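{- Assume the $ABC$-Conjecture. Let $f(x)\in\mathbb{Z}[x]$ be nonconstant, let $m$ be a positive integer and let $q_1,\dots,q_m\in\mathbb{Z}$. (1) If $f(x)$ is separable with $\deg f(x)>2$, and for each $j$ with $1\le j\le m$ one has $(y+q_j)^2\mid\prod_{i=1}^m(y+q_i)$ in $\mathbb{Z}[y]$, then the equation $$(y+q_1)\cdots(y+q_m)=f(x)$$ has finitely many integer solutions $(x,y)$. (2) If $m>2$, $q_1,\dots,q_m$ are distinct and $f(x)=\prod_{i=1}^k f_i(x)^{l_i}$, where $k$ is a positive integer, $f_i(x)\in\mathbb{Z}[x]$ and the $l_i\ge 2$ are integers for $1\le i\le k$, then the equation $$(y+q_1)\cdots(y+q_m)=f(x)$$ has finitely many integer solutions $(x,y)$.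
   Context: A polynomial is separable if it has no repeated roots (in $\mathbb{C}$). The $ABC$-Conjecture is the following assertion: for every fixed $\epsilon>0$ there is a constant $C_\epsilon$ such that, whenever $a,b,c$ are coprime positive integers with $a+b=c$, one has $c\le C_\epsilon\,N(a,b,c)^{1+\epsilon}$, where $N(a,b,c)$ is the product of the distinct prime divisors of $abc$. -}

module Defs where

open import Algebra.Bundles.Raw using (RawRing)
import Algebra.Definitions.RawSemiring
open import Data.Integer.Base as ℤ using (ℤ)
open import Data.List.Base using (List; []; _∷_; map; foldr; filter; upTo)
open import Data.List.Membership.Propositional using (_∈_)
open import Data.Nat.Base as ℕ using (ℕ; zero; suc)
import Data.Nat.Properties as ℕ
open import Data.Nat.Divisibility using (_∣?_)
open import Data.Nat.GCD using (gcd)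
open import Data.Nat.ListAction using (product)
open import Data.Nat.Primality using (prime?)
open import Data.Product.Base using (∃-syntax; _×_; _,_)
open import Data.Rational.Base as ℚ using (ℚ; 0ℚ; 1ℚ; ½)
import Data.Rational.Properties as ℚ
open import Data.Rational.Solver using (module +-*-Solver)
open import Level using (Level; 0ℓ)
open import Relation.Binary.PropositionalEquality
open import Relation.Nullary using (¬_)
open import Relation.Nullary.Decidable using (_×-dec_)

FinitelyMany : {A : Set} → (A → Set) → Set
FinitelyMany {A} P = ∃[ xs ] (∀ (a : A) → P a → a ∈ xs)

------------------------------------------------------------------------
-- The ABC-Conjecture

radical : ℕ → ℕ
radical n = product (filter (λ p → prime? p ×-dec p ∣? n) (upTo (suc n)))

-- ε = r / s ranges over the positive rationals and C over the naturals;
-- the bound c ≤ C · N^(1 + r/s) is raised to the power s, so that only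
-- natural exponents occur.  As N ≥ 1, a smaller ε gives a sharper bound,
-- so this is the same as asking it for all real ε > 0 and real C.
ABC-Conjecture : Set
ABC-Conjecture =
  ∀ (r s : ℕ) → 0 ℕ.< r → 0 ℕ.< s →
  ∃[ C ] (∀ (a b c : ℕ) → 0 ℕ.< a → 0 ℕ.< b → 0 ℕ.< c →
          gcd (gcd a b) c ≡ 1 → a ℕ.+ b ≡ c →
          c ℕ.^ s ℕ.≤ C ℕ.^ s ℕ.* radical (a ℕ.* b ℕ.* c) ℕ.^ (s ℕ.+ r))

------------------------------------------------------------------------
-- Polynomials in one variable

-- Lists of coefficients, constant term first.  Trailing zeros are
-- allowed, so equality of polynomials is _≈_ and not _≡_.
module Polynomial {c ℓ : Level} (R : RawRing c ℓ) where

  private module R = RawRing R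

  infix  4 _≈_
  infixl 6 _+_
  infixl 7 _*_
  infix  9 X+_

  Poly : Set c
  Poly = List R.Carrier

  coeff : Poly → ℕ → R.Carrier
  coeff []      n       = R.0#
  coeff (a ∷ p) zero    = a
  coeff (a ∷ p) (suc n) = coeff p n

  eval : Poly → R.Carrier → R.Carrier
  eval p x = foldr (λ a r → a R.+ x R.* r) R.0# p

  -- the polynomial X + a
  X+_ : R.Carrier → Poly
  X+ a = a ∷ R.1# ∷ []

  _≈_ : Poly → Poly → Set ℓ
  p ≈ q = ∀ n → coeff p n R.≈ coeff q n

  _+_ : Poly → Poly → Poly
  []      + q       = q
  (a ∷ p) + []      = a ∷ p
  (a ∷ p) + (b ∷ q) = (a R.+ b) ∷ (p + q)

  _*_ : Poly → Poly → Poly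
  []      * q = []
  (a ∷ p) * q = map (a R.*_) q + (R.0# ∷ (p * q))

  rawRing : RawRing c ℓ
  rawRing = record
    { Carrier = Poly
    ; _≈_     = _≈_
    ; _+_     = _+_
    ; _*_     = _*_
    ; -_      = map R.-_
    ; 0#      = []
    ; 1#      = R.1# ∷ []
    }

  -- _∣_ is divisibility in R[X] itself: the cofactor lies in R[X].
  open Algebra.Definitions.RawSemiring (RawRing.rawSemiring rawRing) public
    using (_∣_; _^_)
    renaming (product to ∏)

-- Products of integers indexed by Fin n.
open Algebra.Definitions.RawSemiring (RawRing.rawSemiring ℤ.+-*-rawRing) public
  using ()
  renaming (product to ∏ℤ)

module ℤ[X] = Polynomial ℤ.+-*-rawRing

-- HasDegree f d is uninhabited when f is the zero polynomial.
HasDegree : ℤ[X].Poly → ℕ → Set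
HasDegree f d = ℤ[X].coeff f d ≢ ℤ.0ℤ × (∀ n → d ℕ.< n → ℤ[X].coeff f n ≡ ℤ.0ℤ)

Nonconstant : ℤ[X].Poly → Set
Nonconstant f = ∃[ d ] (HasDegree f d × 0 ℕ.< d)

------------------------------------------------------------------------
-- Real numbers: Cauchy sequences of rationals with termwise operations,
-- two sequences being equal when their difference tends to 0

record ℝ : Set where
  field
    seq    : ℕ → ℚ
    cauchy : ∀ ε → 0ℚ ℚ.< ε →
             ∃[ N ] (∀ m n → N ℕ.≤ m → N ℕ.≤ n → ℚ.∣ seq m ℚ.- seq n ∣ ℚ.< ε)

open ℝ

_≈ᴿ_ : ℝ → ℝ → Set
x ≈ᴿ y = ∀ ε → 0ℚ ℚ.< ε →
         ∃[ N ] (∀ n → N ℕ.≤ n → ℚ.∣ seq x n ℚ.- seq y n ∣ ℚ.< ε)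

fromℚ : ℚ → ℝ
fromℚ p .seq    _      = p
fromℚ p .cauchy ε 0<ε  = 0 , λ _ _ _ _ →
  subst (λ d → ℚ.∣ d ∣ ℚ.< ε) (sym (ℚ.+-inverseʳ p)) 0<ε

_+ᴿ_ : ℝ → ℝ → ℝ
(x +ᴿ y) .seq    n     = seq x n ℚ.+ seq y n
(x +ᴿ y) .cauchy ε 0<ε =
  let
    0<½ε : 0ℚ ℚ.< ½ ℚ.* ε
    0<½ε = ℚ.positive⁻¹ _ {{ℚ.pos*pos⇒pos ½ ε {{ℚ.positive 0<ε}}}}
    M , hx = cauchy x _ 0<½ε
    N , hy = cauchy y _ 0<½ε
  in M ℕ.⊔ N , λ m n m≥ n≥ →
    let
      open ℚ.≤-Reasoning
      a = seq x m; a′ = seq x n; b = seq y m; b′ = seq y n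
    in begin-strict
      ℚ.∣ (a ℚ.+ b) ℚ.- (a′ ℚ.+ b′) ∣
        ≡⟨ cong ℚ.∣_∣ (solve 4 (λ a a′ b b′ →
             (a :+ b) :- (a′ :+ b′) := (a :- a′) :+ (b :- b′)) refl a a′ b b′) ⟩
      ℚ.∣ (a ℚ.- a′) ℚ.+ (b ℚ.- b′) ∣
        ≤⟨ ℚ.∣p+q∣≤∣p∣+∣q∣ (a ℚ.- a′) (b ℚ.- b′) ⟩
      ℚ.∣ a ℚ.- a′ ∣ ℚ.+ ℚ.∣ b ℚ.- b′ ∣
        <⟨ ℚ.+-mono-< (hx m n (ℕ.m⊔n≤o⇒m≤o M N m≥) (ℕ.m⊔n≤o⇒m≤o M N n≥))
                      (hy m n (ℕ.m⊔n≤o⇒n≤o M N m≥) (ℕ.m⊔n≤o⇒n≤o M N n≥)) ⟩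
      ½ ℚ.* ε ℚ.+ ½ ℚ.* ε
        ≡⟨ ℚ.*-distribʳ-+ ε ½ ½ ⟨
      1ℚ ℚ.* ε
        ≡⟨ ℚ.*-identityˡ ε ⟩
      ε ∎
  where open +-*-Solver

-ᴿ_ : ℝ → ℝ
(-ᴿ x) .seq    n     = ℚ.- seq x n
(-ᴿ x) .cauchy ε 0<ε =
  let N , h = cauchy x ε 0<ε
  in N , λ m n m≥ n≥ → subst (ℚ._< ε)
       (trans (sym (ℚ.∣-p∣≡∣p∣ (seq x m ℚ.- seq x n)))
              (cong ℚ.∣_∣ (ℚ.neg-distrib-+ (seq x m) (ℚ.- seq x n))))
       (h m n m≥ n≥)

private
  eventually-bounded : ∀ x →
    ∃[ N ] ∃[ B ] (0ℚ ℚ.< B × (∀ n → N ℕ.≤ n → ℚ.∣ seq x n ∣ ℚ.≤ B))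
  eventually-bounded x =
    let
      N , h = cauchy x 1ℚ (ℚ.positive⁻¹ 1ℚ)
      c = seq x N
    in N , 1ℚ ℚ.+ ℚ.∣ c ∣
       , ℚ.+-mono-<-≤ (ℚ.positive⁻¹ 1ℚ) (ℚ.0≤∣p∣ c)
       , λ n n≥ →
      let
        open ℚ.≤-Reasoning
        a = seq x n
      in begin
        ℚ.∣ a ∣
          ≡⟨ cong ℚ.∣_∣ (solve 2 (λ a c → a := (a :- c) :+ c) refl a c) ⟩
        ℚ.∣ (a ℚ.- c) ℚ.+ c ∣
          ≤⟨ ℚ.∣p+q∣≤∣p∣+∣q∣ (a ℚ.- c) c ⟩
        ℚ.∣ a ℚ.- c ∣ ℚ.+ ℚ.∣ c ∣
          ≤⟨ ℚ.+-monoˡ-≤ ℚ.∣ c ∣ (ℚ.<⇒≤ (h n N n≥ ℕ.≤-refl)) ⟩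
        1ℚ ℚ.+ ℚ.∣ c ∣ ∎
    where open +-*-Solver

_*ᴿ_ : ℝ → ℝ → ℝ
(x *ᴿ y) .seq    n     = seq x n ℚ.* seq y n
(x *ᴿ y) .cauchy ε 0<ε =
  let
    K , A , 0<A , hA = eventually-bounded x
    L , B , 0<B , hB = eventually-bounded y
    instance
      A-pos : ℚ.Positive A
      A-pos = ℚ.positive 0<A
      B-pos : ℚ.Positive B
      B-pos = ℚ.positive 0<B
      A+B-pos : ℚ.Positive (A ℚ.+ B)
      A+B-pos = ℚ.pos+pos⇒pos A B
      A+B-nonZero : ℚ.NonZero (A ℚ.+ B)
      A+B-nonZero = ℚ.pos⇒nonZero (A ℚ.+ B)
    δ = (ℚ.1/ (A ℚ.+ B)) ℚ.* ε
    0<δ : 0ℚ ℚ.< δ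
    0<δ = ℚ.positive⁻¹ δ {{ℚ.pos*pos⇒pos (ℚ.1/ (A ℚ.+ B)) {{ℚ.1/pos⇒pos (A ℚ.+ B)}}
                                          ε {{ℚ.positive 0<ε}}}}
    M , hx = cauchy x δ 0<δ
    N , hy = cauchy y δ 0<δ
  in (K ℕ.⊔ L) ℕ.⊔ (M ℕ.⊔ N) , λ m n m≥ n≥ →
    let
      open ℚ.≤-Reasoning
      a = seq x m; a′ = seq x n; b = seq y m; b′ = seq y n
      KL≤m = ℕ.m⊔n≤o⇒m≤o (K ℕ.⊔ L) (M ℕ.⊔ N) m≥
      KL≤n = ℕ.m⊔n≤o⇒m≤o (K ℕ.⊔ L) (M ℕ.⊔ N) n≥
      MN≤m = ℕ.m⊔n≤o⇒n≤o (K ℕ.⊔ L) (M ℕ.⊔ N) m≥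
      MN≤n = ℕ.m⊔n≤o⇒n≤o (K ℕ.⊔ L) (M ℕ.⊔ N) n≥
    in begin-strict
      ℚ.∣ a ℚ.* b ℚ.- a′ ℚ.* b′ ∣
        ≡⟨ cong ℚ.∣_∣ (solve 4 (λ a a′ b b′ →
             a :* b :- a′ :* b′ := a :* (b :- b′) :+ b′ :* (a :- a′)) refl a a′ b b′) ⟩
      ℚ.∣ a ℚ.* (b ℚ.- b′) ℚ.+ b′ ℚ.* (a ℚ.- a′) ∣
        ≤⟨ ℚ.∣p+q∣≤∣p∣+∣q∣ (a ℚ.* (b ℚ.- b′)) (b′ ℚ.* (a ℚ.- a′)) ⟩
      ℚ.∣ a ℚ.* (b ℚ.- b′) ∣ ℚ.+ ℚ.∣ b′ ℚ.* (a ℚ.- a′) ∣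
        <⟨ ℚ.+-mono-<
             (product-< a (b ℚ.- b′) A δ (hA m (ℕ.m⊔n≤o⇒m≤o K L KL≤m))
                (hy m n (ℕ.m⊔n≤o⇒n≤o M N MN≤m) (ℕ.m⊔n≤o⇒n≤o M N MN≤n)))
             (product-< b′ (a ℚ.- a′) B δ (hB n (ℕ.m⊔n≤o⇒n≤o K L KL≤n))
                (hx m n (ℕ.m⊔n≤o⇒m≤o M N MN≤m) (ℕ.m⊔n≤o⇒m≤o M N MN≤n))) ⟩
      A ℚ.* δ ℚ.+ B ℚ.* δ
        ≡⟨ ℚ.*-distribʳ-+ δ A B ⟨
      (A ℚ.+ B) ℚ.* δ
        ≡⟨ ℚ.*-assoc (A ℚ.+ B) (ℚ.1/ (A ℚ.+ B)) ε ⟨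
      (A ℚ.+ B) ℚ.* (ℚ.1/ (A ℚ.+ B)) ℚ.* ε
        ≡⟨ cong (ℚ._* ε) (ℚ.*-inverseʳ (A ℚ.+ B)) ⟩
      1ℚ ℚ.* ε
        ≡⟨ ℚ.*-identityˡ ε ⟩
      ε ∎
  where
  open +-*-Solver
  product-< : ∀ p q P Q {{_ : ℚ.Positive P}} →
              ℚ.∣ p ∣ ℚ.≤ P → ℚ.∣ q ∣ ℚ.< Q → ℚ.∣ p ℚ.* q ∣ ℚ.< P ℚ.* Q
  product-< p q P Q p≤P q<Q = begin-strict
    ℚ.∣ p ℚ.* q ∣            ≡⟨ ℚ.∣p*q∣≡∣p∣*∣q∣ p q ⟩
    ℚ.∣ p ∣ ℚ.* ℚ.∣ q ∣      ≤⟨ ℚ.*-monoʳ-≤-nonNeg ℚ.∣ q ∣ {{ℚ.∣-∣-nonNeg q}} p≤P ⟩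
    P ℚ.* ℚ.∣ q ∣            <⟨ ℚ.*-monoʳ-<-pos P q<Q ⟩
    P ℚ.* Q                  ∎
    where open ℚ.≤-Reasoning

------------------------------------------------------------------------
-- Complex numbers

record ℂ : Set where
  constructor _+i_
  field
    re im : ℝ

fromℤ : ℤ → ℂ
fromℤ n = fromℚ (n ℚ./ 1) +i fromℚ 0ℚ

ℂ-rawRing : RawRing 0ℓ 0ℓ
ℂ-rawRing = record
  { Carrier = ℂ
  ; _≈_     = λ (a +i b) (c +i d) → (a ≈ᴿ c) × (b ≈ᴿ d)
  ; _+_     = λ (a +i b) (c +i d) → (a +ᴿ c) +i (b +ᴿ d)
  ; _*_     = λ (a +i b) (c +i d) →
                ((a *ᴿ c) +ᴿ (-ᴿ (b *ᴿ d))) +i ((a *ᴿ d) +ᴿ (b *ᴿ c))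
  ; -_      = λ (a +i b) → (-ᴿ a) +i (-ᴿ b)
  ; 0#      = fromℤ ℤ.0ℤ
  ; 1#      = fromℤ ℤ.1ℤ
  }

module ℂ[X] = Polynomial ℂ-rawRing

-- z is a root of multiplicity at least 2: (X - z)² divides f in ℂ[X].
IsRepeatedRoot : ℤ[X].Poly → ℂ → Set
IsRepeatedRoot f z = ((ℂ[X].X+ (RawRing.-_ ℂ-rawRing z)) ℂ[X].^ 2) ℂ[X].∣ map fromℤ f

Separable : ℤ[X].Poly → Set
Separable f = ∀ z → ¬ IsRepeatedRoot f z

{-# OPTIONS --safe #-}
-- Both parts bound the x at which a squarefree F ∈ ℤ[X] of degree at least 3
-- has a powerful value: in (1) F = f, since the product of the y + qᵢ is
-- powerful; in (2) F = (X + q₁) ⋯ (X + qₘ), since f(x) is powerful.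
--
-- As in Belyi's theorem, there are a polynomial φ, a constant c ≠ 0 and K
-- with κ φ (φ - c) = F φ′ K: first replace F by polynomials of smaller degree
-- vanishing at critical values, until all roots are integers, then merge three
-- integer roots a < b < c by (X - a)^(b-a) (X - c)^(c-b).  ABC applied
-- to φ(x), c and φ(x) - c, whose radical is at most of order rad F(x) · |K(x)|
-- ≤ |F(x)|^½ |K(x)|, then contradicts degrees unless deg F ≤ 2.
--
-- That a separable f is squarefree over ℚ needs a complex root of a common
-- factor g of f and f′, hence the fundamental theorem of algebra.  If |g| were
-- bounded below on ℚ(i), averages of 1/g over circles would hardly depend on
-- the radius (a discrete Cauchy theorem), although 1/g is small on large
-- circles; so g takes small values, and Newton's method gives a Cauchy
-- sequence converging to a root.
module Submission where

-- Why degree 3 is the threshold: let n = deg φ and d = deg F. The identity gives deg K = n + 1 - d,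
-- so the radical of the ABC triple is O(|x|^(n + 1 - d/2)), while φ(x) has size |x|^n. For d ≥ 3
-- the exponent is at most n - 1/2, and ε = 1/(2n) suffices, because (1 + 1/(2n)) (n - 1/2) < n.
-- This count needs exact multiplicities: F φ′ has to divide φ (φ - c) itself. The descent only
-- yields divisibility of a power; the exponent is removed at the end, from squarefreeness of F and
-- from φ′ dividing the derivative of φ (φ - c). Roots are never adjoined: "every root of p is a
-- root of q" is expressed by p dividing a power of q. The values φ(x) and c need not be coprime,
-- but their common factor divides the fixed c and costs only a constant. On circles, powers of a
-- rational rotation replace trigonometry. Such a walk does not close up, but its two ends
-- contribute a bounded term, negligible against a sum of N² values. The grid is finite and
-- rational, so a point with a small value is found by search.

open import Defs

-- Evaluation of integer polynomials in a commutative ring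

module PolynomialEvaluation where

  open import Algebra.Bundles using (CommutativeRing)
  open import Data.Integer.Base using (ℤ; +_; 0ℤ)
  import Data.Integer.Base as ℤ
  open import Data.List.Base using ([]; _∷_; map; foldr)
  open import Data.Maybe.Base using (nothing)
  open import Data.Nat.Base using (ℕ; suc)
  open import Level using (0ℓ)
  open import Data.List.Relation.Unary.All using (All; []; _∷_)
  open import Relation.Binary.PropositionalEquality as ≡ using (_≡_; refl)
  import Data.Integer.Properties as ℤ
  import Tactic.RingSolver.NonReflective as Solver
  open import Tactic.RingSolver.Core.AlmostCommutativeRing using (AlmostCommutativeRing; fromCommutativeRing)

  open ℤ[X] public using (Poly; coeff) renaming (_+_ to _⊕_; _*_ to _⊗_)

  -- For n = 0 this is X p′ and for n = 1 it is (X p)′; each increase of n adds one more p.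
  weightedFrom : ℕ → Poly → Poly
  weightedFrom n []      = []
  weightedFrom n (a ∷ p) = + n ℤ.* a ∷ weightedFrom (suc n) p

  deriv : Poly → Poly
  deriv []      = []
  deriv (_ ∷ p) = weightedFrom 1 p

  _∘ₚ_ : Poly → Poly → Poly
  []      ∘ₚ g = []
  (a ∷ p) ∘ₚ g = (a ∷ []) ⊕ (g ⊗ (p ∘ₚ g))

  IsZero : Poly → Set
  IsZero = All (_≡ 0ℤ)

  -- Instantiated twice: over ℤ for growth and divisibility, over ℚ(i) for the search for a complex
  -- root.
  module Evaluation
    (R : CommutativeRing 0ℓ 0ℓ)
    (ι : ℤ → CommutativeRing.Carrier R)
    (ι-0 : CommutativeRing._≈_ R (ι 0ℤ) (CommutativeRing.0# R))
    (ι-+ : ∀ a b → CommutativeRing._≈_ R (ι (a ℤ.+ b)) (CommutativeRing._+_ R (ι a) (ι b)))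
    (ι-* : ∀ a b → CommutativeRing._≈_ R (ι (a ℤ.* b)) (CommutativeRing._*_ R (ι a) (ι b))) where

    open CommutativeRing R hiding (zero)
    import Relation.Binary.Reasoning.Setoid setoid as ≈-Reasoning

    acr : AlmostCommutativeRing 0ℓ 0ℓ
    acr = fromCommutativeRing R (λ _ → nothing)

    open Solver acr using (solve; _⊜_) renaming (_⊕_ to _:+_; _⊗_ to _:*_)

    ev : Poly → Carrier → Carrier
    ev p z = foldr (λ a r → ι a + z * r) 0# p

    ev-⊕ : ∀ p q z → ev (p ⊕ q) z ≈ ev p z + ev q z
    ev-⊕ []      q       z = sym (+-identityˡ _)
    ev-⊕ (a ∷ p) []      z = sym (+-identityʳ _)
    ev-⊕ (a ∷ p) (b ∷ q) z = begin
      ι (a ℤ.+ b) + z * ev (p ⊕ q) z         ≈⟨ +-cong (ι-+ a b) (*-congˡ (ev-⊕ p q z)) ⟩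
      ι a + ι b + z * (ev p z + ev q z)      ≈⟨ rearrange (ι a) (ι b) z (ev p z) (ev q z) ⟩
      ι a + z * ev p z + (ι b + z * ev q z)  ∎
      where
      open ≈-Reasoning
      rearrange : ∀ a b z p q → a + b + z * (p + q) ≈ a + z * p + (b + z * q)
      rearrange = solve 5 (λ a b z p q → (a :+ b :+ z :* (p :+ q)) ⊜ (a :+ z :* p :+ (b :+ z :* q))) (CommutativeRing.refl R)

    ev-scale : ∀ a p z → ev (map (a ℤ.*_) p) z ≈ ι a * ev p z
    ev-scale a []      z = sym (zeroʳ _)
    ev-scale a (b ∷ p) z = begin
      ι (a ℤ.* b) + z * ev (map (a ℤ.*_) p) z  ≈⟨ +-cong (ι-* a b) (*-congˡ (ev-scale a p z)) ⟩
      ι a * ι b + z * (ι a * ev p z)           ≈⟨ rearrange (ι a) (ι b) z (ev p z) ⟩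
      ι a * (ι b + z * ev p z)                 ∎
      where
      open ≈-Reasoning
      rearrange : ∀ a b z p → a * b + z * (a * p) ≈ a * (b + z * p)
      rearrange = solve 4 (λ a b z p → (a :* b :+ z :* (a :* p)) ⊜ (a :* (b :+ z :* p))) (CommutativeRing.refl R)

    ev-shift : ∀ p z → ev (0ℤ ∷ p) z ≈ z * ev p z
    ev-shift p z = trans (+-congʳ ι-0) (+-identityˡ _)

    ev-⊗ : ∀ p q z → ev (p ⊗ q) z ≈ ev p z * ev q z
    ev-⊗ []      q z = sym (zeroˡ _)
    ev-⊗ (a ∷ p) q z = begin
      ev (map (a ℤ.*_) q ⊕ (0ℤ ∷ (p ⊗ q))) z             ≈⟨ ev-⊕ (map (a ℤ.*_) q) (0ℤ ∷ (p ⊗ q)) z ⟩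
      ev (map (a ℤ.*_) q) z + ev (0ℤ ∷ (p ⊗ q)) z        ≈⟨ +-cong (ev-scale a q z) (ev-shift (p ⊗ q) z) ⟩
      ι a * ev q z + z * ev (p ⊗ q) z                    ≈⟨ +-congˡ (*-congˡ (ev-⊗ p q z)) ⟩
      ι a * ev q z + z * (ev p z * ev q z)               ≈⟨ rearrange (ι a) (ev q z) z (ev p z) ⟩
      (ι a + z * ev p z) * ev q z                        ∎
      where
      open ≈-Reasoning
      rearrange : ∀ a q z p → a * q + z * (p * q) ≈ (a + z * p) * q
      rearrange = solve 4 (λ a q z p → (a :* q :+ z :* (p :* q)) ⊜ ((a :+ z :* p) :* q)) (CommutativeRing.refl R)

    ev-const : ∀ a z → ev (a ∷ []) z ≈ ι a
    ev-const a z = trans (+-congˡ (zeroʳ z)) (+-identityʳ _)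

    ev-IsZero : ∀ {p} → IsZero p → ∀ z → ev p z ≈ 0#
    ev-IsZero []         z = refl′ where refl′ = CommutativeRing.refl R
    ev-IsZero (≡.refl ∷ h) z = trans (+-cong ι-0 (trans (*-congˡ (ev-IsZero h z)) (zeroʳ z))) (+-identityʳ _)

    ev-weightedFrom-suc : ∀ n p z → ev (weightedFrom (suc n) p) z ≈ ev (weightedFrom n p) z + ev p z
    ev-weightedFrom-suc n []      z = sym (+-identityʳ _)
    ev-weightedFrom-suc n (a ∷ p) z = begin
      ι (+ suc n ℤ.* a) + z * ev (weightedFrom (suc (suc n)) p) z
        ≈⟨ +-cong (trans (reflexive (≡.cong ι (suc-* a))) (ι-+ a (+ n ℤ.* a)))
                  (*-congˡ (ev-weightedFrom-suc (suc n) p z)) ⟩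
      ι a + ι (+ n ℤ.* a) + z * (ev (weightedFrom (suc n) p) z + ev p z)
        ≈⟨ rearrange (ι a) (ι (+ n ℤ.* a)) z (ev (weightedFrom (suc n) p) z) (ev p z) ⟩
      ι (+ n ℤ.* a) + z * ev (weightedFrom (suc n) p) z + (ι a + z * ev p z) ∎
      where
      open ≈-Reasoning
      suc-* : ∀ a → + suc n ℤ.* a ≡ a ℤ.+ + n ℤ.* a
      suc-* a = ℤ.suc-* (+ n) a
      rearrange : ∀ a b z p q → a + b + z * (p + q) ≈ b + z * p + (a + z * q)
      rearrange = solve 5 (λ a b z p q → (a :+ b :+ z :* (p :+ q)) ⊜ (b :+ z :* p :+ (a :+ z :* q))) (CommutativeRing.refl R)

    ev-weightedFrom-0 : ∀ p z → ev (weightedFrom 0 p) z ≈ z * ev (deriv p) z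
    ev-weightedFrom-0 []      z = sym (zeroʳ z)
    ev-weightedFrom-0 (a ∷ p) z =
      trans (+-congʳ (trans (reflexive (≡.cong ι (ℤ.*-zeroˡ a))) ι-0)) (+-identityˡ _)

    ev-deriv-∷ : ∀ a p z → ev (deriv (a ∷ p)) z ≈ ev p z + z * ev (deriv p) z
    ev-deriv-∷ a p z = trans (ev-weightedFrom-suc 0 p z)
      (trans (+-comm _ _) (+-congˡ (ev-weightedFrom-0 p z)))

-- Growth and derivatives of integer polynomials

module IntegerPolynomials where

  open PolynomialEvaluation
  open import Data.Empty using (⊥-elim)
  open import Data.Integer.Base using (ℤ; +_; 0ℤ; -1ℤ; _+_; _*_; _-_; -_) renaming (∣_∣ to abs)
  import Data.Integer.Properties as ℤ
  open import Data.Integer.Tactic.RingSolver using (solve-∀)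
  open import Data.List.Base using ([]; _∷_; map; _∷ʳ_; length)
  open import Data.List.Relation.Unary.All using ([]; _∷_)
  open import Data.Nat.Base as ℕ using (ℕ; suc; _≤_; _<_; z≤n; s≤s; _^_; _⊔_)
  import Data.Nat.Properties as ℕ
  import Data.Nat.Tactic.RingSolver as ℕ
  open import Data.Product.Base using (∃-syntax; _×_; _,_)
  open import Data.Sum.Base using (_⊎_; inj₁; inj₂)
  open import Relation.Binary.PropositionalEquality
  open import Relation.Nullary using (yes; no)

  open Evaluation ℤ.+-*-commutativeRing (λ a → a) refl (λ _ _ → refl) (λ _ _ → refl) public
    using (ev; ev-⊕; ev-scale; ev-shift; ev-⊗; ev-const; ev-IsZero; ev-deriv-∷; ev-weightedFrom-suc)

  ∣+∣≥ : ∀ a b → (abs a) ≤ abs (a + b) ℕ.+ (abs b)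
  ∣+∣≥ a b = subst (λ c → (abs c) ≤ abs (a + b) ℕ.+ (abs b)) (cancel a b)
               (subst (λ n → abs (a + b - b) ≤ abs (a + b) ℕ.+ n) (ℤ.∣-i∣≡∣i∣ b) (ℤ.∣i+j∣≤∣i∣+∣j∣ (a + b) (- b)))
    where
    cancel : ∀ a b → a + b - b ≡ a
    cancel = solve-∀

  ∣∣≢0 : ∀ {a} → a ≢ 0ℤ → 1 ≤ (abs a)
  ∣∣≢0 {a} a≢0 = ℕ.n≢0⇒n>0 (λ e → a≢0 (ℤ.∣i∣≡0⇒i≡0 e))

  *-≢0 : ∀ {a b} → a ≢ 0ℤ → b ≢ 0ℤ → a * b ≢ 0ℤ
  *-≢0 {a} a≢0 b≢0 e with ℤ.i*j≡0⇒i≡0∨j≡0 a e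
  ... | inj₁ z = a≢0 z
  ... | inj₂ z = b≢0 z

  1≤^ : ∀ {m} n → 1 ≤ m → 1 ≤ m ^ n
  1≤^ n (s≤s _) = ℕ.m^n>0 _ n

  growth-upper : ∀ p γ → ∃[ C ] (∀ x → 1 ≤ (abs x) → abs (ev (p ∷ʳ γ) x) ≤ C ℕ.* (abs x) ^ length p)
  growth-upper [] γ = (abs γ) , λ x _ → ℕ.≤-reflexive (trans (cong abs (ev-const γ x)) (sym (ℕ.*-identityʳ _)))
  growth-upper (a ∷ p) γ = let (C , h) = growth-upper p γ in (abs a) ℕ.+ C , λ x 1≤x → begin
    abs (a + x * ev (p ∷ʳ γ) x)                  ≤⟨ ℤ.∣i+j∣≤∣i∣+∣j∣ a _ ⟩
    (abs a) ℕ.+ abs (x * ev (p ∷ʳ γ) x)            ≡⟨ cong (abs a ℕ.+_) (ℤ.abs-* x _) ⟩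
    (abs a) ℕ.+ (abs x) ℕ.* abs (ev (p ∷ʳ γ) x)
      ≤⟨ ℕ.+-mono-≤ (ℕ.m≤m*n (abs a) _ {{ℕ.>-nonZero (1≤^ (suc (length p)) 1≤x)}}) (ℕ.*-monoʳ-≤ (abs x) (h x 1≤x)) ⟩
    (abs a) ℕ.* (abs x ^ suc (length p)) ℕ.+ (abs x) ℕ.* (C ℕ.* (abs x) ^ length p)
      ≡⟨ collect (abs a) C (abs x) (abs x ^ length p) ⟩
    (abs a ℕ.+ C) ℕ.* (abs x) ^ suc (length p)   ∎
    where
    open ℕ.≤-Reasoning
    collect : ∀ a C x y → a ℕ.* (x ℕ.* y) ℕ.+ x ℕ.* (C ℕ.* y) ≡ (a ℕ.+ C) ℕ.* (x ℕ.* y)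
    collect = ℕ.solve-∀

  -- Adding a constant term `a` to X p leaves at least half of |x p(x)| once |x| exceeds 2 C |a|, so
  -- the constant in the bound doubles with each coefficient.
  growth-lower : ∀ p γ → γ ≢ 0ℤ →
    ∃[ C ] ∃[ B ] (∀ x → B ≤ (abs x) → (abs x) ^ length p ≤ C ℕ.* abs (ev (p ∷ʳ γ) x))
  growth-lower [] γ γ≢0 = 1 , 0 , λ x _ →
    subst (1 ≤_) (trans (cong abs (sym (ev-const γ x))) (sym (ℕ.*-identityˡ _))) (∣∣≢0 γ≢0)
  growth-lower (a ∷ p) γ γ≢0 = let (C , B , h) = growth-lower p γ γ≢0 in
    2 ℕ.* C , suc (B ⊔ (2 ℕ.* (C ℕ.* (abs a)))) , λ x B≤x → ℕ.+-cancelʳ-≤ (abs x ^ suc (length p)) _ _ (begin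
      (abs x) ^ suc (length p) ℕ.+ (abs x) ^ suc (length p)
        ≡⟨ double (abs x) (abs x ^ length p) ⟩
      2 ℕ.* (abs x ℕ.* (abs x) ^ length p)
        ≤⟨ ℕ.*-monoʳ-≤ 2 (ℕ.*-monoʳ-≤ (abs x) (h x (B≤ x B B≤x))) ⟩
      2 ℕ.* (abs x ℕ.* (C ℕ.* abs (ev (p ∷ʳ γ) x)))
        ≡⟨ swap (abs x) C (abs (ev (p ∷ʳ γ) x)) ⟩
      2 ℕ.* (C ℕ.* (abs x ℕ.* abs (ev (p ∷ʳ γ) x)))
        ≡⟨ cong (λ t → 2 ℕ.* (C ℕ.* t)) (ℤ.abs-* x _) ⟨
      2 ℕ.* (C ℕ.* abs (x * ev (p ∷ʳ γ) x))
        ≤⟨ ℕ.*-monoʳ-≤ 2 (ℕ.*-monoʳ-≤ C (∣+∣≥ (x * ev (p ∷ʳ γ) x) a)) ⟩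
      2 ℕ.* (C ℕ.* (abs (x * ev (p ∷ʳ γ) x + a) ℕ.+ (abs a)))
        ≡⟨ cong (λ t → 2 ℕ.* (C ℕ.* (abs t ℕ.+ (abs a)))) (ℤ.+-comm (x * ev (p ∷ʳ γ) x) a) ⟩
      2 ℕ.* (C ℕ.* (abs (a + x * ev (p ∷ʳ γ) x) ℕ.+ (abs a)))
        ≡⟨ expand C (abs (a + x * ev (p ∷ʳ γ) x)) (abs a) ⟩
      2 ℕ.* C ℕ.* abs (a + x * ev (p ∷ʳ γ) x) ℕ.+ 2 ℕ.* (C ℕ.* (abs a))
        ≤⟨ ℕ.+-monoʳ-≤ (2 ℕ.* C ℕ.* abs (a + x * ev (p ∷ʳ γ) x))
             (ℕ.≤-trans (ℕ.m≤n⊔m B _) (ℕ.≤-trans (ℕ.n≤1+n _) (ℕ.≤-trans B≤x (ℕ.m≤m*n (abs x) (abs x ^ length p)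
                {{ℕ.>-nonZero (1≤^ (length p) (ℕ.≤-trans (s≤s z≤n) B≤x))}})))) ⟩
      2 ℕ.* C ℕ.* abs (a + x * ev (p ∷ʳ γ) x) ℕ.+ (abs x) ^ suc (length p) ∎)
    where
    open ℕ.≤-Reasoning
    B≤ : ∀ x B {n} → suc (B ⊔ n) ≤ (abs x) → B ≤ (abs x)
    B≤ x B {n} le = ℕ.≤-trans (ℕ.m≤m⊔n B n) (ℕ.≤-trans (ℕ.n≤1+n _) le)
    double : ∀ x y → x ℕ.* y ℕ.+ x ℕ.* y ≡ 2 ℕ.* (x ℕ.* y)
    double = ℕ.solve-∀
    swap : ∀ x C y → 2 ℕ.* (x ℕ.* (C ℕ.* y)) ≡ 2 ℕ.* (C ℕ.* (x ℕ.* y))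
    swap = ℕ.solve-∀
    expand : ∀ C y a → 2 ℕ.* (C ℕ.* (y ℕ.+ a)) ≡ 2 ℕ.* C ℕ.* y ℕ.+ 2 ℕ.* (C ℕ.* a)
    expand = ℕ.solve-∀

  -- A coefficient list may end in zeros. Replacing it, as a function, by `p₀ ∷ʳ γ` makes the degree
  -- `length p₀` and the leading coefficient visible.
  Leading : Poly → Set
  Leading p = ∃[ p₀ ] ∃[ γ ] (γ ≢ 0ℤ × length p₀ < length p × (∀ x → ev p x ≡ ev (p₀ ∷ʳ γ) x))

  leading : ∀ p → IsZero p ⊎ Leading p
  leading []      = inj₁ []
  leading (a ∷ p) with leading p
  ... | inj₂ (p₀ , γ , γ≢0 , l , h) = inj₂ (a ∷ p₀ , γ , γ≢0 , s≤s l , λ x → cong (λ t → a + x * t) (h x))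
  ... | inj₁ z with a ℤ.≟ 0ℤ
  ...   | yes a≡0 = inj₁ (a≡0 ∷ z)
  ...   | no  a≢0 = inj₂ ([] , a , a≢0 , s≤s z≤n , λ x → cong (λ t → a + x * t) (ev-IsZero z x))

  large : ∀ B → B ≤ abs (+ B)
  large B = ℕ.≤-refl

  -- Otherwise `growth-lower` would bound a positive power of a large x by 0. Getting back from
  -- values to coefficients is what later allows identities checked over ℤ to be differentiated and
  -- evaluated at complex arguments.
  vanishing⇒IsZero : ∀ p B → (∀ x → B ≤ (abs x) → ev p x ≡ 0ℤ) → IsZero p
  vanishing⇒IsZero p B h with leading p
  ... | inj₁ z = z
  ... | inj₂ (p₀ , γ , γ≢0 , _ , e) = let (C , B′ , g) = growth-lower p₀ γ γ≢0; N = suc (B ⊔ B′) in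
    ⊥-elim (ℕ.<⇒≱ (1≤^ (length p₀) (s≤s z≤n)) (subst (abs (+ N) ^ length p₀ ≤_)
      (trans (cong (λ t → C ℕ.* (abs t)) (trans (sym (e (+ N))) (h (+ N) (ℕ.≤-trans (ℕ.m≤m⊔n B B′) (ℕ.n≤1+n _)))))
             (ℕ.*-zeroʳ C))
      (g (+ N) (ℕ.≤-trans (ℕ.m≤n⊔m B B′) (ℕ.n≤1+n _)))))

  difference : Poly → Poly → Poly
  difference p q = p ⊕ map (-1ℤ *_) q

  ev-difference : ∀ p q x → ev (difference p q) x ≡ ev p x - ev q x
  ev-difference p q x = trans (ev-⊕ p (map (-1ℤ *_) q) x)
    (cong (_+_ (ev p x)) (trans (ev-scale -1ℤ q x) (ℤ.-1*i≡-i (ev q x))))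

  ev-ext : ∀ p q B → (∀ x → B ≤ (abs x) → ev p x ≡ ev q x) → IsZero (difference p q)
  ev-ext p q B h = vanishing⇒IsZero _ B (λ x le →
    trans (ev-difference p q x) (ℤ.i≡j⇒i-j≡0 (h x le)))

  IsZero-weightedFrom : ∀ n {p} → IsZero p → IsZero (weightedFrom n p)
  IsZero-weightedFrom n []         = []
  IsZero-weightedFrom n (refl ∷ h) = ℤ.*-zeroʳ (+ n) ∷ IsZero-weightedFrom (suc n) h

  IsZero-deriv : ∀ {p} → IsZero p → IsZero (deriv p)
  IsZero-deriv []      = []
  IsZero-deriv (_ ∷ h) = IsZero-weightedFrom 1 h

  deriv-⊕ : ∀ p q x → ev (deriv (p ⊕ q)) x ≡ ev (deriv p) x + ev (deriv q) x
  deriv-⊕ []      q       x = sym (ℤ.+-identityˡ _)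
  deriv-⊕ (a ∷ p) []      x = sym (ℤ.+-identityʳ _)
  deriv-⊕ (a ∷ p) (b ∷ q) x = trans (ev-deriv-∷ (a + b) (p ⊕ q) x)
    (trans (cong₂ (λ s t → s + x * t) (ev-⊕ p q x) (deriv-⊕ p q x))
    (trans (rearrange (ev p x) (ev q x) x (ev (deriv p) x) (ev (deriv q) x))
           (sym (cong₂ _+_ (ev-deriv-∷ a p x) (ev-deriv-∷ b q x)))))
    where
    rearrange : ∀ p q x p′ q′ → p + q + x * (p′ + q′) ≡ p + x * p′ + (q + x * q′)
    rearrange = solve-∀

  deriv-scale : ∀ a p x → ev (deriv (map (a *_) p)) x ≡ a * ev (deriv p) x
  deriv-scale a []      x = sym (ℤ.*-zeroʳ a)
  deriv-scale a (b ∷ p) x = trans (ev-deriv-∷ (a * b) (map (a *_) p) x)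
    (trans (cong₂ (λ s t → s + x * t) (ev-scale a p x) (deriv-scale a p x))
    (trans (rearrange a (ev p x) x (ev (deriv p) x)) (cong (a *_) (sym (ev-deriv-∷ b p x)))))
    where
    rearrange : ∀ a p x p′ → a * p + x * (a * p′) ≡ a * (p + x * p′)
    rearrange = solve-∀

  deriv-⊗ : ∀ p q x → ev (deriv (p ⊗ q)) x ≡ ev (deriv p) x * ev q x + ev p x * ev (deriv q) x
  deriv-⊗ []      q x = sym (trans (cong₂ _+_ (ℤ.*-zeroˡ (ev q x)) (ℤ.*-zeroˡ (ev (deriv q) x))) refl)
  deriv-⊗ (a ∷ p) q x = trans (deriv-⊕ (map (a *_) q) (0ℤ ∷ (p ⊗ q)) x)
    (trans (cong₂ _+_ (deriv-scale a q x) (trans (ev-deriv-∷ 0ℤ (p ⊗ q) x)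
              (cong₂ (λ s t → s + x * t) (ev-⊗ p q x) (deriv-⊗ p q x))))
    (trans (rearrange a x (ev p x) (ev q x) (ev (deriv p) x) (ev (deriv q) x))
           (cong (λ t → t * ev q x + (a + x * ev p x) * ev (deriv q) x) (sym (ev-deriv-∷ a p x)))))
    where
    rearrange : ∀ a x p q p′ q′ →
      a * q′ + (p * q + x * (p′ * q + p * q′)) ≡ (p + x * p′) * q + (a + x * p) * q′
    rearrange = solve-∀

  ev-∘ : ∀ p g x → ev (p ∘ₚ g) x ≡ ev p (ev g x)
  ev-∘ []      g x = refl
  ev-∘ (a ∷ p) g x = trans (ev-⊕ (a ∷ []) (g ⊗ (p ∘ₚ g)) x)
    (cong₂ _+_ (ev-const a x) (trans (ev-⊗ g (p ∘ₚ g) x) (cong (ev g x *_) (ev-∘ p g x))))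

  deriv-∘ : ∀ p g x → ev (deriv (p ∘ₚ g)) x ≡ ev (deriv p) (ev g x) * ev (deriv g) x
  deriv-∘ []      g x = sym (ℤ.*-zeroˡ (ev (deriv g) x))
  deriv-∘ (a ∷ p) g x = trans (deriv-⊕ (a ∷ []) (g ⊗ (p ∘ₚ g)) x)
    (trans (ℤ.+-identityˡ _) (trans (deriv-⊗ g (p ∘ₚ g) x)
    (trans (cong₂ (λ s t → ev (deriv g) x * s + ev g x * t) (ev-∘ p g x) (deriv-∘ p g x))
    (trans (rearrange (ev (deriv g) x) (ev p (ev g x)) (ev g x) (ev (deriv p) (ev g x)))
           (cong (_* ev (deriv g) x) (sym (ev-deriv-∷ a p (ev g x))))))))
    where
    rearrange : ∀ d p g p′ → d * p + g * (p′ * d) ≡ (p + g * p′) * d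
    rearrange = solve-∀

-- Divisibility and greatest common divisors up to denominators

module PolynomialExpressions where

  open PolynomialEvaluation
  open IntegerPolynomials
  open import Data.Empty using (⊥-elim)
  open import Data.Integer.Base using (ℤ; +_; 0ℤ; 1ℤ; -1ℤ; _+_; _*_; _-_; -_; _^_; ≢-nonZero) renaming (∣_∣ to abs)
  import Data.Integer.Properties as ℤ
  open import Data.Integer.Tactic.RingSolver using (solve-∀)
  open import Data.List.Base using ([]; _∷_; map; _∷ʳ_; length; initLast; _∷ʳ′_)
  open import Data.List.Properties using (length-map; length-++)
  open import Data.List.Relation.Unary.All using ([]; _∷_)
  open import Data.Nat.Base as ℕ using (ℕ; zero; suc; _≤_; z≤n; s≤s)
  import Data.Nat.Properties as ℕ
  open import Data.Product.Base using (∃-syntax; _×_; _,_)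
  open import Data.Sum.Base using (inj₁; inj₂)
  open import Relation.Binary.PropositionalEquality
  open import Relation.Nullary using (yes; no)

  infixl 6 _+ᵖ_
  infixl 7 _*ᵖ_
  infixr 8 _^ᵖ_
  infix  9 X+ᵖ_
  infix  4 _≐_ _∣ᵖ_

  -- Formal expressions, so that fn and dn compute and polynomial identities
  -- become identities in ℤ.
  data Pol : Set where
    ⌈_⌉            : Poly → Pol
    constᵖ X+ᵖ_    : ℤ → Pol
    _+ᵖ_ _*ᵖ_ _∘ᵖ_ : Pol → Pol → Pol
    D              : Pol → Pol

  code : Pol → Poly
  code ⌈ p ⌉      = p
  code (constᵖ a) = a ∷ []
  code (X+ᵖ a)    = a ∷ 1ℤ ∷ []
  code (p +ᵖ q)   = code p ⊕ code q
  code (p *ᵖ q)   = code p ⊗ code q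
  code (p ∘ᵖ q)   = code p ∘ₚ code q
  code (D p)      = deriv (code p)

  fn dn : Pol → ℤ → ℤ
  fn ⌈ p ⌉      x = ev p x
  fn (constᵖ a) x = a
  fn (X+ᵖ a)    x = x + a
  fn (p +ᵖ q)   x = fn p x + fn q x
  fn (p *ᵖ q)   x = fn p x * fn q x
  fn (p ∘ᵖ q)   x = fn p (fn q x)
  fn (D p)      x = dn p x
  dn ⌈ p ⌉      x = ev (deriv p) x
  dn (constᵖ a) x = 0ℤ
  dn (X+ᵖ a)    x = 1ℤ
  dn (p +ᵖ q)   x = dn p x + dn q x
  dn (p *ᵖ q)   x = dn p x * fn q x + fn p x * dn q x
  dn (p ∘ᵖ q)   x = dn p (fn q x) * dn q x
  -- Symbolic differentiation stops at the first derivative; a second one is read off the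
  -- coefficient list.
  dn (D p)      x = ev (deriv (deriv (code p))) x

  fn≡ : ∀ p x → fn p x ≡ ev (code p) x
  dn≡ : ∀ p x → dn p x ≡ ev (deriv (code p)) x
  fn≡ ⌈ p ⌉      x = refl
  fn≡ (constᵖ a) x = sym (ev-const a x)
  fn≡ (X+ᵖ a)    x = trans (ℤ.+-comm x a)
    (cong (_+_ a) (trans (sym (ℤ.*-identityʳ x)) (cong (x *_) (sym (ev-const 1ℤ x)))))
  fn≡ (p +ᵖ q)   x = trans (cong₂ _+_ (fn≡ p x) (fn≡ q x)) (sym (ev-⊕ (code p) (code q) x))
  fn≡ (p *ᵖ q)   x = trans (cong₂ _*_ (fn≡ p x) (fn≡ q x)) (sym (ev-⊗ (code p) (code q) x))
  fn≡ (p ∘ᵖ q)   x = trans (fn≡ p (fn q x)) (trans (cong (ev (code p)) (fn≡ q x)) (sym (ev-∘ (code p) (code q) x)))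
  fn≡ (D p)      x = dn≡ p x
  dn≡ ⌈ p ⌉      x = refl
  dn≡ (constᵖ a) x = refl
  dn≡ (X+ᵖ a)    x = sym (ev-const 1ℤ x)
  dn≡ (p +ᵖ q)   x = trans (cong₂ _+_ (dn≡ p x) (dn≡ q x)) (sym (deriv-⊕ (code p) (code q) x))
  dn≡ (p *ᵖ q)   x = trans (cong₂ _+_ (cong₂ _*_ (dn≡ p x) (fn≡ q x)) (cong₂ _*_ (fn≡ p x) (dn≡ q x)))
                           (sym (deriv-⊗ (code p) (code q) x))
  dn≡ (p ∘ᵖ q)   x = trans (cong₂ _*_ (trans (dn≡ p (fn q x)) (cong (ev (deriv (code p))) (fn≡ q x))) (dn≡ q x))
                           (sym (deriv-∘ (code p) (code q) x))
  dn≡ (D p)      x = refl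

  _^ᵖ_ : Pol → ℕ → Pol
  p ^ᵖ zero  = constᵖ 1ℤ
  p ^ᵖ suc n = p *ᵖ p ^ᵖ n

  _≐_ : Pol → Pol → Set
  p ≐ q = ∀ x → fn p x ≡ fn q x

  -- By `ev-ext` the coefficients of the difference vanish. This is how a factor with finitely many
  -- zeros gets cancelled: away from them the cancellation takes place in ℤ.
  ≐-from-large : ∀ p q B → (∀ x → B ≤ abs x → fn p x ≡ fn q x) → p ≐ q
  ≐-from-large p q B h x = trans (fn≡ p x) (trans
    (ℤ.i-j≡0⇒i≡j _ _ (trans (sym (ev-difference (code p) (code q) x)) (ev-IsZero
      (ev-ext (code p) (code q) B (λ x le → trans (sym (fn≡ p x)) (trans (h x le) (fn≡ q x)))) x)))
    (sym (fn≡ q x)))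

  -- Equal values force equal coefficients up to trailing zeros, so identities between values may be
  -- differentiated.
  D-cong : ∀ p q → p ≐ q → D p ≐ D q
  D-cong p q h x = trans (dn≡ p x) (trans (ℤ.i-j≡0⇒i≡j _ _ (begin
    ev (deriv (code p)) x - ev (deriv (code q)) x
      ≡⟨ cong (_+_ (ev (deriv (code p)) x)) (trans (sym (ℤ.-1*i≡-i _)) (sym (deriv-scale -1ℤ (code q) x))) ⟩
    ev (deriv (code p)) x + ev (deriv (map (-1ℤ *_) (code q))) x
      ≡⟨ deriv-⊕ (code p) (map (-1ℤ *_) (code q)) x ⟨
    ev (deriv (difference (code p) (code q))) x
      ≡⟨ ev-IsZero (IsZero-deriv (ev-ext (code p) (code q) 0
           (λ x _ → trans (sym (fn≡ p x)) (trans (h x) (fn≡ q x))))) x ⟩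
    0ℤ ∎)) (sym (dn≡ q x)))
    where open ≡-Reasoning

  NonZeroᵖ : Pol → Set
  NonZeroᵖ p = ∃[ x ] fn p x ≢ 0ℤ

  leadingᵖ : ∀ p → NonZeroᵖ p → Leading (code p)
  leadingᵖ p (x , p≢0) with leading (code p)
  ... | inj₁ z = ⊥-elim (p≢0 (trans (fn≡ p x) (ev-IsZero z x)))
  ... | inj₂ l = l

  NonZero-large : ∀ p → NonZeroᵖ p → ∃[ B ] (∀ x → B ≤ abs x → fn p x ≢ 0ℤ)
  NonZero-large p nz = let
      (p₀ , γ , γ≢0 , _ , e) = leadingᵖ p nz
      (C , B , h) = growth-lower p₀ γ γ≢0
    in suc B , λ x le z → ℕ.<⇒≱ (1≤^ (length p₀) (ℕ.≤-trans (s≤s z≤n) le)) (ℕ.≤-trans (h x (ℕ.≤-trans (ℕ.n≤1+n B) le))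
         (ℕ.≤-reflexive (trans (cong (λ t → C ℕ.* abs t) (trans (sym (e x)) (trans (sym (fn≡ p x)) z))) (ℕ.*-zeroʳ C))))

  growth⇒NonZero : ∀ p n C B → (∀ x → B ≤ abs x → abs x ℕ.^ n ≤ C ℕ.* abs (fn p x)) → NonZeroᵖ p
  growth⇒NonZero p n C B h = + suc B , λ z → ℕ.<⇒≱ (1≤^ {suc B} n (s≤s z≤n)) (ℕ.≤-trans (h (+ suc B) (ℕ.n≤1+n B))
    (ℕ.≤-reflexive (trans (cong (λ t → C ℕ.* abs t) z) (ℕ.*-zeroʳ C))))

  Leading⇒NonZero : ∀ p → Leading (code p) → NonZeroᵖ p
  Leading⇒NonZero p (p₀ , γ , γ≢0 , _ , e) = let (C , B , h) = growth-lower p₀ γ γ≢0 in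
    growth⇒NonZero p (length p₀) C B λ x le →
      subst (λ v → abs x ℕ.^ length p₀ ≤ C ℕ.* abs v) (trans (sym (e x)) (sym (fn≡ p x))) (h x le)

  NonZero-∷ʳ : ∀ p γ → γ ≢ 0ℤ → NonZeroᵖ ⌈ p ∷ʳ γ ⌉
  NonZero-∷ʳ p γ γ≢0 = let (C , B , h) = growth-lower p γ γ≢0 in growth⇒NonZero ⌈ p ∷ʳ γ ⌉ (length p) C B h

  *-cancelˡ-≐ : ∀ m p q → NonZeroᵖ m → m *ᵖ p ≐ m *ᵖ q → p ≐ q
  *-cancelˡ-≐ m p q nz h = let (B , hB) = NonZero-large m nz in
    ≐-from-large p q B (λ x le → ℤ.*-cancelˡ-≡ (fn m x) _ _ {{≢-nonZero (hB x le)}} (h x))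

  ^-distribʳ-* : ∀ a b n → (a * b) ^ n ≡ a ^ n * b ^ n
  ^-distribʳ-* a b zero    = refl
  ^-distribʳ-* a b (suc n) = trans (cong (a * b *_) (^-distribʳ-* a b n)) (rearrange a b (a ^ n) (b ^ n))
    where
    rearrange : ∀ a b c d → a * b * (c * d) ≡ a * c * (b * d)
    rearrange = solve-∀

  abs-^ : ∀ i n → abs (i ^ n) ≡ abs i ℕ.^ n
  abs-^ i zero    = refl
  abs-^ i (suc n) = trans (ℤ.abs-* i (i ^ n)) (cong (abs i ℕ.*_) (abs-^ i n))

  fn-^ : ∀ p n x → fn (p ^ᵖ n) x ≡ fn p x ^ n
  fn-^ p zero    x = refl
  fn-^ p (suc n) x = cong (fn p x *_) (fn-^ p n x)

  ^-≢0 : ∀ {a} n → a ≢ 0ℤ → a ^ n ≢ 0ℤ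
  ^-≢0 zero    a≢0 ()
  ^-≢0 (suc n) a≢0 = *-≢0 a≢0 (^-≢0 n a≢0)

  -- Divisibility in ℚ[X]: denominators are cleared by κ.
  record _∣ᵖ_ (p q : Pol) : Set where
    constructor dvd
    field
      κ   : ℤ
      r   : Pol
      κ≢0 : κ ≢ 0ℤ
      eq  : constᵖ κ *ᵖ q ≐ p *ᵖ r


  1≢0 : 1ℤ ≢ 0ℤ
  1≢0 ()

  ∣-refl : ∀ p → p ∣ᵖ p
  ∣-refl p = dvd 1ℤ (constᵖ 1ℤ) 1≢0 λ x → ℤ.*-comm 1ℤ (fn p x)

  ≐⇒∣ : ∀ p q → p ≐ q → p ∣ᵖ q
  ≐⇒∣ p q e = dvd 1ℤ (constᵖ 1ℤ) 1≢0 λ x → trans (ℤ.*-comm 1ℤ (fn q x)) (cong (_* 1ℤ) (sym (e x)))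

  ∣-trans : ∀ p q r → p ∣ᵖ q → q ∣ᵖ r → p ∣ᵖ r
  ∣-trans p q r (dvd κ s κ≢0 e) (dvd κ′ s′ κ′≢0 e′) = dvd (κ * κ′) (s *ᵖ s′) (*-≢0 κ≢0 κ′≢0) λ x →
    trans (ℤ.*-assoc κ κ′ (fn r x)) (trans (cong (κ *_) (e′ x)) (trans (sym (ℤ.*-assoc κ (fn q x) (fn s′ x)))
      (trans (cong (_* fn s′ x) (e x)) (ℤ.*-assoc (fn p x) (fn s x) (fn s′ x)))))

  ∣-* : ∀ p q r s → p ∣ᵖ q → r ∣ᵖ s → p *ᵖ r ∣ᵖ q *ᵖ s
  ∣-* p q r s (dvd κ u κ≢0 e) (dvd κ′ u′ κ′≢0 e′) = dvd (κ * κ′) (u *ᵖ u′) (*-≢0 κ≢0 κ′≢0) λ x →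
    trans (rearrange κ κ′ (fn q x) (fn s x)) (trans (cong₂ _*_ (e x) (e′ x))
          (rearrange (fn p x) (fn u x) (fn r x) (fn u′ x)))
    where
    rearrange : ∀ a b c d → a * b * (c * d) ≡ a * c * (b * d)
    rearrange = solve-∀

  ∣-^ : ∀ p q n → p ∣ᵖ q → p ^ᵖ n ∣ᵖ q ^ᵖ n
  ∣-^ p q zero    h = ∣-refl (constᵖ 1ℤ)
  ∣-^ p q (suc n) h = ∣-* p q (p ^ᵖ n) (q ^ᵖ n) h (∣-^ p q n h)

  ∣-factorˡ : ∀ p q → p ∣ᵖ p *ᵖ q
  ∣-factorˡ p q = dvd 1ℤ q 1≢0 λ x → ℤ.*-identityˡ _

  ∣-factorʳ : ∀ p q → p ∣ᵖ q *ᵖ p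
  ∣-factorʳ p q = dvd 1ℤ q 1≢0 λ x → trans (ℤ.*-identityˡ _) (ℤ.*-comm (fn q x) (fn p x))

  ∣-NonZero : ∀ p q → p ∣ᵖ q → NonZeroᵖ q → NonZeroᵖ p
  ∣-NonZero p q (dvd κ r κ≢0 e) (x , q≢0) = x , λ z → *-≢0 κ≢0 q≢0
    (trans (e x) (trans (cong (_* fn r x) z) (ℤ.*-zeroˡ (fn r x))))

  -- A Bezout relation over ℚ, with its denominators collected in κ.
  Coprimeᵖ : Pol → Pol → Set
  Coprimeᵖ p q = ∃[ a ] ∃[ b ] ∃[ κ ] (κ ≢ 0ℤ × a *ᵖ p +ᵖ b *ᵖ q ≐ constᵖ κ)

  -- Greatest common divisors

  ev-∷ʳ : ∀ p γ x → ev (p ∷ʳ γ) x ≡ ev p x + x ^ length p * γ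
  ev-∷ʳ []      γ x = trans (ev-const γ x) (trans (sym (ℤ.*-identityˡ γ)) (sym (ℤ.+-identityˡ _)))
  ev-∷ʳ (a ∷ p) γ x = trans (cong (λ t → a + x * t) (ev-∷ʳ p γ x))
    (rearrange a x (ev p x) (x ^ length p) γ)
    where
    rearrange : ∀ a x p y γ → a + x * (p + y * γ) ≡ a + x * p + x * y * γ
    rearrange = solve-∀

  length-⊕ : ∀ {n} p q → length p ≤ n → length q ≤ n → length (p ⊕ q) ≤ n
  length-⊕ []      q       _       lq      = lq
  length-⊕ (_ ∷ p) []      lp      _       = lp
  length-⊕ (_ ∷ p) (_ ∷ q) (s≤s lp) (s≤s lq) = s≤s (length-⊕ p q lp lq)

  length-scale : ∀ a p {n} → length p ≤ n → length (map (a *_) p) ≤ n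
  length-scale a p = subst (_≤ _) (sym (length-map (a *_) p))

  DivMod : Poly → Poly → ℕ → Set
  DivMod m p n = ∃[ κ ] ∃[ s ] ∃[ r ] (κ ≢ 0ℤ × length r ≤ n × (∀ x → κ * ev p x ≡ ev m x * ev s x + ev r x))

  -- Pseudo-division: p is multiplied by the leading coefficient β of the divisor, so that its own
  -- top coefficient ρ is cancelled by ρ times the divisor without leaving ℤ.
  reduceTop : ∀ m β → β ≢ 0ℤ → ∀ p → length p ≤ suc (length m) → DivMod (m ∷ʳ β) p (length m)
  reduceTop m β β≢0 p lp with length p ℕ.≤? length m
  ... | yes le = 1ℤ , [] , p , 1≢0 , le , λ x →
    trans (ℤ.*-identityˡ _) (sym (trans (cong (λ t → t + ev p x) (ℤ.*-zeroʳ (ev (m ∷ʳ β) x))) (ℤ.+-identityˡ _)))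
  ... | no ¬le with initLast p
  ...   | []        = ⊥-elim (¬le z≤n)
  ...   | r ∷ʳ′ ρ  = β , ρ ∷ [] , map (β *_) r ⊕ map (- ρ *_) m , β≢0 ,
    length-⊕ (map (β *_) r) (map (- ρ *_) m) (length-scale β r (ℕ.≤-reflexive lr)) (length-scale (- ρ) m ℕ.≤-refl) , λ x → begin
      β * ev (r ∷ʳ ρ) x
        ≡⟨ cong (β *_) (trans (ev-∷ʳ r ρ x) (cong (λ n → ev r x + x ^ n * ρ) lr)) ⟩
      β * (ev r x + x ^ length m * ρ)
        ≡⟨ rearrange β ρ (ev r x) (ev m x) (x ^ length m) ⟩
      (ev m x + x ^ length m * β) * ρ + (β * ev r x + - ρ * ev m x)
        ≡⟨ cong₂ _+_ (cong₂ _*_ (sym (ev-∷ʳ m β x)) (sym (ev-const ρ x)))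
             (trans (cong₂ _+_ (sym (ev-scale β r x)) (sym (ev-scale (- ρ) m x))) (sym (ev-⊕ (map (β *_) r) _ x))) ⟩
      ev (m ∷ʳ β) x * ev (ρ ∷ []) x + ev (map (β *_) r ⊕ map (- ρ *_) m) x ∎
    where
    open ≡-Reasoning
    lr : length r ≡ length m
    lr = ℕ.suc-injective (trans (trans (ℕ.+-comm 1 (length r)) (sym (length-++ r)))
           (ℕ.≤-antisym lp (ℕ.≰⇒> ¬le)))
    rearrange : ∀ b a r m y → b * (r + y * a) ≡ (m + y * b) * a + (b * r + - a * m)
    rearrange = solve-∀

  -- Horner form: if κ p leaves the remainder r, then κ (a + X p) leaves κ a + X r, which is at most
  -- one coefficient too long and is shortened by `reduceTop`.
  divMod : ∀ m β → β ≢ 0ℤ → ∀ p → DivMod (m ∷ʳ β) p (length m)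
  divMod m β β≢0 [] = 1ℤ , [] , [] , 1≢0 , z≤n , λ x →
    sym (trans (ℤ.+-identityʳ _) (ℤ.*-zeroʳ (ev (m ∷ʳ β) x)))
  divMod m β β≢0 (a ∷ p) = let
      (κ , s , r , κ≢0 , lr , e) = divMod m β β≢0 p
      (κ′ , s′ , r′ , κ′≢0 , lr′ , e′) = reduceTop m β β≢0 (κ * a ∷ r) (s≤s lr)
    in κ′ * κ , map (κ′ *_) (0ℤ ∷ s) ⊕ s′ , r′ , *-≢0 κ′≢0 κ≢0 , lr′ , λ x → let M = ev (m ∷ʳ β) x in begin
      κ′ * κ * (a + x * ev p x)
        ≡⟨ expand κ′ κ a x (ev p x) ⟩
      κ′ * (κ * a + x * (κ * ev p x))
        ≡⟨ cong (λ t → κ′ * (κ * a + x * t)) (e x) ⟩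
      κ′ * (κ * a + x * (M * ev s x + ev r x))
        ≡⟨ regroup κ′ (κ * a) x M (ev s x) (ev r x) ⟩
      M * (κ′ * (x * ev s x)) + κ′ * ev (κ * a ∷ r) x
        ≡⟨ cong₂ _+_ (cong (λ t → M * (κ′ * t)) (sym (ev-shift s x))) (e′ x) ⟩
      M * (κ′ * ev (0ℤ ∷ s) x) + (M * ev s′ x + ev r′ x)
        ≡⟨ collect M (κ′ * ev (0ℤ ∷ s) x) (ev s′ x) (ev r′ x) ⟩
      M * (κ′ * ev (0ℤ ∷ s) x + ev s′ x) + ev r′ x
        ≡⟨ cong (λ t → M * t + ev r′ x) (trans (cong (λ t → t + ev s′ x) (sym (ev-scale κ′ (0ℤ ∷ s) x)))
             (sym (ev-⊕ (map (κ′ *_) (0ℤ ∷ s)) s′ x))) ⟩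
      M * ev (map (κ′ *_) (0ℤ ∷ s) ⊕ s′) x + ev r′ x ∎
    where
    open ≡-Reasoning
    expand : ∀ c k a x p → c * k * (a + x * p) ≡ c * (k * a + x * (k * p))
    expand = solve-∀
    regroup : ∀ c a x m s r → c * (a + x * (m * s + r)) ≡ m * (c * (x * s)) + c * (a + x * r)
    regroup = solve-∀
    collect : ∀ m s t r → m * s + (m * t + r) ≡ m * (s + t) + r
    collect = solve-∀

  GCD : Pol → Pol → Set
  GCD p q = ∃[ g ] (g ∣ᵖ p × g ∣ᵖ q × ∃[ a ] ∃[ b ] ∃[ κ ] (κ ≢ 0ℤ × a *ᵖ p +ᵖ b *ᵖ q ≐ constᵖ κ *ᵖ g))

  -- The length bound decreases because the divisor is q without its trailing zeros, so that the
  -- remainder has at most deg q coefficients, fewer than q.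
  euclid : ∀ n p (q : Poly) → length q ≤ n → GCD p ⌈ q ⌉
  euclid n p q l with leading q
  ... | inj₁ z = p , ∣-refl p , (dvd 1ℤ (constᵖ 0ℤ) 1≢0
                   λ x → trans (ℤ.*-identityˡ _) (trans (ev-IsZero z x) (sym (ℤ.*-zeroʳ (fn p x))))) ,
                 constᵖ 1ℤ , constᵖ 0ℤ , 1ℤ , 1≢0 , λ x → ℤ.+-identityʳ _
  euclid zero    p [] l | inj₂ (_ , _ , _ , () , _)
  euclid zero    p (_ ∷ _) () | inj₂ _
  euclid (suc n) p q l | inj₂ (m , β , β≢0 , lm , em) = let
      (κ , s , r , κ≢0 , lr , e) = divMod m β β≢0 (code p)
      (g , (dvd κ₁ q₁ κ₁≢0 e₁) , (dvd κ₂ r₁ κ₂≢0 e₂) , a , b , κ₃ , κ₃≢0 , e₃) =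
        euclid n ⌈ q ⌉ r (ℕ.≤-trans lr (ℕ.≤-pred (ℕ.≤-trans lm l)))
      step : ∀ x → κ * fn p x ≡ ev q x * ev s x + ev r x
      step x = trans (cong (κ *_) (fn≡ p x)) (trans (e x) (cong (λ t → t * ev s x + ev r x) (sym (em x))))
    in g ,
       (dvd (κ₁ * κ₂ * κ) (constᵖ κ₂ *ᵖ q₁ *ᵖ ⌈ s ⌉ +ᵖ constᵖ κ₁ *ᵖ r₁) (*-≢0 (*-≢0 κ₁≢0 κ₂≢0) κ≢0) λ x →
         trans (trans (ℤ.*-assoc (κ₁ * κ₂) κ (fn p x)) (cong (κ₁ * κ₂ *_) (step x)))
           (trans (distribute κ₁ κ₂ (ev q x) (ev s x) (ev r x))
           (trans (cong₂ (λ t u → κ₂ * t * ev s x + κ₁ * u) (e₁ x) (e₂ x))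
                  (collect κ₁ κ₂ (fn g x) (fn q₁ x) (ev s x) (fn r₁ x))))) ,
       (dvd κ₁ q₁ κ₁≢0 e₁) ,
       constᵖ κ *ᵖ b , a +ᵖ constᵖ -1ℤ *ᵖ b *ᵖ ⌈ s ⌉ , κ₃ , κ₃≢0 , λ x →
         trans (combine κ (fn b x) (fn p x) (fn a x) (ev s x) (ev q x))
           (trans (cong (λ t → fn b x * (t - ev s x * ev q x) + fn a x * ev q x) (step x))
           (trans (simplify (fn b x) (ev q x) (ev s x) (ev r x) (fn a x)) (e₃ x)))
    where
    distribute : ∀ k l q s r → k * l * (q * s + r) ≡ l * (k * q) * s + k * (l * r)
    distribute = solve-∀
    collect : ∀ k l g q s r → l * (g * q) * s + k * (g * r) ≡ g * (l * q * s + k * r)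
    collect = solve-∀
    combine : ∀ k b p a s q → k * b * p + (a + -1ℤ * b * s) * q ≡ b * (k * p - s * q) + a * q
    combine = solve-∀
    simplify : ∀ b q s r a → b * (q * s + r - s * q) + a * q ≡ a * q + b * r
    simplify = solve-∀

  gcdᵖ : ∀ p q → GCD p q
  gcdᵖ p q = let (g , g∣p , (dvd κ r κ≢0 e) , a , b , κ′ , κ′≢0 , e′) = euclid _ p (code q) ℕ.≤-refl in
    g , g∣p , (dvd κ r κ≢0 λ x → trans (cong (κ *_) (fn≡ q x)) (e x)) ,
    a , b , κ′ , κ′≢0 , λ x → trans (cong (λ t → fn a x * fn p x + fn b x * t) (fn≡ q x)) (e′ x)

  record Cofactors (p q : Pol) : Set where
    field
      g p₁ q₁ : Pol
      κ₁ κ₂   : ℤ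
      κ₁≢0    : κ₁ ≢ 0ℤ
      κ₂≢0    : κ₂ ≢ 0ℤ
      p-eq    : constᵖ κ₁ *ᵖ p ≐ g *ᵖ p₁
      q-eq    : constᵖ κ₂ *ᵖ q ≐ g *ᵖ q₁
      coprime : Coprimeᵖ p₁ q₁

  -- Coprimality comes from cancelling g in the Bezout relation for g; g is nonzero because it
  -- divides the nonzero p.
  cofactors : ∀ p q → NonZeroᵖ p → Cofactors p q
  cofactors p q nz = let (g , (dvd κ₁ p₁ κ₁≢0 e₁) , (dvd κ₂ q₁ κ₂≢0 e₂) , a , b , κ , κ≢0 , e) = gcdᵖ p q in record
    { g = g ; p₁ = p₁ ; q₁ = q₁ ; κ₁ = κ₁ ; κ₂ = κ₂ ; κ₁≢0 = κ₁≢0 ; κ₂≢0 = κ₂≢0 ; p-eq = e₁ ; q-eq = e₂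
    ; coprime = constᵖ κ₂ *ᵖ a , constᵖ κ₁ *ᵖ b , κ₁ * κ₂ * κ , *-≢0 (*-≢0 κ₁≢0 κ₂≢0) κ≢0 ,
        *-cancelˡ-≐ g (constᵖ κ₂ *ᵖ a *ᵖ p₁ +ᵖ constᵖ κ₁ *ᵖ b *ᵖ q₁) (constᵖ (κ₁ * κ₂ * κ))
          (∣-NonZero g p (dvd κ₁ p₁ κ₁≢0 e₁) nz) λ x →
          trans (expand (fn g x) κ₁ κ₂ (fn a x) (fn b x) (fn p₁ x) (fn q₁ x))
          (trans (sym (cong₂ (λ t u → κ₂ * fn a x * t + κ₁ * fn b x * u) (e₁ x) (e₂ x)))
          (trans (regroup κ₁ κ₂ (fn a x) (fn b x) (fn p x) (fn q x))
          (trans (cong (κ₁ * κ₂ *_) (e x)) (swap (κ₁ * κ₂) κ (fn g x))))) }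
    where
    expand : ∀ g k l a b p q → g * (l * a * p + k * b * q) ≡ l * a * (g * p) + k * b * (g * q)
    expand = solve-∀
    regroup : ∀ k l a b p q → l * a * (k * p) + k * b * (l * q) ≡ k * l * (a * p + b * q)
    regroup = solve-∀
    swap : ∀ k l g → k * (l * g) ≡ g * (k * l)
    swap = solve-∀

-- Comparing roots and multiplicities without factoring

module Multiplicities where

  open PolynomialEvaluation
  open IntegerPolynomials
  open PolynomialExpressions
  open import Data.Empty using (⊥-elim)
  open import Data.Integer.Base using (ℤ; +_; 0ℤ; 1ℤ; _+_; _*_; _-_; -_; _^_)
  import Data.Integer.Properties as ℤ
  open import Data.Integer.Tactic.RingSolver using (solve-∀)
  open import Data.List.Base using ([]; _∷_; length)
  open import Data.List.Relation.Unary.All using ([]; _∷_)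
  open import Data.Nat.Base as ℕ using (ℕ; zero; suc; _≤_; z≤n; s≤s)
  import Data.Nat.Properties as ℕ
  open import Data.Product.Base using (∃-syntax; _×_; _,_; proj₁; proj₂)
  open import Data.Sum.Base using (inj₁; inj₂)
  open import Relation.Binary.PropositionalEquality

  D^ : ℕ → Pol → Pol
  D^ zero    p = p
  D^ (suc n) p = D^ n (D p)

  IsZero-weightedFrom⁻¹ : ∀ n p → IsZero (weightedFrom (suc n) p) → IsZero p
  IsZero-weightedFrom⁻¹ n []      []      = []
  IsZero-weightedFrom⁻¹ n (a ∷ p) (e ∷ h) with ℤ.i*j≡0⇒i≡0∨j≡0 (+ suc n) e
  ... | inj₂ a≡0 = a≡0 ∷ IsZero-weightedFrom⁻¹ (suc n) p h

  length-deriv : ∀ a p → length (deriv (a ∷ p)) ≡ length p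
  length-deriv a p = go 1 p
    where
    go : ∀ n p → length (weightedFrom n p) ≡ length p
    go n []      = refl
    go n (_ ∷ p) = cong suc (go (suc n) p)

  zero-deriv⇒const : ∀ p → IsZero (deriv p) → ∃[ c ] (∀ x → ev p x ≡ c)
  zero-deriv⇒const []      h = 0ℤ , λ _ → refl
  zero-deriv⇒const (a ∷ p) h = a , λ x → trans (cong (λ t → a + x * t)
    (ev-IsZero (IsZero-weightedFrom⁻¹ 0 p h) x)) (trans (cong (_+_ a) (ℤ.*-zeroʳ x)) (ℤ.+-identityʳ a))

  -- In characteristic 0 a vanishing derivative means a constant, so repeated differentiation passes
  -- through a nonzero constant before it reaches 0.
  higher-deriv-const : ∀ n p → length (code p) ≤ n → NonZeroᵖ p →
    ∃[ i ] ∃[ c ] (c ≢ 0ℤ × D^ i p ≐ constᵖ c)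
  higher-deriv-const n p l nz with leading (deriv (code p))
  higher-deriv-const n p l (x , p≢0) | inj₁ z = let (c , h) = zero-deriv⇒const (code p) z in
    0 , c , (λ c≡0 → p≢0 (trans (fn≡ p x) (trans (h x) c≡0))) , λ y → trans (fn≡ p y) (h y)
  higher-deriv-const zero    p l nz | inj₂ ld = ⊥-elim (ℕ.n≮0 (ℕ.<-≤-trans (proj₁ (proj₂ (proj₂ (proj₂ ld)))) (length-deriv≤ (code p) l)))
    where
    length-deriv≤ : ∀ p {n} → length p ≤ n → length (deriv p) ≤ n
    length-deriv≤ []      l = l
    length-deriv≤ (a ∷ p) l = ℕ.≤-trans (ℕ.≤-reflexive (length-deriv a p)) (ℕ.≤-trans (ℕ.n≤1+n _) l)
  higher-deriv-const (suc n) p l nz | inj₂ ld = let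
      (i , r) = higher-deriv-const n (D p) (length-deriv≤ (code p) l) (Leading⇒NonZero (D p) ld)
    in suc i , r
    where
    length-deriv≤ : ∀ p {n} → length p ≤ suc n → length (deriv p) ≤ n
    length-deriv≤ []      l       = z≤n
    length-deriv≤ (a ∷ p) (s≤s l) = ℕ.≤-trans (ℕ.≤-reflexive (length-deriv a p)) l

  -- The extra factor p avoids the exponent n - 1, and with it a separate case n = 0.
  *-dn-^ : ∀ p n x → fn p x * dn (p ^ᵖ n) x ≡ + n * (fn (p ^ᵖ n) x * dn p x)
  *-dn-^ p zero    x = trans (ℤ.*-zeroʳ (fn p x)) (sym (ℤ.*-zeroˡ (1ℤ * dn p x)))
  *-dn-^ p (suc n) x = trans (expand (fn p x) (dn p x) (fn (p ^ᵖ n) x) (dn (p ^ᵖ n) x))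
    (trans (cong (λ t → fn p x * dn p x * fn (p ^ᵖ n) x + fn p x * t) (*-dn-^ p n x))
           (collect (fn p x) (dn p x) (fn (p ^ᵖ n) x) (+ n)))
    where
    expand : ∀ p d q e → p * (d * q + p * e) ≡ p * d * q + p * (p * e)
    expand = solve-∀
    collect : ∀ p d q n → p * d * q + p * (n * (q * d)) ≡ (1ℤ + n) * (p * q * d)
    collect = solve-∀

  -- Multiplicities without factoring: h ∣ h′ r says that r vanishes at
  -- every root of h, hence that h divides a power of r.  The proof
  -- differentiates h ∣ h⁽ⁱ⁾ rⁱ until h⁽ⁱ⁾ is constant.
  module _ (h r : Pol) (h∣h′r : h ∣ᵖ D h *ᵖ r) where

    -- Differentiate κ q rⁱ = h w and multiply by r. Beside q′ rⁱ⁺¹ the left side has i q rⁱ r′, a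
    -- multiple of h up to constants; on the right r h w′ is one, and r h′ w is one by the
    -- hypothesis on h′ r.
    ∣-D-step : ∀ q i → h ∣ᵖ q *ᵖ r ^ᵖ i → h ∣ᵖ D q *ᵖ r ^ᵖ suc i
    ∣-D-step q i (dvd κ w κ≢0 e) = let (dvd κ′ s κ′≢0 e′) = h∣h′r in
      dvd (κ′ * κ) (s *ᵖ w +ᵖ constᵖ κ′ *ᵖ (r *ᵖ D w) +ᵖ constᵖ (- (κ′ * + i)) *ᵖ (D r *ᵖ w)) (*-≢0 κ′≢0 κ≢0) λ x →
      let ri = fn (r ^ᵖ i) x; ri′ = dn (r ^ᵖ i) x in begin
      κ′ * κ * (dn q x * (fn r x * ri))
        ≡⟨ isolate κ′ κ (fn q x) (dn q x) (fn r x) ri ri′ ⟩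
      κ′ * (fn r x * (0ℤ * (fn q x * ri) + κ * (dn q x * ri + fn q x * ri′))) - κ′ * (κ * (fn q x * (fn r x * ri′)))
        ≡⟨ cong₂ (λ t u → κ′ * (fn r x * t) - κ′ * (κ * (fn q x * u)))
             (D-cong (constᵖ κ *ᵖ (q *ᵖ r ^ᵖ i)) (h *ᵖ w) e x) (*-dn-^ r i x) ⟩
      κ′ * (fn r x * (dn h x * fn w x + fn h x * dn w x)) - κ′ * (κ * (fn q x * (+ i * (ri * dn r x))))
        ≡⟨ regroup κ′ κ (fn r x) (dn h x) (fn w x) (fn h x) (dn w x) (fn q x) (+ i) ri (dn r x) ⟩
      κ′ * (dn h x * fn r x) * fn w x + κ′ * (fn r x * (fn h x * dn w x)) - κ′ * + i * (κ * (fn q x * ri)) * dn r x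
        ≡⟨ cong₂ (λ t u → t * fn w x + κ′ * (fn r x * (fn h x * dn w x)) - κ′ * + i * u * dn r x) (e′ x) (e x) ⟩
      fn h x * fn s x * fn w x + κ′ * (fn r x * (fn h x * dn w x)) - κ′ * + i * (fn h x * fn w x) * dn r x
        ≡⟨ collect κ′ (fn h x) (fn s x) (fn w x) (fn r x) (dn w x) (κ′ * + i) (dn r x) ⟩
      fn h x * (fn s x * fn w x + κ′ * (fn r x * dn w x) + - (κ′ * + i) * (dn r x * fn w x)) ∎
      where
      open ≡-Reasoning
      isolate : ∀ l k q q′ r s s′ →
        l * k * (q′ * (r * s)) ≡ l * (r * (0ℤ * (q * s) + k * (q′ * s + q * s′))) - l * (k * (q * (r * s′)))
      isolate = solve-∀
      regroup : ∀ l k r h′ w h w′ q i s r′ →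
        l * (r * (h′ * w + h * w′)) - l * (k * (q * (i * (s * r′))))
        ≡ l * (h′ * r) * w + l * (r * (h * w′)) - l * i * (k * (q * s)) * r′
      regroup = solve-∀
      collect : ∀ l h s w r w′ c r′ →
        h * s * w + l * (r * (h * w′)) - c * (h * w) * r′ ≡ h * (s * w + l * (r * w′) + - c * (r′ * w))
      collect = solve-∀

    ∣-D^ : ∀ n q i → h ∣ᵖ q *ᵖ r ^ᵖ i → ∃[ j ] (h ∣ᵖ D^ n q *ᵖ r ^ᵖ j)
    ∣-D^ zero    q i d = i , d
    ∣-D^ (suc n) q i d = ∣-D^ n (D q) (suc i) (∣-D-step q i d)

    ∣-power : NonZeroᵖ h → ∃[ n ] (h ∣ᵖ r ^ᵖ n)
    ∣-power nz = let
        (i , c , c≢0 , e) = higher-deriv-const _ h ℕ.≤-refl nz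
        (j , dvd κ w κ≢0 e′) = ∣-D^ i h 0 (∣-factorˡ h (constᵖ 1ℤ))
      in j , dvd (κ * c) w (*-≢0 κ≢0 c≢0) λ x → trans (ℤ.*-assoc κ c _)
           (trans (cong (λ t → κ * (t * fn (r ^ᵖ j) x)) (sym (e x))) (e′ x))

  ^ᵖ-*ᵖ : ∀ p q n → (p *ᵖ q) ^ᵖ n ≐ p ^ᵖ n *ᵖ q ^ᵖ n
  ^ᵖ-*ᵖ p q n x = trans (fn-^ (p *ᵖ q) n x) (trans (^-distribʳ-* (fn p x) (fn q x) n)
    (sym (cong₂ _*_ (fn-^ p n x) (fn-^ q n x))))

  ∣-power-trans : ∀ p q r n m → p ∣ᵖ q ^ᵖ n → q ∣ᵖ r ^ᵖ m → p ∣ᵖ r ^ᵖ (m ℕ.* n)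
  ∣-power-trans p q r n m p∣ q∣ = ∣-trans p (q ^ᵖ n) _ p∣ (∣-trans (q ^ᵖ n) ((r ^ᵖ m) ^ᵖ n) _ (∣-^ q (r ^ᵖ m) n q∣)
    (≐⇒∣ ((r ^ᵖ m) ^ᵖ n) (r ^ᵖ (m ℕ.* n)) (λ x → trans (fn-^ (r ^ᵖ m) n x) (trans (cong (_^ n) (fn-^ r m x))
       (trans (ℤ.^-*-assoc (fn r x) m n) (sym (fn-^ r (m ℕ.* n) x)))))))

  ^ᵖ-+ : ∀ p m n → p ^ᵖ m *ᵖ p ^ᵖ n ≐ p ^ᵖ (m ℕ.+ n)
  ^ᵖ-+ p m n x = trans (cong₂ _*_ (fn-^ p m x) (fn-^ p n x))
    (trans (sym (ℤ.^-distribˡ-+-* (fn p x) m n)) (sym (fn-^ p (m ℕ.+ n) x)))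

  -- In terms of roots: those of p lie among those of q t, and those of q among those of t.
  absorb : ∀ p q t k n → p ∣ᵖ (q *ᵖ t) ^ᵖ k → q ∣ᵖ t ^ᵖ n → p ∣ᵖ t ^ᵖ (n ℕ.* k ℕ.+ k)
  absorb p q t k n p∣ q∣ = ∣-trans p ((q *ᵖ t) ^ᵖ k) _ p∣
    (∣-trans ((q *ᵖ t) ^ᵖ k) (q ^ᵖ k *ᵖ t ^ᵖ k) _ (≐⇒∣ ((q *ᵖ t) ^ᵖ k) (q ^ᵖ k *ᵖ t ^ᵖ k) (^ᵖ-*ᵖ q t k))
    (∣-trans (q ^ᵖ k *ᵖ t ^ᵖ k) (t ^ᵖ (n ℕ.* k) *ᵖ t ^ᵖ k) _
      (∣-* (q ^ᵖ k) (t ^ᵖ (n ℕ.* k)) (t ^ᵖ k) (t ^ᵖ k) (∣-power-trans (q ^ᵖ k) q t k n (∣-refl (q ^ᵖ k)) q∣) (∣-refl (t ^ᵖ k)))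
      (≐⇒∣ (t ^ᵖ (n ℕ.* k) *ᵖ t ^ᵖ k) (t ^ᵖ (n ℕ.* k ℕ.+ k)) (^ᵖ-+ t (n ℕ.* k) k))))

  gauss : ∀ m t u → Coprimeᵖ m t → m ∣ᵖ t *ᵖ u → m ∣ᵖ u
  gauss m t u (a , b , κ , κ≢0 , e) (dvd κ′ r κ′≢0 e′) =
    dvd (κ′ * κ) (constᵖ κ′ *ᵖ (a *ᵖ u) +ᵖ b *ᵖ r) (*-≢0 κ′≢0 κ≢0) λ x →
    trans (ℤ.*-assoc κ′ κ (fn u x)) (trans (cong (λ t → κ′ * (t * fn u x)) (sym (e x)))
    (trans (expand κ′ (fn a x) (fn m x) (fn b x) (fn t x) (fn u x))
    (trans (cong (λ s → fn m x * (κ′ * (fn a x * fn u x)) + fn b x * s) (e′ x))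
           (collect (fn m x) (κ′ * (fn a x * fn u x)) (fn b x) (fn r x)))))
    where
    expand : ∀ k a m b t u → k * ((a * m + b * t) * u) ≡ m * (k * (a * u)) + b * (k * (t * u))
    expand = solve-∀
    collect : ∀ m s b r → m * s + b * (m * r) ≡ m * (s + b * r)
    collect = solve-∀

  gauss-^ : ∀ m t u n → Coprimeᵖ m t → m ∣ᵖ t ^ᵖ n *ᵖ u → m ∣ᵖ u
  gauss-^ m t u zero    c d = ∣-trans m (constᵖ 1ℤ *ᵖ u) u d (≐⇒∣ (constᵖ 1ℤ *ᵖ u) u (λ x → ℤ.*-identityˡ (fn u x)))
  gauss-^ m t u (suc n) c d = gauss-^ m t u n c (gauss m t (t ^ᵖ n *ᵖ u) c
    (∣-trans m (t *ᵖ t ^ᵖ n *ᵖ u) (t *ᵖ (t ^ᵖ n *ᵖ u)) d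
      (≐⇒∣ (t *ᵖ t ^ᵖ n *ᵖ u) (t *ᵖ (t ^ᵖ n *ᵖ u)) (λ x → ℤ.*-assoc (fn t x) (fn (t ^ᵖ n) x) (fn u x)))))

  coprime-∣-^ : ∀ m t n → Coprimeᵖ m t → m ∣ᵖ t ^ᵖ n → m ∣ᵖ constᵖ 1ℤ
  coprime-∣-^ m t n c d = gauss-^ m t (constᵖ 1ℤ) n c (∣-trans m (t ^ᵖ n) _ d (∣-factorˡ (t ^ᵖ n) (constᵖ 1ℤ)))

  ∣-*-unit : ∀ g m → m ∣ᵖ constᵖ 1ℤ → g *ᵖ m ∣ᵖ g
  ∣-*-unit g m u = ∣-trans (g *ᵖ m) (g *ᵖ constᵖ 1ℤ) g (∣-* g g m (constᵖ 1ℤ) (∣-refl g) u)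
    (≐⇒∣ (g *ᵖ constᵖ 1ℤ) g (λ x → ℤ.*-identityʳ (fn g x)))

  Squarefreeᵖ : Pol → Set
  Squarefreeᵖ p = Coprimeᵖ p (D p)

  -- Up to constants s = g p₁ and t = g q₁ with p₁, q₁ coprime. Then p₁ divides (g q₁)ⁿ, hence gⁿ.
  -- Squarefreeness of s = g p₁ makes p₁ coprime to g, so p₁ is a constant and s divides g up to
  -- constants.
  squarefree-∣-^ : ∀ s t n → NonZeroᵖ s → Squarefreeᵖ s → s ∣ᵖ t ^ᵖ n → s ∣ᵖ t
  squarefree-∣-^ s t n nz (a , b , κ , κ≢0 , e) d =
    ∣-trans s (g *ᵖ p₁) t s∣gp₁ (∣-trans (g *ᵖ p₁) g t (∣-*-unit g p₁ p₁∣1) (dvd κ₂ q₁ κ₂≢0 q-eq))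
    where
    open Cofactors (cofactors s t nz)
    s∣gp₁ : s ∣ᵖ g *ᵖ p₁
    s∣gp₁ = dvd 1ℤ (constᵖ κ₁) 1≢0 λ x → trans (ℤ.*-identityˡ _) (trans (sym (p-eq x)) (ℤ.*-comm κ₁ (fn s x)))
    t∣gq₁ : t ∣ᵖ g *ᵖ q₁
    t∣gq₁ = dvd 1ℤ (constᵖ κ₂) 1≢0 λ x → trans (ℤ.*-identityˡ _) (trans (sym (q-eq x)) (ℤ.*-comm κ₂ (fn t x)))
    p₁∣s : p₁ ∣ᵖ s
    p₁∣s = dvd κ₁ g κ₁≢0 λ x → trans (p-eq x) (ℤ.*-comm (fn g x) (fn p₁ x))
    p₁∣g^n : p₁ ∣ᵖ g ^ᵖ n
    p₁∣g^n = gauss-^ p₁ q₁ (g ^ᵖ n) n coprime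
      (∣-trans p₁ ((g *ᵖ q₁) ^ᵖ n) _ (∣-trans p₁ s _ p₁∣s (∣-trans s (t ^ᵖ n) _ d (∣-^ t (g *ᵖ q₁) n t∣gq₁)))
        (≐⇒∣ ((g *ᵖ q₁) ^ᵖ n) (q₁ ^ᵖ n *ᵖ g ^ᵖ n) (λ x → trans (^ᵖ-*ᵖ g q₁ n x) (ℤ.*-comm (fn (g ^ᵖ n) x) (fn (q₁ ^ᵖ n) x)))))
    p₁⊥g : Coprimeᵖ p₁ g
    p₁⊥g = a *ᵖ g +ᵖ b *ᵖ D g , b *ᵖ D p₁ , κ₁ * κ , *-≢0 κ₁≢0 κ≢0 , λ x → begin
      (fn a x * fn g x + fn b x * dn g x) * fn p₁ x + fn b x * dn p₁ x * fn g x
        ≡⟨ rearrange (fn a x) (fn b x) (fn g x) (dn g x) (fn p₁ x) (dn p₁ x) ⟩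
      fn a x * (fn g x * fn p₁ x) + fn b x * (dn g x * fn p₁ x + fn g x * dn p₁ x)
        ≡⟨ cong₂ (λ t u → fn a x * t + fn b x * u) (p-eq x) (D-cong (constᵖ κ₁ *ᵖ s) (g *ᵖ p₁) p-eq x) ⟨
      fn a x * (κ₁ * fn s x) + fn b x * (0ℤ * fn s x + κ₁ * dn s x)
        ≡⟨ factor κ₁ (fn a x) (fn b x) (fn s x) (dn s x) ⟩
      κ₁ * (fn a x * fn s x + fn b x * dn s x)
        ≡⟨ cong (κ₁ *_) (e x) ⟩
      κ₁ * κ ∎
      where
      open ≡-Reasoning
      rearrange : ∀ a b g g′ p p′ → (a * g + b * g′) * p + b * p′ * g ≡ a * (g * p) + b * (g′ * p + g * p′)
      rearrange = solve-∀
      factor : ∀ k a b s s′ → a * (k * s) + b * (0ℤ * s + k * s′) ≡ k * (a * s + b * s′)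
      factor = solve-∀
    p₁∣1 : p₁ ∣ᵖ constᵖ 1ℤ
    p₁∣1 = coprime-∣-^ p₁ g n p₁⊥g p₁∣g^n

  -- A root of t has a smaller multiplicity in t′, hence in m, than in t.
  ∣-D⇒∣ : ∀ m t k → NonZeroᵖ m → m ∣ᵖ D t → m ∣ᵖ t ^ᵖ k → m ∣ᵖ t
  ∣-D⇒∣ m t k nz (dvd κ₃ r κ₃≢0 e₃) d =
    ∣-trans m (g *ᵖ p₁) t m∣gp₁ (∣-trans (g *ᵖ p₁) g t (∣-*-unit g p₁ p₁∣1) (dvd κ₂ q₁ κ₂≢0 q-eq))
    where
    open Cofactors (cofactors m t nz)
    m∣gp₁ : m ∣ᵖ g *ᵖ p₁
    m∣gp₁ = dvd 1ℤ (constᵖ κ₁) 1≢0 λ x → trans (ℤ.*-identityˡ _) (trans (sym (p-eq x)) (ℤ.*-comm κ₁ (fn m x)))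
    t∣gq₁ : t ∣ᵖ g *ᵖ q₁
    t∣gq₁ = dvd 1ℤ (constᵖ κ₂) 1≢0 λ x → trans (ℤ.*-identityˡ _) (trans (sym (q-eq x)) (ℤ.*-comm κ₂ (fn t x)))
    p₁∣m : p₁ ∣ᵖ m
    p₁∣m = dvd κ₁ g κ₁≢0 λ x → trans (p-eq x) (ℤ.*-comm (fn g x) (fn p₁ x))
    g-nz : NonZeroᵖ g
    g-nz = ∣-NonZero g m (dvd κ₁ p₁ κ₁≢0 p-eq) nz
    -- Up to constants t = g q₁, and g divides m, which divides t′ = g′ q₁ + g q₁′; so g divides g′
    -- q₁, and all roots of g are roots of q₁. Then p₁, which divides a power of g q₁, divides a
    -- power of q₁ although it is coprime to q₁.
    g∣g′q₁ : g ∣ᵖ D g *ᵖ q₁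
    g∣g′q₁ = dvd (κ₁ * κ₃) (constᵖ κ₂ *ᵖ (p₁ *ᵖ r) +ᵖ constᵖ (- (κ₁ * κ₃)) *ᵖ D q₁) (*-≢0 κ₁≢0 κ₃≢0) λ x → begin
      κ₁ * κ₃ * (dn g x * fn q₁ x)
        ≡⟨ isolate (κ₁ * κ₃) (dn g x) (fn q₁ x) (fn g x) (dn q₁ x) ⟩
      κ₁ * κ₃ * (dn g x * fn q₁ x + fn g x * dn q₁ x) - fn g x * (κ₁ * κ₃ * dn q₁ x)
        ≡⟨ cong (λ t → κ₁ * κ₃ * t - fn g x * (κ₁ * κ₃ * dn q₁ x)) (D-cong (constᵖ κ₂ *ᵖ t) (g *ᵖ q₁) q-eq x) ⟨
      κ₁ * κ₃ * (0ℤ * fn t x + κ₂ * dn t x) - fn g x * (κ₁ * κ₃ * dn q₁ x)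
        ≡⟨ regroup κ₁ κ₂ κ₃ (fn t x) (dn t x) (fn g x * (κ₁ * κ₃ * dn q₁ x)) ⟩
      κ₂ * κ₁ * (κ₃ * dn t x) - fn g x * (κ₁ * κ₃ * dn q₁ x)
        ≡⟨ cong (λ t → κ₂ * κ₁ * t - fn g x * (κ₁ * κ₃ * dn q₁ x)) (e₃ x) ⟩
      κ₂ * κ₁ * (fn m x * fn r x) - fn g x * (κ₁ * κ₃ * dn q₁ x)
        ≡⟨ reassoc κ₁ κ₂ (fn m x) (fn r x) (fn g x * (κ₁ * κ₃ * dn q₁ x)) ⟩
      κ₂ * ((κ₁ * fn m x) * fn r x) - fn g x * (κ₁ * κ₃ * dn q₁ x)
        ≡⟨ cong (λ t → κ₂ * (t * fn r x) - fn g x * (κ₁ * κ₃ * dn q₁ x)) (p-eq x) ⟩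
      κ₂ * (fn g x * fn p₁ x * fn r x) - fn g x * (κ₁ * κ₃ * dn q₁ x)
        ≡⟨ collect κ₂ (fn g x) (fn p₁ x) (fn r x) (κ₁ * κ₃) (dn q₁ x) ⟩
      fn g x * (κ₂ * (fn p₁ x * fn r x) + - (κ₁ * κ₃) * dn q₁ x) ∎
      where
      open ≡-Reasoning
      isolate : ∀ k g′ q g q′ → k * (g′ * q) ≡ k * (g′ * q + g * q′) - g * (k * q′)
      isolate = solve-∀
      regroup : ∀ k l m t t′ c → k * m * (0ℤ * t + l * t′) - c ≡ l * k * (m * t′) - c
      regroup = solve-∀
      reassoc : ∀ k l m r c → l * k * (m * r) - c ≡ l * (k * m * r) - c
      reassoc = solve-∀
      collect : ∀ l g p r k q′ → l * (g * p * r) - g * (k * q′) ≡ g * (l * (p * r) + - k * q′)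
      collect = solve-∀
    p₁∣1 : p₁ ∣ᵖ constᵖ 1ℤ
    p₁∣1 = let (n , g∣) = ∣-power g q₁ g∣g′q₁ g-nz in coprime-∣-^ p₁ q₁ (n ℕ.* k ℕ.+ k) coprime
      (absorb p₁ g q₁ k n (∣-trans p₁ m _ p₁∣m (∣-trans m (t ^ᵖ k) _ d (∣-^ t (g *ᵖ q₁) k t∣gq₁))) g∣)

  -- By `∣-D⇒∣`, t = m u up to a constant. As m divides t′, it divides m′ u, so every root of m is a
  -- root of u. Hence s, whose roots are roots of m u, divides a power of u, and being squarefree it
  -- divides u.
  squarefree-*-∣ : ∀ s m t k → NonZeroᵖ s → NonZeroᵖ m → Squarefreeᵖ s →
    m ∣ᵖ D t → s *ᵖ m ∣ᵖ t ^ᵖ k → s *ᵖ m ∣ᵖ t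
  squarefree-*-∣ s m t k s-nz m-nz sqf m∣t′ sm∣ = conclude (∣-D⇒∣ m t k m-nz m∣t′ (∣-trans m (s *ᵖ m) _ (∣-factorʳ m s) sm∣))
    where
    conclude : m ∣ᵖ t → s *ᵖ m ∣ᵖ t
    conclude (dvd κ u κ≢0 e) = let
        (dvd κ₄ r κ₄≢0 e₄) = m∣t′
        m∣m′u : m ∣ᵖ D m *ᵖ u
        m∣m′u = dvd κ₄ (constᵖ κ *ᵖ r +ᵖ constᵖ (- κ₄) *ᵖ D u) κ₄≢0 λ x →
          trans (isolate κ₄ (dn m x) (fn u x) (fn m x) (dn u x))
          (trans (cong (λ t → κ₄ * t - fn m x * (κ₄ * dn u x)) (sym (D-cong (constᵖ κ *ᵖ t) (m *ᵖ u) e x)))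
          (trans (regroup κ₄ κ (fn t x) (dn t x) (fn m x * (κ₄ * dn u x)))
          (trans (cong (λ t → κ * t - fn m x * (κ₄ * dn u x)) (e₄ x))
                 (collect κ (fn m x) (fn r x) κ₄ (dn u x)))))
        (n , m∣) = ∣-power m u m∣m′u m-nz
        t∣mu : t ∣ᵖ m *ᵖ u
        t∣mu = dvd 1ℤ (constᵖ κ) 1≢0 λ x → trans (ℤ.*-identityˡ _) (trans (sym (e x)) (ℤ.*-comm κ (fn t x)))
        s∣u : s ∣ᵖ u
        s∣u = squarefree-∣-^ s u (n ℕ.* k ℕ.+ k) s-nz sqf (absorb s m u k n
          (∣-trans s (s *ᵖ m) _ (∣-factorˡ s m) (∣-trans (s *ᵖ m) (t ^ᵖ k) _ sm∣ (∣-^ t (m *ᵖ u) k t∣mu))) m∣)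
      in ∣-trans (s *ᵖ m) (u *ᵖ m) t (∣-* s u m m s∣u (∣-refl m))
           (dvd κ (constᵖ 1ℤ) κ≢0 λ x → trans (e x) (trans (ℤ.*-comm (fn m x) (fn u x)) (sym (ℤ.*-identityʳ _))))
      where
      isolate : ∀ k m′ u m u′ → k * (m′ * u) ≡ k * (m′ * u + m * u′) - m * (k * u′)
      isolate = solve-∀
      regroup : ∀ k l t t′ c → k * (0ℤ * t + l * t′) - c ≡ l * (k * t′) - c
      regroup = solve-∀
      collect : ∀ l m r k u′ → l * (m * r) - m * (k * u′) ≡ m * (l * r + - k * u′)
      collect = solve-∀

-- Linear dependence, critical values and Belyi polynomials

module BelyiPolynomials where

  open PolynomialEvaluation
  open IntegerPolynomials
  open PolynomialExpressions
  open Multiplicities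
  import Algebra.Properties.Semiring.Sum as Sum
  open import Data.Empty using (⊥-elim)
  open import Data.Fin.Base using (Fin; zero; suc; toℕ; punchIn)
  open import Data.Fin.Properties using (any?)
  open import Data.Integer.Base using (ℤ; +_; 0ℤ; 1ℤ; -1ℤ; _+_; _*_; _-_; -_; _^_) renaming (∣_∣ to abs; suc to sucℤ)
  import Data.Integer.Base as ℤ using (_<_)
  import Data.Integer.Properties as ℤ
  open import Data.Integer.Tactic.RingSolver using (solve-∀)
  open import Data.List.Base using (List; []; _∷_; _∷ʳ_; length; tabulate; map)
  open import Data.List.Properties using (length-tabulate; length-map)
  import Data.List.Relation.Unary.All.Properties as All
  open import Data.List.Relation.Unary.All using (All; []; _∷_)
  open import Data.Nat.Base as ℕ using (ℕ; zero; suc; _≤_; _<_; z≤n; s≤s; _⊔_)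
  import Data.Nat.Properties as ℕ
  open import Data.Product.Base using (∃-syntax; Σ-syntax; _×_; _,_; proj₁; proj₂)
  open import Data.Sum.Base using (inj₁; inj₂)
  open import Data.Vec.Functional using (insertAt)
  open import Data.Vec.Functional.Properties using (insertAt-lookup; insertAt-punchIn)
  open import Relation.Binary.Definitions using (tri<; tri≈; tri>)
  open import Relation.Binary.PropositionalEquality
  open import Relation.Nullary using (yes; no)
  open import Relation.Nullary.Decidable using (¬?; decidable-stable)

  open Sum ℤ.+-*-semiring using (sum; sum-remove; sum-cong-≗; ∑-distrib-+; *-distribˡ-sum)

  -- Linear dependence over ℤ

  uncons : ∀ n (p : Poly) → length p ≤ suc n →
    ∃[ h ] ∃[ t ] (length t ≤ n × (∀ x → ev p x ≡ h + x * ev t x))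
  uncons n []      l       = 0ℤ , [] , z≤n , λ x → sym (trans (ℤ.+-identityˡ (x * 0ℤ)) (ℤ.*-zeroʳ x))
  uncons n (h ∷ t) (s≤s l) = h , t , l , λ _ → refl

  Dependent : ∀ {n} → (Fin n → Poly) → Set
  Dependent {n} v = Σ[ c ∈ (Fin n → ℤ) ] ((∃[ i ] c i ≢ 0ℤ) × (∀ x → sum (λ i → c i * ev (v i) x) ≡ 0ℤ))

  sum-*ˡ : ∀ {n} a (f : Fin n → ℤ) → sum (λ i → a * f i) ≡ a * sum f
  sum-*ˡ a f = sym (*-distribˡ-sum a f)

  -- Elimination on constant terms. If all of them vanish, one polynomial is dropped and X is
  -- divided out of the others; otherwise a pivot with `h j` nonzero clears the other constant
  -- terms, and again X is divided out.
  dependent : ∀ n (v : Fin (suc n) → Poly) → (∀ i → length (v i) ≤ n) → Dependent v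
  dependent zero v l with v zero | l zero
  ... | [] | _ = (λ _ → 1ℤ) , (zero , 1≢0) , λ x → refl
  dependent (suc n) v l with any? (λ i → ¬? (proj₁ (uncons n (v i) (l i)) ℤ.≟ 0ℤ))
  ... | no ¬∃ = extend (dependent n (λ i → t (suc i)) (λ i → lt (suc i)))
    where
    h : Fin (suc (suc n)) → ℤ
    h i = proj₁ (uncons n (v i) (l i))
    t : Fin (suc (suc n)) → Poly
    t i = proj₁ (proj₂ (uncons n (v i) (l i)))
    lt : ∀ i → length (t i) ≤ n
    lt i = proj₁ (proj₂ (proj₂ (uncons n (v i) (l i))))
    v-eq : ∀ i x → ev (v i) x ≡ x * ev (t i) x
    v-eq i x = trans (proj₂ (proj₂ (proj₂ (uncons n (v i) (l i)))) x)
      (trans (cong (λ z → z + x * ev (t i) x) (decidable-stable (h i ℤ.≟ 0ℤ) (λ h≢0 → ¬∃ (i , h≢0)))) (ℤ.+-identityˡ (x * ev (t i) x)))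
    swap : ∀ c x y → c * (x * y) ≡ x * (c * y)
    swap = solve-∀
    extend : Dependent (λ i → t (suc i)) → Dependent v
    extend (c , (i , ci≢0) , e) = c′ , (suc i , ci≢0) , λ x →
      trans (cong₂ _+_ (ℤ.*-zeroˡ (ev (v zero) x)) (sum-cong-≗ (λ i → trans (cong (c i *_) (v-eq (suc i) x)) (swap (c i) x (ev (t (suc i)) x)))))
      (trans (ℤ.+-identityˡ (sum (λ i → x * (c i * ev (t (suc i)) x)))) (trans (sum-*ˡ x (λ i → c i * ev (t (suc i)) x)) (trans (cong (x *_) (e x)) (ℤ.*-zeroʳ x))))
      where
      c′ : Fin (suc (suc n)) → ℤ
      c′ zero    = 0ℤ
      c′ (suc i) = c i
  ... | yes (j , hj≢0) = extend (dependent n w w-length)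
    where
    h : Fin (suc (suc n)) → ℤ
    h i = proj₁ (uncons n (v i) (l i))
    t : Fin (suc (suc n)) → Poly
    t i = proj₁ (proj₂ (uncons n (v i) (l i)))
    lt : ∀ i → length (t i) ≤ n
    lt i = proj₁ (proj₂ (proj₂ (uncons n (v i) (l i))))
    v-eq : ∀ i x → ev (v i) x ≡ h i + x * ev (t i) x
    v-eq i = proj₂ (proj₂ (proj₂ (uncons n (v i) (l i))))
    w : Fin (suc n) → Poly
    w i = map (h j *_) (t (punchIn j i)) ⊕ map (- h (punchIn j i) *_) (t j)
    w-length : ∀ i → length (w i) ≤ n
    w-length i = length-⊕ (map (h j *_) (t (punchIn j i))) (map (- h (punchIn j i) *_) (t j))
      (length-scale (h j) (t (punchIn j i)) (lt (punchIn j i))) (length-scale (- h (punchIn j i)) (t j) (lt j))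
    w-eq : ∀ i x → ev (w i) x ≡ h j * ev (t (punchIn j i)) x + - h (punchIn j i) * ev (t j) x
    w-eq i x = trans (ev-⊕ (map (h j *_) (t (punchIn j i))) (map (- h (punchIn j i) *_) (t j)) x)
      (cong₂ _+_ (ev-scale (h j) (t (punchIn j i)) x) (ev-scale (- h (punchIn j i)) (t j) x))
    eliminate : ∀ c a b s t x → c * b * (a + x * s) ≡ x * (c * (b * s + - a * t)) + (c * a) * (b + x * t)
    eliminate = solve-∀
    extend : Dependent w → Dependent v
    extend (c , (i , ci≢0) , e) = c′ , (punchIn j i , λ z → *-≢0 ci≢0 hj≢0 (trans (sym (insertAt-punchIn c″ j (- S) i)) z)) , λ x → begin
      sum (λ i → c′ i * ev (v i) x)
        ≡⟨ sum-remove {i = j} (λ i → c′ i * ev (v i) x) ⟩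
      c′ j * ev (v j) x + sum (λ i → c′ (punchIn j i) * ev (v (punchIn j i)) x)
        ≡⟨ cong₂ _+_ (cong₂ _*_ (insertAt-lookup c″ j (- S)) (v-eq j x)) (sum-cong-≗ (λ i →
             trans (cong₂ _*_ (insertAt-punchIn c″ j (- S) i) (v-eq (punchIn j i) x))
             (trans (eliminate (c i) (h (punchIn j i)) (h j) (ev (t (punchIn j i)) x) (ev (t j) x) x)
                    (cong (λ z → x * (c i * z) + c i * h (punchIn j i) * (h j + x * ev (t j) x)) (sym (w-eq i x)))))) ⟩
      - S * (h j + x * ev (t j) x) + sum (λ i → x * (c i * ev (w i) x) + c i * h (punchIn j i) * (h j + x * ev (t j) x))
        ≡⟨ cong (λ z → - S * (h j + x * ev (t j) x) + z)
             (trans (∑-distrib-+ (λ i → x * (c i * ev (w i) x)) (λ i → c i * h (punchIn j i) * (h j + x * ev (t j) x)))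
               (cong₂ _+_ (trans (sum-*ˡ x (λ i → c i * ev (w i) x)) (cong (x *_) (e x)))
                 (trans (sum-cong-≗ (λ i → ℤ.*-comm (c i * h (punchIn j i)) (h j + x * ev (t j) x)))
                   (sum-*ˡ (h j + x * ev (t j) x) (λ i → c i * h (punchIn j i)))))) ⟩
      - S * (h j + x * ev (t j) x) + (x * 0ℤ + (h j + x * ev (t j) x) * S)
        ≡⟨ vanish S (h j + x * ev (t j) x) x ⟩
      0ℤ ∎
      where
      open ≡-Reasoning
      -- Expressing `h j` times the other polynomials through `w` produces S copies of `v j`; the
      -- pivot receives - S to cancel them.
      S : ℤ
      S = sum (λ i → c i * h (punchIn j i))
      c″ : Fin (suc n) → ℤ
      c″ i = c i * h j
      c′ : Fin (suc (suc n)) → ℤ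
      c′ = insertAt c″ j (- S)
      vanish : ∀ s y x → - s * y + (x * 0ℤ + y * s) ≡ 0ℤ
      vanish = solve-∀

  ev-tabulate : ∀ {n} (c : Fin n → ℤ) y → ev (tabulate c) y ≡ sum (λ i → c i * y ^ toℕ i)
  ev-tabulate {zero}  c y = refl
  ev-tabulate {suc n} c y = cong₂ _+_ (sym (ℤ.*-identityʳ (c zero))) (trans (cong (y *_) (ev-tabulate (λ i → c (suc i)) y))
    (trans (*-distribˡ-sum y (λ i → c (suc i) * y ^ toℕ i)) (sum-cong-≗ (λ i → swap y (c (suc i)) (y ^ toℕ i)))))
    where
    swap : ∀ y c z → y * (c * z) ≡ c * (y * z)
    swap = solve-∀

  sumᵖ : ∀ {n} → (Fin n → Pol) → Pol
  sumᵖ {zero}  p = constᵖ 0ℤ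
  sumᵖ {suc n} p = p zero +ᵖ sumᵖ (λ i → p (suc i))

  fn-sumᵖ : ∀ {n} (p : Fin n → Pol) x → fn (sumᵖ p) x ≡ sum (λ i → fn (p i) x)
  fn-sumᵖ {zero}  p x = refl
  fn-sumᵖ {suc n} p x = cong (_+_ (fn (p zero) x)) (fn-sumᵖ (λ i → p (suc i)) x)

  weightedFrom-∷ʳ : ∀ n p γ → weightedFrom n (p ∷ʳ γ) ≡ weightedFrom n p ∷ʳ (+ (n ℕ.+ length p) * γ)
  weightedFrom-∷ʳ n []      γ = cong (λ m → + m * γ ∷ []) (sym (ℕ.+-identityʳ n))
  weightedFrom-∷ʳ n (a ∷ p) γ = cong (+ n * a ∷_) (trans (weightedFrom-∷ʳ (suc n) p γ)
    (cong (λ m → weightedFrom (suc n) p ∷ʳ (+ m * γ)) (sym (ℕ.+-suc n (length p)))))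

  length-weightedFrom : ∀ n p → length (weightedFrom n p) ≡ length p
  length-weightedFrom n []      = refl
  length-weightedFrom n (_ ∷ p) = cong suc (length-weightedFrom (suc n) p)

  -- The polynomial c vanishes at the critical values of g; it comes from a
  -- linear relation between the powers of g modulo g′.
  criticalValues : ∀ a p γ → γ ≢ 0ℤ →
    ∃[ c ] (Leading c × length c ≤ suc (length p) × D ⌈ a ∷ p ∷ʳ γ ⌉ ∣ᵖ ⌈ c ⌉ ∘ᵖ ⌈ a ∷ p ∷ʳ γ ⌉)
  criticalValues a p γ γ≢0 = C , leading-C , ℕ.≤-reflexive (length-tabulate coef) ,
    dvd 1ℤ (sumᵖ (λ i → constᵖ (c i) *ᵖ ⌈ s i ⌉)) 1≢0 λ x → begin
      1ℤ * ev C (fn g x)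
        ≡⟨ trans (ℤ.*-identityˡ (ev C (fn g x))) (ev-tabulate coef (fn g x)) ⟩
      sum (λ i → c i * κ i * fn g x ^ toℕ i)
        ≡⟨ sum-cong-≗ (λ i → term i x) ⟩
      sum (λ i → dn g x * (c i * ev (s i) x) + c i * ev (r i) x)
        ≡⟨ ∑-distrib-+ (λ i → dn g x * (c i * ev (s i) x)) (λ i → c i * ev (r i) x) ⟩
      sum (λ i → dn g x * (c i * ev (s i) x)) + sum (λ i → c i * ev (r i) x)
        ≡⟨ cong₂ _+_ (sum-*ˡ (dn g x) (λ i → c i * ev (s i) x)) (relation x) ⟩
      dn g x * sum (λ i → c i * ev (s i) x) + 0ℤ
        ≡⟨ trans (ℤ.+-identityʳ (dn g x * sum (λ i → c i * ev (s i) x))) (cong (dn g x *_) (sym (fn-sumᵖ (λ i → constᵖ (c i) *ᵖ ⌈ s i ⌉) x))) ⟩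
      dn g x * fn (sumᵖ (λ i → constᵖ (c i) *ᵖ ⌈ s i ⌉)) x ∎
    where
    open ≡-Reasoning
    g : Pol
    g = ⌈ a ∷ p ∷ʳ γ ⌉
    m : Poly
    m = weightedFrom 1 p
    β : ℤ
    β = + suc (length p) * γ
    β≢0 : β ≢ 0ℤ
    β≢0 = *-≢0 {+ suc (length p)} (λ ()) γ≢0
    dm : ∀ i → DivMod (m ∷ʳ β) (code (g ^ᵖ i)) (length m)
    dm i = divMod m β β≢0 (code (g ^ᵖ i))
    e : ℕ
    e = suc (length p)
    κ : Fin e → ℤ
    κ i = proj₁ (dm (toℕ i))
    s r : Fin e → Poly
    s i = proj₁ (proj₂ (dm (toℕ i)))
    r i = proj₁ (proj₂ (proj₂ (dm (toℕ i))))
    -- There are deg g powers of g, while the remainders modulo g′ have at most deg g - 1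
    -- coefficients. So `c` gets a degree below deg g.
    dep : Dependent r
    dep = dependent (length p) r (λ i → ℕ.≤-trans (proj₁ (proj₂ (proj₂ (proj₂ (proj₂ (dm (toℕ i)))))))
                                                  (ℕ.≤-reflexive (length-weightedFrom 1 p)))
    c : Fin e → ℤ
    c = proj₁ dep
    relation : ∀ x → sum (λ i → c i * ev (r i) x) ≡ 0ℤ
    relation = proj₂ (proj₂ dep)
    coef : Fin e → ℤ
    coef i = c i * κ i
    C : Poly
    C = tabulate coef
    leading-C : Leading C
    leading-C with leading C | proj₁ (proj₂ dep)
    ... | inj₂ ld | _          = ld
    ... | inj₁ z  | i , ci≢0 = ⊥-elim (*-≢0 ci≢0 (proj₁ (proj₂ (proj₂ (proj₂ (dm (toℕ i)))))) (All.tabulate⁻ {f = coef} z i))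
    rearrange : ∀ c d s r → c * (d * s + r) ≡ d * (c * s) + c * r
    rearrange = solve-∀
    term : ∀ i x → c i * κ i * fn g x ^ toℕ i ≡ dn g x * (c i * ev (s i) x) + c i * ev (r i) x
    term i x = trans (ℤ.*-assoc (c i) (κ i) (fn g x ^ toℕ i)) (trans (cong (λ t → c i * (κ i * t))
        (trans (sym (fn-^ g (toℕ i) x)) (fn≡ (g ^ᵖ toℕ i) x)))
      (trans (cong (c i *_) (trans (proj₂ (proj₂ (proj₂ (proj₂ (proj₂ (dm (toℕ i)))))) x)
        (cong (λ q → ev q x * ev (s i) x + ev (r i) x) (sym (weightedFrom-∷ʳ 1 p γ)))))
      (rearrange (c i) (dn g x) (ev (s i) x) (ev (r i) x))))

  -- Belyi polynomials

  -- Stands for "nonconstant", in a form that passes directly to composites and products.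
  Tends : Pol → Set
  Tends p = ∀ M → ∃[ B ] (∀ x → B ≤ abs x → M ≤ abs (fn p x))

  Tends-growth : ∀ p n C B → (∀ x → B ≤ abs x → abs x ℕ.^ suc n ≤ C ℕ.* abs (fn p x)) → Tends p
  Tends-growth p n C B h M = B ⊔ suc (C ℕ.* M) , λ x le → ℕ.<⇒≤ (ℕ.*-cancelˡ-< C M _ (ℕ.≤-trans
    (ℕ.≤-trans (ℕ.m≤n⊔m B _) le) (ℕ.≤-trans (ℕ.m≤m*n (abs x) (abs x ℕ.^ n) {{ℕ.>-nonZero (1≤^ n
      (ℕ.≤-trans (s≤s z≤n) (ℕ.≤-trans (ℕ.m≤n⊔m B (suc (C ℕ.* M))) le)))}}) (h x (ℕ.≤-trans (ℕ.m≤m⊔n B _) le)))))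

  Tends-X+ : ∀ a → Tends (X+ᵖ a)
  Tends-X+ a M = M ℕ.+ abs a , λ x le → ℕ.+-cancelʳ-≤ (abs a) _ _ (ℕ.≤-trans le (∣+∣≥ x a))

  Tends-∘ : ∀ p q → Tends p → Tends q → Tends (p ∘ᵖ q)
  Tends-∘ p q hp hq M = let (B , h) = hp M; (B′ , h′) = hq B in B′ , λ x le → h (fn q x) (h′ x le)

  Tends-* : ∀ p q → Tends p → Tends q → Tends (p *ᵖ q)
  Tends-* p q hp hq M = let (B , h) = hp M; (B′ , h′) = hq 1 in B ⊔ B′ , λ x le →
    ℕ.≤-trans (h x (ℕ.≤-trans (ℕ.m≤m⊔n B B′) le)) (ℕ.≤-trans
      (ℕ.m≤m*n (abs (fn p x)) (abs (fn q x)) {{ℕ.>-nonZero (h′ x (ℕ.≤-trans (ℕ.m≤n⊔m B B′) le))}})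
      (ℕ.≤-reflexive (sym (ℤ.abs-* (fn p x) (fn q x)))))

  Tends-^ : ∀ p n → Tends p → Tends (p ^ᵖ suc n)
  Tends-^ p zero    h M = let (B , h′) = h M in B , λ x le → subst (λ t → M ≤ abs t) (sym (ℤ.*-identityʳ (fn p x))) (h′ x le)
  Tends-^ p (suc n) h   = Tends-* p (p ^ᵖ suc n) h (Tends-^ p n h)

  -- φ maps the roots of s and its own critical points into {0, c}.
  record Belyi (s : Pol) : Set where
    field
      φ       : Pol
      c       : ℤ
      k       : ℕ
      c≢0     : c ≢ 0ℤ
      tends   : Tends φ
      divides : s *ᵖ D φ ∣ᵖ (φ *ᵖ (φ +ᵖ constᵖ (- c))) ^ᵖ k

  ∣-∘ : ∀ p q φ → p ∣ᵖ q → p ∘ᵖ φ ∣ᵖ q ∘ᵖ φ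
  ∣-∘ p q φ (dvd κ r κ≢0 e) = dvd κ (r ∘ᵖ φ) κ≢0 λ x → e (fn φ x)

  -- Chain rule: s (ψ ∘ φ)′ = (s φ′) (ψ′ ∘ φ) divides a power of (h ψ′) ∘ φ, hence of ψ (ψ - c)
  -- composed with φ. So s may be replaced by any h whose roots include the images of the roots of s
  -- and the critical values of φ.
  belyi-∘ : ∀ s h φ k → Tends φ → s *ᵖ D φ ∣ᵖ (h ∘ᵖ φ) ^ᵖ k → Belyi h → Belyi s
  belyi-∘ s h φ k φ-tends d b = record
    { φ = ψ ∘ᵖ φ ; c = c ; k = j ℕ.* suc k ; c≢0 = c≢0 ; tends = Tends-∘ ψ φ ψ-tends φ-tends
    ; divides =
        ∣-trans _ (s *ᵖ D φ *ᵖ (D ψ ∘ᵖ φ)) _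
          (≐⇒∣ (s *ᵖ D (ψ ∘ᵖ φ)) (s *ᵖ D φ *ᵖ (D ψ ∘ᵖ φ)) λ x → rearrange (fn s x) (dn ψ (fn φ x)) (dn φ x))
        -- The exponent is `suc k` because the factor ψ′ ∘ φ has to occur also for k = 0.
        (∣-trans _ ((h ∘ᵖ φ) ^ᵖ suc k *ᵖ (D ψ ∘ᵖ φ) ^ᵖ suc k) _
          (∣-* _ _ _ _ (∣-trans _ _ _ d (∣-factorʳ ((h ∘ᵖ φ) ^ᵖ k) (h ∘ᵖ φ))) (∣-factorˡ (D ψ ∘ᵖ φ) ((D ψ ∘ᵖ φ) ^ᵖ k)))
        (∣-trans _ (((h *ᵖ D ψ) ∘ᵖ φ) ^ᵖ suc k) _
          (≐⇒∣ _ _ λ x → trans (sym (^ᵖ-*ᵖ (h ∘ᵖ φ) (D ψ ∘ᵖ φ) (suc k) x))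
             (trans (fn-^ ((h ∘ᵖ φ) *ᵖ (D ψ ∘ᵖ φ)) (suc k) x) (sym (fn-^ ((h *ᵖ D ψ) ∘ᵖ φ) (suc k) x))))
          (∣-power-trans _ ((h *ᵖ D ψ) ∘ᵖ φ) (ψφ *ᵖ (ψφ +ᵖ constᵖ (- c))) (suc k) j (∣-refl _)
             (∣-trans _ (((ψ *ᵖ (ψ +ᵖ constᵖ (- c))) ^ᵖ j) ∘ᵖ φ) _ (∣-∘ _ _ φ divides)
               (≐⇒∣ _ _ λ x → trans (fn-^ (ψ *ᵖ (ψ +ᵖ constᵖ (- c))) j (fn φ x))
                  (sym (fn-^ (ψφ *ᵖ (ψφ +ᵖ constᵖ (- c))) j x)))))))
    }
    where
    open Belyi b renaming (φ to ψ; tends to ψ-tends; k to j)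
    ψφ : Pol
    ψφ = ψ ∘ᵖ φ
    rearrange : ∀ s p q → s * (p * q) ≡ s * q * p
    rearrange = solve-∀

  Xᵖ : Pol
  Xᵖ = X+ᵖ 0ℤ

  -- Composition with φ = X, whose derivative is 1.
  belyi-mono : ∀ s h k → s ∣ᵖ h ^ᵖ k → Belyi h → Belyi s
  belyi-mono s h k d = belyi-∘ s h Xᵖ k (Tends-X+ 0ℤ) (∣-trans _ s _ (≐⇒∣ (s *ᵖ D Xᵖ) s (λ x →
    ℤ.*-identityʳ (fn s x)))
    (∣-trans _ (h ^ᵖ k) _ d (≐⇒∣ _ _ λ x → trans (fn-^ h k x) (trans (cong (λ y → fn h y ^ k) (sym (ℤ.+-identityʳ x)))
      (sym (fn-^ (h ∘ᵖ Xᵖ) k x))))))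

  belyi-∣ : ∀ s h → s ∣ᵖ h → Belyi h → Belyi s
  belyi-∣ s h d = belyi-mono s h 1 (∣-trans s h _ d (≐⇒∣ h (h ^ᵖ 1) (λ x → sym (ℤ.*-identityʳ (fn h x)))))

  linears : List ℤ → Pol
  linears []      = constᵖ 1ℤ
  linears (a ∷ A) = X+ᵖ (- a) *ᵖ linears A

  factor-theorem : ∀ p a → X+ᵖ (- a) ∣ᵖ p +ᵖ constᵖ (- fn p a)
  factor-theorem p a = let (q , e) = divide (code p) in dvd 1ℤ ⌈ q ⌉ 1≢0 λ x →
    trans (ℤ.*-identityˡ _) (trans (cong₂ _-_ (fn≡ p x) (fn≡ p a)) (trans (cong (_- ev (code p) a) (e x)) (cancel _ _)))
    where
    cancel : ∀ m n → m + n - n ≡ m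
    cancel = solve-∀
    rearrange : ∀ b x a q v → b + x * ((x - a) * q + v) ≡ (x - a) * (v + x * q) + (b + a * v)
    rearrange = solve-∀
    divide : ∀ p → ∃[ q ] (∀ x → ev p x ≡ (x - a) * ev q x + ev p a)
    divide []      = [] , λ x → sym (trans (ℤ.+-identityʳ _) (ℤ.*-zeroʳ (x - a)))
    divide (b ∷ p) = let (q , e) = divide p in ev p a ∷ q , λ x →
      trans (cong (λ t → b + x * t) (e x)) (rearrange b x a (ev q x) (ev p a))

  linears-∣ : ∀ g A → linears A ∣ᵖ linears (map (fn g) A) ∘ᵖ g
  linears-∣ g []      = ≐⇒∣ _ _ λ _ → refl
  linears-∣ g (a ∷ A) = ∣-trans _ ((g +ᵖ constᵖ (- fn g a)) *ᵖ (linears (map (fn g) A) ∘ᵖ g)) _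
    (∣-* _ _ _ _ (factor-theorem g a) (linears-∣ g A)) (≐⇒∣ _ _ λ _ → refl)

  dn-X+^ : ∀ a n x → dn ((X+ᵖ a) ^ᵖ suc n) x ≡ + suc n * fn ((X+ᵖ a) ^ᵖ n) x
  dn-X+^ a zero    x = trans (cong (_+_ (1ℤ * 1ℤ)) (ℤ.*-zeroʳ (x + a))) refl
  dn-X+^ a (suc n) x = trans (cong (λ t → 1ℤ * fn ((X+ᵖ a) ^ᵖ suc n) x + (x + a) * t) (dn-X+^ a n x))
    (collect (x + a) (fn ((X+ᵖ a) ^ᵖ n) x) (+ suc n))
    where
    collect : ∀ y p n → 1ℤ * (y * p) + y * (n * p) ≡ (1ℤ + n) * (y * p)
    collect = solve-∀

  -- φ = (X - a)ᵘ⁺¹ (X - c)ᵛ⁺¹ with b = a + (u + 1) and c = b + (v + 1) has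
  -- critical points a, b, c only, and φ(a) = φ(c) = 0.
  merging : ℤ → ℕ → ℕ → Pol
  merging a u v = (X+ᵖ (- a)) ^ᵖ suc u *ᵖ (X+ᵖ (- (a + + suc u + + suc v))) ^ᵖ suc v

  -- Here s φ′ is a constant times (X - b)² φ times the factors of A. The exponent 2 is due to b,
  -- which is both one of the points and a critical point. Since a and c both go to 0, one point
  -- fewer remains.
  belyi-merge : ∀ a u v A → let b = a + + suc u; c = b + + suc v; φ = merging a u v in
    Belyi (linears (0ℤ ∷ fn φ b ∷ map (fn φ) A)) → Belyi (linears (a ∷ b ∷ c ∷ A))
  belyi-merge a u v A = belyi-∘ (linears (a ∷ b ∷ c ∷ A)) h φ 2
    (Tends-* (P ^ᵖ suc u) (Q ^ᵖ suc v) (Tends-^ P u (Tends-X+ (- a))) (Tends-^ Q v (Tends-X+ (- c))))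
    (∣-trans _ (X+ᵖ (- b) *ᵖ X+ᵖ (- b) *ᵖ (φ *ᵖ linears A)) _
      (dvd (+ suc u + + suc v) (constᵖ 1ℤ) (λ ()) λ x → sym (trans (cong (λ t → fn (linears (a ∷ b ∷ c ∷ A)) x * t * 1ℤ) (dφ x))
        (split (fn P x) (x - b) (fn Q x) (fn (linears A) x) (+ suc u + + suc v) (fn (P ^ᵖ u) x) (fn (Q ^ᵖ v) x))))
      (∣-trans _ ((φ +ᵖ constᵖ (- fn φ b)) *ᵖ (φ +ᵖ constᵖ (- fn φ b)) *ᵖ (φ *ᵖ (L ∘ᵖ φ))) _
        (∣-* _ _ _ _ (∣-* _ _ _ _ (factor-theorem φ b) (factor-theorem φ b)) (∣-* _ _ _ _ (∣-refl φ) (linears-∣ φ A)))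
        (dvd 1ℤ (φ *ᵖ (L ∘ᵖ φ)) 1≢0 λ x → regroup (fn φ x) (fn φ x + - fn φ b) (fn L (fn φ x)))))
    where
    b c : ℤ
    b = a + + suc u
    c = b + + suc v
    P Q φ L h : Pol
    P = X+ᵖ (- a)
    Q = X+ᵖ (- c)
    φ = P ^ᵖ suc u *ᵖ Q ^ᵖ suc v
    L = linears (map (fn φ) A)
    h = linears (0ℤ ∷ fn φ b ∷ map (fn φ) A)
    regroup : ∀ p q l → 1ℤ * ((p + 0ℤ) * (q * l) * ((p + 0ℤ) * (q * l) * 1ℤ)) ≡ q * q * (p * l) * (p * l)
    regroup = solve-∀
    split : ∀ p y q l k pu qv → p * (y * (q * l)) * (k * (y * (pu * qv))) * 1ℤ ≡ k * (y * y * (p * pu * (q * qv) * l))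
    split = solve-∀
    critical : ∀ x a u v pu qv →
      u * pu * ((x + - (a + u + v)) * qv) + (x + - a) * pu * (v * qv) ≡ (u + v) * ((x + - (a + u)) * (pu * qv))
    critical = solve-∀
    dφ : ∀ x → dn φ x ≡ (+ suc u + + suc v) * ((x - b) * (fn (P ^ᵖ u) x * fn (Q ^ᵖ v) x))
    dφ x = trans (cong₂ (λ s t → s * fn (Q ^ᵖ suc v) x + fn (P ^ᵖ suc u) x * t) (dn-X+^ (- a) u x) (dn-X+^ (- c) v x))
      (critical x a (+ suc u) (+ suc v) (fn (P ^ᵖ u) x) (fn (Q ^ᵖ v) x))

  <⇒+suc : ∀ {i j} → i ℤ.< j → ∃[ n ] j ≡ i + + suc n
  <⇒+suc {i} {j} i<j = abs (j - sucℤ i) , sym (trans (split i (+ abs (j - sucℤ i)))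
    (trans (cong (_+_ (sucℤ i)) (ℤ.0≤i⇒+∣i∣≡i (ℤ.i≤j⇒0≤j-i (ℤ.i<j⇒suc[i]≤j i<j)))) (cancel (sucℤ i) j)))
    where
    split : ∀ i n → i + (1ℤ + n) ≡ 1ℤ + i + n
    split = solve-∀
    cancel : ∀ i j → i + (j - i) ≡ j
    cancel = solve-∀

  -- Up to two distinct points are moved into {0, c} by a translation. Among three or more, a
  -- repeated point is dropped at the cost of an exponent, and three distinct ones are merged after
  -- being put in increasing order; either way the list gets shorter.
  belyi-linears : ∀ n A → length A ≤ n → Belyi (linears A)
  belyi-linears n [] l = record
    { φ = Xᵖ ; c = 1ℤ ; k = 0 ; c≢0 = 1≢0 ; tends = Tends-X+ 0ℤ ; divides = ≐⇒∣ _ _ λ x → refl }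
  belyi-linears n (a ∷ []) l = record
    { φ = X+ᵖ (- a) ; c = 1ℤ ; k = 1 ; c≢0 = 1≢0 ; tends = Tends-X+ (- a)
    ; divides = dvd 1ℤ (X+ᵖ (- a) +ᵖ constᵖ -1ℤ) 1≢0 λ x → once (x + - a) (x + - a + -1ℤ) }
    where
    once : ∀ y z → 1ℤ * (y * z * 1ℤ) ≡ y * 1ℤ * 1ℤ * z
    once = solve-∀
  belyi-linears n (a ∷ b ∷ []) l with a ℤ.≟ b
  belyi-linears (suc n) (a ∷ a ∷ []) (s≤s l) | yes refl =
    belyi-mono _ (linears (a ∷ [])) 2 (≐⇒∣ _ _ λ x → square (x - a)) (belyi-linears n (a ∷ []) l)
    where
    square : ∀ y → y * (y * 1ℤ) ≡ y * 1ℤ * (y * 1ℤ * 1ℤ)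
    square = solve-∀
  ... | no a≢b = record
    { φ = X+ᵖ (- a) ; c = b - a ; k = 1 ; c≢0 = λ e → a≢b (sym (ℤ.i-j≡0⇒i≡j b a e)) ; tends = Tends-X+ (- a)
    ; divides = ≐⇒∣ _ _ λ x → shift x a b }
    where
    shift : ∀ x a b → (x + - a) * ((x + - b) * 1ℤ) * 1ℤ ≡ (x + - a) * (x + - a + - (b - a)) * 1ℤ
    shift = solve-∀
  belyi-linears (suc n) (a ∷ b ∷ c ∷ A) (s≤s l) = order (ℤ.<-cmp a b) (ℤ.<-cmp b c) (ℤ.<-cmp a c)
    where
    l′ : ∀ {m : ℕ} (f : ℤ → ℤ) → suc (suc (length A)) ≤ m → suc (suc (length (map f A))) ≤ m
    l′ f = subst (λ k → suc (suc k) ≤ _) (sym (length-map f A))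
    sorted : ∀ {a b c} → a ℤ.< b → b ℤ.< c → Belyi (linears (a ∷ b ∷ c ∷ A))
    sorted {a} {b} {c} a<b b<c with <⇒+suc a<b | <⇒+suc b<c
    ... | u , refl | v , refl = belyi-merge a u v A (belyi-linears n (0ℤ ∷ fn φ b ∷ map (fn φ) A) (l′ (fn φ) l))
      where
      φ : Pol
      φ = merging a u v
    permuted : ∀ {a b c a′ b′ c′} → (∀ x l → (x + - a) * ((x + - b) * ((x + - c) * l)) ≡ (x + - a′) * ((x + - b′) * ((x + - c′) * l))) →
      Belyi (linears (a′ ∷ b′ ∷ c′ ∷ A)) → Belyi (linears (a ∷ b ∷ c ∷ A))
    permuted e = belyi-∣ _ _ (≐⇒∣ _ _ λ x → e x (fn (linears A) x))
    duplicate : ∀ {a b c} d e → (∀ x l → (x + - a) * ((x + - b) * ((x + - c) * l)) ≡ (x + - d) * ((x + - d) * ((x + - e) * l))) →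
      Belyi (linears (a ∷ b ∷ c ∷ A))
    duplicate d e eq = belyi-mono _ (linears (d ∷ e ∷ A)) 2 (dvd 1ℤ ((X+ᵖ (- e)) *ᵖ linears A) 1≢0 λ x →
        trans (square (x - d) (x - e) (fn (linears A) x)) (cong (_* ((x - e) * fn (linears A) x)) (sym (eq x _))))
      (belyi-linears n (d ∷ e ∷ A) l)
      where
      square : ∀ y z l → 1ℤ * (y * (z * l) * (y * (z * l) * 1ℤ)) ≡ y * (y * (z * l)) * (z * l)
      square = solve-∀
    order : _ → _ → _ → Belyi (linears (a ∷ b ∷ c ∷ A))
    order (tri≈ _ refl _) _ _ = duplicate a c (λ x l → refl)
    order _ (tri≈ _ refl _) _ = duplicate b a (λ x l → rotate (x - a) (x - b) l)
      where
      rotate : ∀ a b l → a * (b * (b * l)) ≡ b * (b * (a * l))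
      rotate = solve-∀
    order _ _ (tri≈ _ refl _) = duplicate a b (λ x l → rotate (x - a) (x - b) l)
      where
      rotate : ∀ a b l → a * (b * (a * l)) ≡ a * (a * (b * l))
      rotate = solve-∀
    order (tri< a<b _ _) (tri< b<c _ _) _ = sorted a<b b<c
    order (tri< a<b _ _) (tri> _ _ c<b) (tri< a<c _ _) = permuted (λ x l → swap₂₃ (x - a) (x - b) (x - c) l) (sorted a<c c<b)
      where
      swap₂₃ : ∀ a b c l → a * (b * (c * l)) ≡ a * (c * (b * l))
      swap₂₃ = solve-∀
    order (tri< a<b _ _) (tri> _ _ c<b) (tri> _ _ c<a) = permuted (λ x l → cycle (x - a) (x - b) (x - c) l) (sorted c<a a<b)
      where
      cycle : ∀ a b c l → a * (b * (c * l)) ≡ c * (a * (b * l))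
      cycle = solve-∀
    order (tri> _ _ b<a) (tri< b<c _ _) (tri< a<c _ _) = permuted (λ x l → swap₁₂ (x - a) (x - b) (x - c) l) (sorted b<a a<c)
      where
      swap₁₂ : ∀ a b c l → a * (b * (c * l)) ≡ b * (a * (c * l))
      swap₁₂ = solve-∀
    order (tri> _ _ b<a) (tri< b<c _ _) (tri> _ _ c<a) = permuted (λ x l → cycle (x - a) (x - b) (x - c) l) (sorted b<c c<a)
      where
      cycle : ∀ a b c l → a * (b * (c * l)) ≡ b * (c * (a * l))
      cycle = solve-∀
    order (tri> _ _ b<a) (tri> _ _ c<b) _ = permuted (λ x l → reverse₃ (x - a) (x - b) (x - c) l) (sorted c<b b<a)
      where
      reverse₃ : ∀ a b c l → a * (b * (c * l)) ≡ c * (b * (a * l))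
      reverse₃ = solve-∀

  -- Applying φ = g replaces the factor g by the point 0, the points of A by
  -- their images, and adds the critical values of g, which are the roots of
  -- a polynomial of smaller degree.
  belyi-mixed : ∀ n A p γ → γ ≢ 0ℤ → length p ≤ n → Belyi (linears A *ᵖ ⌈ p ∷ʳ γ ⌉)
  belyi-mixed n A [] γ γ≢0 l = belyi-∣ _ (linears A)
    (dvd γ (constᵖ 1ℤ) γ≢0 λ x → trans (swap γ (fn (linears A) x)) (cong (λ t → fn (linears A) x * t * 1ℤ) (sym (ev-const γ x))))
    (belyi-linears _ A ℕ.≤-refl)
    where
    swap : ∀ g a → g * a ≡ a * g * 1ℤ
    swap = solve-∀
  belyi-mixed (suc n) A (a ∷ p) γ γ≢0 (s≤s l) = let
      (c , (q , δ , δ≢0 , lq , e) , lc , d) = criticalValues a p γ γ≢0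
      (C , B , gr) = growth-lower (a ∷ p) γ γ≢0
      -- The new 0 is the image of the roots of g. The list may grow; the recursion is on the degree
      -- of the other factor, now that of `c`.
      A′ = 0ℤ ∷ map (fn g) A
    in belyi-∘ _ (linears A′ *ᵖ ⌈ q ∷ʳ δ ⌉) g 1 (Tends-growth g (length p) C B gr)
        (∣-trans _ (linears (map (fn g) A) ∘ᵖ g *ᵖ g *ᵖ (⌈ c ⌉ ∘ᵖ g)) _
          (∣-* _ _ _ _ (∣-* _ _ _ _ (linears-∣ g A) (∣-refl g)) d)
          (≐⇒∣ _ _ λ x → trans (cong (fn (linears (map (fn g) A)) (fn g x) * fn g x *_) (e (fn g x)))
             (rearrange (fn (linears (map (fn g) A)) (fn g x)) (fn g x) (ev (q ∷ʳ δ) (fn g x)))))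
        (belyi-mixed n A′ q δ δ≢0 (ℕ.≤-trans (ℕ.≤-pred (ℕ.≤-trans lq lc)) l))
    where
    g : Pol
    g = ⌈ a ∷ p ∷ʳ γ ⌉
    rearrange : ∀ l g c → l * g * c ≡ (g + 0ℤ) * l * c * 1ℤ
    rearrange = solve-∀

  abstract
    belyi : ∀ s → NonZeroᵖ s → Belyi s
    belyi s nz = let (p , γ , γ≢0 , _ , e) = leadingᵖ s nz in
      belyi-∣ s (linears [] *ᵖ ⌈ p ∷ʳ γ ⌉)
        (≐⇒∣ _ _ λ x → trans (fn≡ s x) (trans (e x) (sym (ℤ.*-identityˡ _))))
        (belyi-mixed _ [] p γ γ≢0 ℕ.≤-refl)

  belyi-product-NonZero : ∀ φ c → Tends φ → NonZeroᵖ (φ *ᵖ (φ +ᵖ constᵖ (- c)))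
  belyi-product-NonZero φ c tends = let (B , h) = tends (suc (abs c)); x = + B; big = h x ℕ.≤-refl in x ,
    *-≢0 {fn φ x} {fn φ x + - c} (λ z → ℕ.n≮0 (subst (λ t → suc (abs c) ≤ abs t) z big))
         (λ z → ℕ.<-irrefl refl (subst (λ t → suc (abs c) ≤ abs t) (ℤ.i-j≡0⇒i≡j (fn φ x) c z) big))

  -- For t = φ (φ - c) one has t′ = φ′ (2 φ - c), so φ′ divides t′ and `squarefree-*-∣` removes the
  -- exponent k.
  squarefree-belyi : ∀ s → NonZeroᵖ s → Squarefreeᵖ s →
    ∃[ φ ] ∃[ c ] (c ≢ 0ℤ × Tends φ × s *ᵖ D φ ∣ᵖ φ *ᵖ (φ +ᵖ constᵖ (- c)))
  squarefree-belyi s nz sqf = φ , c , c≢0 , tends , squarefree-*-∣ s (D φ) T k nz Dφ-nz sqf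
    (dvd 1ℤ (φ +ᵖ constᵖ (- c) +ᵖ φ) 1≢0 λ x → product-rule (dn φ x) (fn φ x) (- c)) divides
    where
    open Belyi (belyi s nz)
    product-rule : ∀ d p c → 1ℤ * (d * (p + c) + p * (d + 0ℤ)) ≡ d * (p + c + p)
    product-rule = solve-∀
    T : Pol
    T = φ *ᵖ (φ +ᵖ constᵖ (- c))
    T-nz : NonZeroᵖ T
    T-nz = belyi-product-NonZero φ c tends
    Dφ-nz : NonZeroᵖ (D φ)
    Dφ-nz = ∣-NonZero (D φ) (T ^ᵖ k) (∣-trans _ _ _ (∣-factorʳ (D φ) s) divides)
      (proj₁ T-nz , λ z → ^-≢0 k (proj₂ T-nz) (trans (sym (fn-^ T k _)) z))

-- Radicals, powerful numbers and the ABC bound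

module Radicals where

  open import Data.Empty using (⊥-elim)
  open import Data.List.Base using ([]; _∷_; upTo)
  open import Data.List.Membership.Propositional using (_∈_)
  open import Data.List.Membership.Propositional.Properties using (∈-filter⁺; ∈-filter⁻; ∈-upTo⁺)
  open import Data.List.Relation.Unary.All as All using (All; []; _∷_)
  open import Data.List.Relation.Unary.AllPairs using ([]; _∷_)
  open import Data.List.Relation.Unary.Any using (here; there)
  open import Data.List.Relation.Unary.Unique.Propositional using (Unique)
  open import Data.List.Relation.Unary.Unique.Propositional.Properties using (upTo⁺; filter⁺)
  open import Data.Nat.Base
  open import Data.Nat.Divisibility
  open import Data.Nat.GCD using (gcd; gcd[m,n]∣m; gcd[m,n]∣n; c*gcd[m,n]≡gcd[cm,cn]; gcd-zeroˡ)
  open import Data.Nat.ListAction using (product)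
  open import Data.Nat.ListAction.Properties using (∈⇒∣product)
  open import Data.Nat.Primality using (Prime; prime?; euclidsLemma; ¬prime[1]; prime⇒nonZero; prime⇒irreducible)
  open import Data.Nat.Properties
  open import Data.Nat.Tactic.RingSolver using (solve-∀)
  open import Data.Product.Base using (∃-syntax; _,_; proj₁; proj₂)
  open import Data.Sum.Base using (inj₁; inj₂)
  open import Relation.Binary.PropositionalEquality
  open import Relation.Nullary using (¬_)
  open import Relation.Nullary.Decidable using (_×-dec_)

  prime-∣-^ : ∀ {p} a n → Prime p → p ∣ a ^ n → p ∣ a
  prime-∣-^ a zero    pr d = ⊥-elim (¬prime[1] (subst Prime (∣1⇒≡1 d) pr))
  prime-∣-^ a (suc n) pr d with euclidsLemma a (a ^ n) pr d
  ... | inj₁ p∣a = p∣a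
  ... | inj₂ r   = prime-∣-^ a n pr r

  prime^-∣-* : ∀ {q} e a m → Prime q → ¬ q ∣ a → q ^ e ∣ a * m → q ^ e ∣ m
  prime^-∣-* zero    a m pr q∤a d = 1∣ m
  prime^-∣-* {q} (suc e) a m pr q∤a d with euclidsLemma a m pr (∣-trans (m∣m*n (q ^ e)) d)
  ... | inj₁ q∣a = ⊥-elim (q∤a q∣a)
  ... | inj₂ (divides-refl m′) = subst (q ^ suc e ∣_) (*-comm q m′) (*-monoʳ-∣ q
    (prime^-∣-* e a m′ pr q∤a (*-cancelˡ-∣ q {{prime⇒nonZero pr}} (subst (q ^ suc e ∣_) (swap a m′ q) d))))
    where
    swap : ∀ a m q → a * (m * q) ≡ q * (a * m)
    swap = solve-∀

  ^-distribʳ-*′ : ∀ m n e → (m * n) ^ e ≡ m ^ e * n ^ e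
  ^-distribʳ-*′ m n zero    = refl
  ^-distribʳ-*′ m n (suc e) = trans (cong (m * n *_) (^-distribʳ-*′ m n e)) (rearrange m n (m ^ e) (n ^ e))
    where
    rearrange : ∀ a b c d → a * b * (c * d) ≡ a * c * (b * d)
    rearrange = solve-∀

  -- The powers p ^ e are split off n one at a time; as the primes are distinct, the divisibility by
  -- the other powers passes to the quotient.
  product-^-∣ : ∀ e ps → Unique ps → (∀ {p} → p ∈ ps → Prime p) →
    ∀ n → (∀ {p} → p ∈ ps → p ^ e ∣ n) → product ps ^ e ∣ n
  product-^-∣ e []       _          _  n _ = subst (_∣ n) (sym (^-zeroˡ e)) (1∣ n)
  product-^-∣ e (p ∷ ps) (p∉ ∷ un) pr n h with h (here refl)
  ... | divides-refl m = subst₂ _∣_ (sym (^-distribʳ-*′ p (product ps) e)) (*-comm (p ^ e) m) (*-monoʳ-∣ (p ^ e)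
    (product-^-∣ e ps un (λ i → pr (there i)) m λ {q} i →
      prime^-∣-* e (p ^ e) m (pr (there i)) (q∤p^e i) (subst (q ^ e ∣_) (*-comm m (p ^ e)) (h (there i)))))
    where
    q∤p^e : ∀ {q} → q ∈ ps → ¬ q ∣ p ^ e
    q∤p^e {q} i d with prime⇒irreducible (pr (here refl)) (prime-∣-^ p e (pr (there i)) d)
    ... | inj₁ refl = ¬prime[1] (pr (there i))
    ... | inj₂ refl = All.lookup p∉ i refl

  radical-^-∣ : ∀ e n m → (∀ p → Prime p → p ∣ n → p ^ e ∣ m) → radical n ^ e ∣ m
  radical-^-∣ e n m h = product-^-∣ e _ (filter⁺ P? (upTo⁺ (suc n))) (λ i → proj₁ (proj₂ (∈-filter⁻ P? {xs = upTo (suc n)} i))) m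
    λ i → let (pr , d) = proj₂ (∈-filter⁻ P? {xs = upTo (suc n)} i) in h _ pr d
    where
    P? = λ p → prime? p ×-dec p ∣? n

  radical-∣ : ∀ n m → (∀ p → Prime p → p ∣ n → p ∣ m) → radical n ∣ m
  radical-∣ n m h = subst (_∣ m) (^-identityʳ (radical n))
    (radical-^-∣ 1 n m (λ p pr d → subst (_∣ m) (sym (^-identityʳ p)) (h p pr d)))

  prime∣radical : ∀ {p} n → 0 < n → Prime p → p ∣ n → p ∣ radical n
  prime∣radical {p} n 0<n pr d = ∈⇒∣product (∈-filter⁺ (λ p → prime? p ×-dec p ∣? n)
    (∈-upTo⁺ (s≤s (∣⇒≤ {{>-nonZero 0<n}} d))) (pr , d))

  -- 0 and 1 count as powerful, so zeros of the polynomial are among the values treated.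
  Powerful : ℕ → Set
  Powerful n = ∀ p → Prime p → p ∣ n → p ^ 2 ∣ n

  radical²≤ : ∀ n → 0 < n → Powerful n → radical n ^ 2 ≤ n
  radical²≤ n 0<n pw = ∣⇒≤ {{>-nonZero 0<n}} (radical-^-∣ 2 n n pw)

  radical>0 : ∀ n → 0 < n → 0 < radical n
  radical>0 n 0<n = >-nonZero⁻¹ _ {{≢-nonZero λ z → <⇒≢ 0<n (sym (0∣⇒≡0 (subst (_∣ n) z (radical-∣ n n (λ _ _ d → d)))))}}

  -- The ABC bound without coprimality: the common factor of X and Y divides Y.
  abc-bound : ABC-Conjecture → ∀ s → 0 < s → ∃[ C ] (∀ X Y Z M → 0 < X → 0 < Y → 0 < M → X + Y ≡ Z →
    (∀ p → Prime p → p ∣ X * Y * Z → p ∣ M) → Z ^ s ≤ (Y * C) ^ s * M ^ (s + 1))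
  -- Here ε = 1 / s. M stands in for the radical: a number divisible by every prime of X Y Z is
  -- divisible by the radical, also after the common factor g is removed.
  abc-bound abc s 0<s = let (C , bound) = abc 1 s (s≤s z≤n) 0<s in C , λ X Y Z M 0<X 0<Y 0<M X+Y≡Z h →
    let
      g = gcd X Y
      divides X′ X≡ = gcd[m,n]∣m X Y
      divides Y′ Y≡ = gcd[m,n]∣n X Y
      Z≡ : Z ≡ g * (X′ + Y′)
      Z≡ = trans (sym X+Y≡Z) (trans (cong₂ _+_ X≡ Y≡) (trans (sym (*-distribʳ-+ g X′ Y′)) (*-comm (X′ + Y′) g)))
      instance
        g-nz : NonZero g
        g-nz = ≢-nonZero λ z → <⇒≢ 0<X (sym (trans X≡ (trans (cong (X′ *_) z) (*-zeroʳ X′))))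
      0<X′ : 0 < X′
      0<X′ = n≢0⇒n>0 λ z → <⇒≢ 0<X (sym (trans X≡ (cong (_* g) z)))
      0<Y′ : 0 < Y′
      0<Y′ = n≢0⇒n>0 λ z → <⇒≢ 0<Y (sym (trans Y≡ (cong (_* g) z)))
      coprime : gcd X′ Y′ ≡ 1
      coprime = *-cancelˡ-≡ (gcd X′ Y′) 1 g (trans (c*gcd[m,n]≡gcd[cm,cn] g X′ Y′)
        (trans (cong₂ gcd (trans (*-comm g X′) (sym X≡)) (trans (*-comm g Y′) (sym Y≡))) (sym (*-identityʳ g))))
      rad∣ : radical (X′ * Y′ * (X′ + Y′)) ∣ M
      rad∣ = radical-∣ (X′ * Y′ * (X′ + Y′)) M λ p pr d → h p pr (∣-trans d (*-pres-∣ (*-pres-∣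
        (subst (X′ ∣_) (sym X≡) (m∣m*n g)) (subst (Y′ ∣_) (sym Y≡) (m∣m*n g)))
        (subst ((X′ + Y′) ∣_) (sym Z≡) (n∣m*n g))))
    in begin
      Z ^ s
        ≡⟨ trans (cong (_^ s) Z≡) (^-distribʳ-*′ g (X′ + Y′) s) ⟩
      g ^ s * (X′ + Y′) ^ s
        ≤⟨ *-mono-≤ (^-monoˡ-≤ s (∣⇒≤ {{>-nonZero 0<Y}} (gcd[m,n]∣n X Y)))
             (bound X′ Y′ (X′ + Y′) 0<X′ 0<Y′ (≤-trans 0<X′ (m≤m+n X′ Y′))
               (trans (cong (λ t → gcd t (X′ + Y′)) coprime) (gcd-zeroˡ (X′ + Y′))) refl) ⟩
      Y ^ s * (C ^ s * radical (X′ * Y′ * (X′ + Y′)) ^ (s + 1))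
        ≤⟨ *-monoʳ-≤ (Y ^ s) (*-monoʳ-≤ (C ^ s) (^-monoˡ-≤ (s + 1) (∣⇒≤ {{>-nonZero 0<M}} rad∣))) ⟩
      Y ^ s * (C ^ s * M ^ (s + 1))
        ≡⟨ trans (sym (*-assoc (Y ^ s) (C ^ s) (M ^ (s + 1)))) (cong (_* M ^ (s + 1)) (sym (^-distribʳ-*′ Y C s))) ⟩
      (Y * C) ^ s * M ^ (s + 1) ∎
    where open ≤-Reasoning

-- Bounding the x at which the value is powerful

module PowerfulValues where

  open PolynomialEvaluation
  open IntegerPolynomials
  open PolynomialExpressions
  open Multiplicities
  open BelyiPolynomials
  open Radicals
  open import Data.Empty using (⊥-elim)
  open import Data.Integer.Base using (ℤ; +_; -[1+_]; 0ℤ) renaming (∣_∣ to abs; _+_ to _+ℤ_; _*_ to _*ℤ_; -_ to -ℤ_; _-_ to _-ℤ_)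
  import Data.Integer.Properties as ℤ
  import Data.Integer.Tactic.RingSolver as ℤ
  open import Data.List.Base using ([]; _∷_; _∷ʳ_; length)
  open import Data.Nat.Base
  open import Data.Nat.Divisibility
  open import Data.Nat.Primality using (Prime; euclidsLemma)
  open import Data.Nat.Properties
  open import Data.Nat.Tactic.RingSolver using (solve-∀)
  open import Data.Product.Base using (∃-syntax; _×_; _,_; proj₁; proj₂)
  open import Data.Sum.Base using (_⊎_; inj₁; inj₂)
  open import Relation.Binary.PropositionalEquality
  open import Relation.Nullary using (yes; no)

  -- Turns an equation between integers of arbitrary signs into one between natural numbers, with
  -- the largest absolute value as the sum.
  abs-cases : ∀ i j → abs (i +ℤ j) ≡ abs i + abs j ⊎ abs i ≡ abs (i +ℤ j) + abs j ⊎ abs j ≡ abs (i +ℤ j) + abs i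
  abs-cases (+ m)    (+ n)    = inj₁ refl
  abs-cases -[1+ m ] -[1+ n ] = inj₁ (cong suc (sym (+-suc m n)))
  abs-cases (+ m)    -[1+ n ] with ≤-total m (suc n)
  ... | inj₁ le = inj₂ (inj₂ (sym (trans (cong (λ t → t + m) (ℤ.∣⊖∣-≤ le)) (m∸n+n≡m le))))
  ... | inj₂ le = inj₂ (inj₁ (sym (trans (cong (λ i → abs i + suc n) (ℤ.⊖-≥ le)) (m∸n+n≡m le))))
  abs-cases -[1+ m ] (+ n)    with ≤-total n (suc m)
  ... | inj₁ le = inj₂ (inj₁ (sym (trans (cong (λ t → t + n) (ℤ.∣⊖∣-≤ le)) (m∸n+n≡m le))))
  ... | inj₂ le = inj₂ (inj₂ (sym (trans (cong (λ i → abs i + suc m) (ℤ.⊖-≥ le)) (m∸n+n≡m le))))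

  -- The exponent bookkeeping: a = |φ(x)|, d = |φ′(x)|, F = |f(x)|, K the
  -- cofactor and M a multiple of every prime dividing φ(x) (φ(x) - c).
  combine-bounds : ∀ n {a d F K M X P E₁ κ C₂ C₃ C₄} → 0 < a → 0 < X →
    a ^ (2 * n) ≤ P * M ^ (2 * n + 1) →
    M * M ≤ E₁ * (F * (K * K)) →
    F * d * K ≤ κ * (a * a) →
    X ^ 3 ≤ C₂ * F →
    a ≤ C₃ * (X * d) →
    a ≤ C₄ * X ^ n →
    X ≤ P * P * (E₁ * (C₃ * C₃ * C₂ * (κ * κ))) ^ (2 * n + 1) * (C₄ * C₄)
  combine-bounds n {a} {d} {F} {K} {M} {X} {P} {E₁} {κ} {C₂} {C₃} {C₄} 0<a 0<X h₁ h₂ h₃ h₄ h₅ h₆ =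
    -- By `main`, X^(s + 1) ≤ Q a², and a² is at most C₄² X^(2n). The choice s = 2 n makes the two
    -- powers of X differ by exactly one.
    *-cancelʳ-≤ X _ (X ^ s) (begin
      X * X ^ s                      ≡⟨ cong (X ^_) (+-comm 1 s) ⟩
      X ^ (s + 1)                    ≤⟨ *-cancelˡ-≤ (a ^ s * a ^ s) main ⟩
      Q * (a * a)                    ≤⟨ *-monoʳ-≤ Q (*-mono-≤ h₆ h₆) ⟩
      Q * (C₄ * X ^ n * (C₄ * X ^ n))  ≡⟨ regroup₅ Q C₄ (X ^ n) ⟩
      Q * (C₄ * C₄) * (X ^ n * X ^ n)  ≡⟨ cong (Q * (C₄ * C₄) *_) (trans (sym (^-distribˡ-+-* X n n)) (cong (λ t → X ^ (n + t)) (sym (+-identityʳ n)))) ⟩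
      Q * (C₄ * C₄) * X ^ s          ∎)
    where
    open ≤-Reasoning
    s E₂ Q : ℕ
    s = 2 * n
    E₂ = C₃ * C₃ * C₂ * (κ * κ)
    Q = P * P * (E₁ * E₂) ^ (s + 1)
    instance
      a-nz : NonZero a
      a-nz = >-nonZero 0<a
      X-nz : NonZero X
      X-nz = >-nonZero 0<X
      aa-nz : NonZero (a * a)
      aa-nz = m*n≢0 a a
      XX-nz : NonZero (X * X)
      XX-nz = m*n≢0 X X
      as-nz : NonZero (a ^ s * a ^ s)
      as-nz = m*n≢0 (a ^ s) (a ^ s) {{m^n≢0 a s}} {{m^n≢0 a s}}
      Xs-nz : NonZero (X ^ s)
      Xs-nz = m^n≢0 X s
    regroup₁ : ∀ X a → X * X * (a * a * X) ≡ a * a * (X * (X * (X * 1)))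
    regroup₁ = solve-∀
    regroup₂ : ∀ C₃ X d C₂ F → C₃ * (X * d) * (C₃ * (X * d)) * (C₂ * F) ≡ X * X * (C₃ * C₃ * C₂ * (d * d * F))
    regroup₂ = solve-∀
    regroup₃ : ∀ a F K X → a * a * (F * (K * K) * X) ≡ F * (K * K) * (a * a * X)
    regroup₃ = solve-∀
    regroup₄ : ∀ F K C₃ C₂ d → F * (K * K) * (C₃ * C₃ * C₂ * (d * d * F)) ≡ C₃ * C₃ * C₂ * ((F * d * K) * (F * d * K))
    regroup₄ = solve-∀
    regroup₅ : ∀ Q C y → Q * (C * y * (C * y)) ≡ Q * (C * C) * (y * y)
    regroup₅ = solve-∀
    regroup₆ : ∀ C₃ C₂ κ a → C₃ * C₃ * C₂ * (κ * (a * a) * (κ * (a * a))) ≡ a * a * (C₃ * C₃ * C₂ * (κ * κ) * (a * a))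
    regroup₆ = solve-∀
    -- The square of a ≤ C₃ X d times X³ ≤ C₂ F. This is where the degree of f being at least 3
    -- enters: one factor X is left over.
    a²X≤ : a * a * X ≤ C₃ * C₃ * C₂ * (d * d * F)
    a²X≤ = *-cancelˡ-≤ (X * X) (begin
      X * X * (a * a * X)                            ≡⟨ regroup₁ X a ⟩
      a * a * X ^ 3                                  ≤⟨ *-mono-≤ (*-mono-≤ h₅ h₅) h₄ ⟩
      C₃ * (X * d) * (C₃ * (X * d)) * (C₂ * F)       ≡⟨ regroup₂ C₃ X d C₂ F ⟩
      X * X * (C₃ * C₃ * C₂ * (d * d * F))           ∎)
    -- Multiplying by F K² completes the right side to (F d K)², which `h₃` bounds by a⁴ up to a
    -- constant.
    FKKX≤ : F * (K * K) * X ≤ E₂ * (a * a)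
    FKKX≤ = *-cancelˡ-≤ (a * a) (begin
      a * a * (F * (K * K) * X)                      ≡⟨ regroup₃ a F K X ⟩
      F * (K * K) * (a * a * X)                      ≤⟨ *-monoʳ-≤ (F * (K * K)) a²X≤ ⟩
      F * (K * K) * (C₃ * C₃ * C₂ * (d * d * F))     ≡⟨ regroup₄ F K C₃ C₂ d ⟩
      C₃ * C₃ * C₂ * (F * d * K * (F * d * K))       ≤⟨ *-monoʳ-≤ (C₃ * C₃ * C₂) (*-mono-≤ h₃ h₃) ⟩
      C₃ * C₃ * C₂ * (κ * (a * a) * (κ * (a * a)))   ≡⟨ regroup₆ C₃ C₂ κ a ⟩
      a * a * (E₂ * (a * a))                         ∎)
    gather : ∀ P m x → P * m * (P * m) * x ≡ P * P * (m * m * x)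
    gather = solve-∀
    spread : ∀ P e p q a → P * P * (e * (p * q * a)) ≡ p * q * (P * P * e * a)
    spread = solve-∀
    main : a ^ s * a ^ s * X ^ (s + 1) ≤ a ^ s * a ^ s * (Q * (a * a))
    main = begin
      a ^ s * a ^ s * X ^ (s + 1)
        ≤⟨ *-monoˡ-≤ (X ^ (s + 1)) (*-mono-≤ h₁ h₁) ⟩
      P * M ^ (s + 1) * (P * M ^ (s + 1)) * X ^ (s + 1)
        ≡⟨ gather P (M ^ (s + 1)) (X ^ (s + 1)) ⟩
      P * P * (M ^ (s + 1) * M ^ (s + 1) * X ^ (s + 1))
        ≡⟨ cong (P * P *_) (trans (cong (_* X ^ (s + 1)) (sym (^-distribʳ-*′ M M (s + 1)))) (sym (^-distribʳ-*′ (M * M) X (s + 1)))) ⟩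
      P * P * (M * M * X) ^ (s + 1)
        ≤⟨ *-monoʳ-≤ (P * P) (^-monoˡ-≤ (s + 1) (begin
             M * M * X                   ≤⟨ *-monoˡ-≤ X h₂ ⟩
             E₁ * (F * (K * K)) * X      ≡⟨ *-assoc E₁ _ X ⟩
             E₁ * (F * (K * K) * X)      ≤⟨ *-monoʳ-≤ E₁ FKKX≤ ⟩
             E₁ * (E₂ * (a * a))         ≡⟨ sym (*-assoc E₁ E₂ _) ⟩
             E₁ * E₂ * (a * a)           ∎)) ⟩
      P * P * (E₁ * E₂ * (a * a)) ^ (s + 1)
        ≡⟨ cong (P * P *_) (trans (^-distribʳ-*′ (E₁ * E₂) (a * a) (s + 1)) (cong ((E₁ * E₂) ^ (s + 1) *_)
             (trans (^-distribˡ-+-* (a * a) s 1) (cong₂ _*_ (^-distribʳ-*′ a a s) (*-identityʳ (a * a)))))) ⟩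
      P * P * ((E₁ * E₂) ^ (s + 1) * (a ^ s * a ^ s * (a * a)))
        ≡⟨ spread P ((E₁ * E₂) ^ (s + 1)) (a ^ s) (a ^ s) (a * a) ⟩
      a ^ s * a ^ s * (P * P * (E₁ * E₂) ^ (s + 1) * (a * a)) ∎

  -- n is the degree of φ, and x φ′ has the same degree, hence the second bound. `Tends` rules out
  -- constants.
  growth : ∀ φ → Tends φ → ∃[ n ] ∃[ C ] ∃[ C′ ] ∃[ B ] (0 < n × (∀ x → B ≤ abs x →
    abs (fn φ x) ≤ C * abs x ^ n × abs (fn φ x) ≤ C′ * (abs x * abs (dn φ x))))
  growth φ tends with leading (code φ)
  ... | inj₁ z = let (B , h) = tends 1 in
    ⊥-elim (≤⇒≯ (h (+ B) ≤-refl) (s≤s (≤-reflexive (cong abs (trans (fn≡ φ (+ B)) (ev-IsZero z (+ B)))))))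
  ... | inj₂ ([] , γ , _ , _ , e) = let (B , h) = tends (suc (abs γ)) in
    ⊥-elim (<-irrefl refl (subst (λ t → suc (abs γ) ≤ abs t) (trans (fn≡ φ (+ B)) (trans (e (+ B)) (ev-const γ (+ B)))) (h (+ B) ≤-refl)))
  ... | inj₂ (a ∷ p , γ , γ≢0 , _ , e) = let
      (C , hC) = growth-upper (a ∷ p) γ
      (C′ , B , hB) = growth-lower (weightedFrom 1 p) (+ suc (length p) *ℤ γ) (*-≢0 {+ suc (length p)} (λ ()) γ≢0)
      eq : φ ≐ ⌈ a ∷ p ∷ʳ γ ⌉
      eq x = trans (fn≡ φ x) (e x)
      deq : ∀ x → dn φ x ≡ ev (weightedFrom 1 p ∷ʳ (+ suc (length p) *ℤ γ)) x
      deq x = trans (D-cong φ ⌈ a ∷ p ∷ʳ γ ⌉ eq x) (cong (λ q → ev q x) (weightedFrom-∷ʳ 1 p γ))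
    in suc (length p) , C , C * C′ , suc B , s≤s z≤n , λ x le →
      let up = subst (λ t → abs t ≤ C * abs x ^ suc (length p)) (sym (eq x)) (hC x (≤-trans (s≤s z≤n) le)) in
      up , (begin
        abs (fn φ x)                            ≤⟨ up ⟩
        C * (abs x * abs x ^ length p)
          ≡⟨ cong (λ t → C * (abs x * abs x ^ t)) (sym (length-weightedFrom 1 p)) ⟩
        C * (abs x * abs x ^ length (weightedFrom 1 p))
          ≤⟨ *-monoʳ-≤ C (*-monoʳ-≤ (abs x) (hB x (≤-trans (n≤1+n B) le))) ⟩
        C * (abs x * (C′ * abs (ev (weightedFrom 1 p ∷ʳ (+ suc (length p) *ℤ γ)) x)))
          ≡⟨ cong (λ t → C * (abs x * (C′ * abs t))) (sym (deq x)) ⟩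
        C * (abs x * (C′ * abs (dn φ x)))       ≡⟨ regroup C (abs x) C′ (abs (dn φ x)) ⟩
        C * C′ * (abs x * abs (dn φ x))         ∎)
    where
    open ≤-Reasoning
    regroup : ∀ C x C′ d → C * (x * (C′ * d)) ≡ C * C′ * (x * d)
    regroup = solve-∀

  -- With φ as in squarefree-belyi, φ(x) - (φ(x) - c) = c is an ABC triple whose
  -- radical is at most |c C₁ K(x)| rad f(x), where κ φ (φ - c) = f φ′ K.
  module ABCTriple (f φ K U : Pol) (c κ C₁ : ℤ) (c≢0 : c ≢ 0ℤ) (κ≢0 : κ ≢ 0ℤ) (C₁≢0 : C₁ ≢ 0ℤ)
    (eq : constᵖ κ *ᵖ (φ *ᵖ (φ +ᵖ constᵖ (-ℤ c))) ≐ f *ᵖ D φ *ᵖ K)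
    (N : ℕ) (U-eq : constᵖ C₁ *ᵖ (f *ᵖ K) ^ᵖ N ≐ φ *ᵖ (φ +ᵖ constᵖ (-ℤ c)) *ᵖ U)
    (n B₂ B₃ B₄ C₂ C₃ C₄ C₅ : ℕ)
    (cubic : ∀ x → B₂ ≤ abs x → abs x ^ 3 ≤ C₂ * abs (fn f x))
    (φ-large : ∀ x → B₃ ≤ abs x → suc (abs c) ≤ abs (fn φ x))
    (φ-growth : ∀ x → B₄ ≤ abs x → abs (fn φ x) ≤ C₄ * abs x ^ n × abs (fn φ x) ≤ C₃ * (abs x * abs (dn φ x)))
    (abc-ineq : ∀ X Y Z M → 0 < X → 0 < Y → 0 < M → X + Y ≡ Z →
      (∀ p → Prime p → p ∣ X * Y * Z → p ∣ M) → Z ^ (2 * n) ≤ (Y * C₅) ^ (2 * n) * M ^ (2 * n + 1)) where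

    T : Pol
    T = φ *ᵖ (φ +ᵖ constᵖ (-ℤ c))
    E₁ P B₅ B : ℕ
    E₁ = abs c * abs C₁ * (abs c * abs C₁)
    P = (abs c * C₅) ^ (2 * n)
    B₅ = P * P * (E₁ * (C₃ * C₃ * C₂ * (abs κ * 2 * (abs κ * 2)))) ^ (2 * n + 1) * (C₄ * C₄)
    B = suc (B₂ + B₃ + B₄ + B₅)
    bounded : ∀ x → Powerful (abs (fn f x)) → abs x ≤ B
    bounded x pw with B ≤? abs x
    ... | no  ¬B≤ = ≰⇒≥ ¬B≤
    ... | yes B≤x = ≤-trans (combine-bounds n {a} {d} {F} {k} {M} {X} {P} {E₁} {abs κ * 2} {C₂} {C₃} {C₄} 0<a 0<X h₁ h₂ h₃ (cubic x B₂≤x) (proj₂ gr-x) (proj₁ gr-x))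
                      (≤-trans (m≤n+m B₅ (B₂ + B₃ + B₄)) (n≤1+n _))
      where
      open ≤-Reasoning
      X a a′ F k d R M c₀ : ℕ
      X = abs x
      a = abs (fn φ x)
      a′ = abs (fn φ x -ℤ c)
      F = abs (fn f x)
      k = abs (fn K x)
      d = abs (dn φ x)
      R = radical F
      c₀ = abs c
      -- c₀ covers the primes of c, and C₁ the denominator in the divisibility of (f K)ᴺ by φ (φ -
      -- c).
      M = c₀ * abs C₁ * (R * k)
      B-1≤ : B₂ + B₃ + B₄ + B₅ ≤ X
      B-1≤ = ≤-trans (n≤1+n _) B≤x
      B₂₃₄≤ : B₂ + B₃ + B₄ ≤ X
      B₂₃₄≤ = ≤-trans (m≤m+n _ B₅) B-1≤
      B₂₃≤ : B₂ + B₃ ≤ X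
      B₂₃≤ = ≤-trans (m≤m+n _ B₄) B₂₃₄≤
      B₂≤x : B₂ ≤ X
      B₂≤x = ≤-trans (m≤m+n _ B₃) B₂₃≤
      gr-x : a ≤ C₄ * X ^ n × a ≤ C₃ * (X * d)
      gr-x = φ-growth x (≤-trans (m≤n+m B₄ (B₂ + B₃)) B₂₃₄≤)
      0<X : 0 < X
      0<X = ≤-trans (s≤s z≤n) B≤x
      c<a : c₀ < a
      c<a = φ-large x (≤-trans (m≤n+m B₃ B₂) B₂₃≤)
      0<c₀ : 0 < c₀
      0<c₀ = ∣∣≢0 c≢0
      0<a : 0 < a
      0<a = ≤-trans (s≤s z≤n) c<a
      0<a′ : 0 < a′
      0<a′ = n≢0⇒n>0 λ z → <-irrefl (sym (cong abs (ℤ.i-j≡0⇒i≡j (fn φ x) c (ℤ.∣i∣≡0⇒i≡0 z)))) c<a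
      a′≤ : a′ ≤ 2 * a
      a′≤ = begin
        abs (fn φ x -ℤ c)       ≤⟨ ℤ.∣i-j∣≤∣i∣+∣j∣ (fn φ x) c ⟩
        a + c₀                  ≤⟨ +-monoʳ-≤ a (<⇒≤ c<a) ⟩
        a + a                   ≡⟨ cong (_+_ a) (sym (+-identityʳ a)) ⟩
        2 * a                   ∎
      FdK≡ : F * d * k ≡ abs κ * (a * a′)
      FdK≡ = trans (sym (trans (ℤ.abs-* (fn f x *ℤ dn φ x) (fn K x)) (cong (_* k) (ℤ.abs-* (fn f x) (dn φ x)))))
        (trans (cong abs (sym (eq x))) (trans (ℤ.abs-* κ (fn T x)) (cong (abs κ *_) (ℤ.abs-* (fn φ x) (fn φ x -ℤ c)))))
      -- |φ(x)| > |c| keeps φ (φ - c) away from 0, so f(x) and K(x) are nonzero. In particular the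
      -- powerful value 0 does not occur for large x.
      0<FdK : 0 < F * d * k
      0<FdK = subst (0 <_) (sym FdK≡) (*-mono-≤ (∣∣≢0 κ≢0) (*-mono-≤ 0<a 0<a′))
      0<F : 0 < F
      0<F = n≢0⇒n>0 λ z → <⇒≢ 0<FdK (sym (cong (λ t → t * d * k) z))
      0<k : 0 < k
      0<k = n≢0⇒n>0 λ z → <⇒≢ 0<FdK (sym (trans (cong (F * d *_) z) (*-zeroʳ (F * d))))
      0<M : 0 < M
      0<M = *-mono-≤ (*-mono-≤ 0<c₀ (∣∣≢0 C₁≢0)) (*-mono-≤ (radical>0 F 0<F) 0<k)
      h₃ : F * d * k ≤ abs κ * 2 * (a * a)
      h₃ = begin
        F * d * k                ≡⟨ FdK≡ ⟩
        abs κ * (a * a′)         ≤⟨ *-monoʳ-≤ (abs κ) (*-monoʳ-≤ a a′≤) ⟩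
        abs κ * (a * (2 * a))    ≡⟨ swap (abs κ) a ⟩
        abs κ * 2 * (a * a)      ∎
        where
        swap : ∀ κ a → κ * (a * (2 * a)) ≡ κ * 2 * (a * a)
        swap = solve-∀
      h₂ : M * M ≤ E₁ * (F * (k * k))
      h₂ = begin
        M * M                              ≡⟨ square (c₀ * abs C₁) R k ⟩
        E₁ * (R ^ 2 * (k * k))             ≤⟨ *-monoʳ-≤ E₁ (*-monoˡ-≤ (k * k) (radical²≤ F 0<F pw)) ⟩
        E₁ * (F * (k * k))                 ∎
        where
        square : ∀ e r k → e * (r * k) * (e * (r * k)) ≡ e * e * (r * (r * 1) * (k * k))
        square = solve-∀
      p∣T⇒ : ∀ p → Prime p → p ∣ a * a′ → p ∣ M
      p∣T⇒ p pr p∣ with euclidsLemma (abs C₁) _ pr (subst (p ∣_) (trans (cong (_* abs (fn U x)) (sym (ℤ.abs-* (fn φ x) (fn φ x -ℤ c))))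
                         (trans (sym (ℤ.abs-* (fn T x) (fn U x))) (trans (cong abs (sym (U-eq x))) (ℤ.abs-* C₁ _))))
                         (∣m⇒∣m*n (abs (fn U x)) p∣))
      ... | inj₁ p∣C₁ = ∣m⇒∣m*n (R * k) (∣n⇒∣m*n c₀ p∣C₁)
      ... | inj₂ p∣fK with euclidsLemma F k pr (subst (p ∣_) (ℤ.abs-* (fn f x) (fn K x))
              (prime-∣-^ _ N pr (subst (p ∣_) (trans (cong abs (fn-^ (f *ᵖ K) N x)) (abs-^ (fn f x *ℤ fn K x) N)) p∣fK)))
      ...   | inj₁ p∣F = ∣n⇒∣m*n (c₀ * abs C₁) (∣m⇒∣m*n k (prime∣radical F 0<F pr p∣F))
      ...   | inj₂ p∣k = ∣n⇒∣m*n (c₀ * abs C₁) (∣n⇒∣m*n R p∣k)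
      p∣c⇒ : ∀ p → p ∣ c₀ → p ∣ M
      p∣c⇒ p d = ∣m⇒∣m*n (R * k) (∣m⇒∣m*n (abs C₁) d)
      cancel : ∀ p c → p -ℤ c +ℤ c ≡ p
      cancel = ℤ.solve-∀
      p∣aca′⇒ : ∀ p → Prime p → p ∣ c₀ * (a * a′) → p ∣ M
      p∣aca′⇒ p pr d with euclidsLemma c₀ (a * a′) pr d
      ... | inj₁ p∣c = p∣c⇒ p p∣c
      ... | inj₂ p∣T = p∣T⇒ p pr p∣T
      φ≡ : abs (fn φ x -ℤ c +ℤ c) ≡ a
      φ≡ = cong abs (cancel (fn φ x) c)
      -- In both possible cases Y is |c|, so what `abc-bound` loses to a common factor is the
      -- constant P, and Z is the larger of |φ(x)| and |φ(x) - c|. The third case would make |c| a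
      -- sum with summand |φ(x)| > |c|.
      h₁ : a ^ (2 * n) ≤ P * M ^ (2 * n + 1)
      h₁ with abs-cases (fn φ x -ℤ c) c
      ... | inj₁ e = abc-ineq a′ c₀ a M 0<a′ 0<c₀ 0<M (trans (sym e) φ≡)
            λ p pr p∣ → p∣aca′⇒ p pr (subst (p ∣_) (reorder a′ c₀ a) p∣)
        where
        reorder : ∀ a′ c a → a′ * c * a ≡ c * (a * a′)
        reorder = solve-∀
      ... | inj₂ (inj₁ e) = ≤-trans (^-monoˡ-≤ (2 * n) (≤-trans (m≤m+n a c₀) (≤-reflexive a+c≡)))
            (abc-ineq a c₀ a′ M 0<a 0<c₀ 0<M a+c≡ λ p pr p∣ → p∣aca′⇒ p pr (subst (p ∣_) (reorder a c₀ a′) p∣))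
        where
        a+c≡ : a + c₀ ≡ a′
        a+c≡ = sym (trans e (cong (λ t → t + c₀) φ≡))
        reorder : ∀ a c a′ → a * c * a′ ≡ c * (a * a′)
        reorder = solve-∀
      ... | inj₂ (inj₂ e) = ⊥-elim (<⇒≱ c<a (≤-trans (m≤m+n a a′) (≤-reflexive (sym (trans e (cong (λ t → t + a′) φ≡))))))

  -- With T = φ (φ - c), multiplying f φ′ K = κ T by 2 φ - c shows that T divides T′ f K up to
  -- constants. Since T′ vanishes to lower order than T at a root of T, such a root is a root of f
  -- K; `∣-power` makes this precise.
  product-power : ∀ f φ K c κ → κ ≢ 0ℤ → constᵖ κ *ᵖ (φ *ᵖ (φ +ᵖ constᵖ (-ℤ c))) ≐ f *ᵖ D φ *ᵖ K →
    NonZeroᵖ (φ *ᵖ (φ +ᵖ constᵖ (-ℤ c))) → ∃[ N ] (φ *ᵖ (φ +ᵖ constᵖ (-ℤ c)) ∣ᵖ (f *ᵖ K) ^ᵖ N)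
  product-power f φ K c κ κ≢0 eq = ∣-power T (f *ᵖ K)
    (dvd κ (constᵖ (κ *ℤ κ) *ᵖ (φ +ᵖ φ +ᵖ constᵖ (-ℤ c))) κ≢0 λ x →
      trans (rearrange κ (dn φ x) (fn φ x) c (fn f x) (fn K x))
        (trans (cong (λ t → κ *ℤ (t *ℤ (fn φ x +ℤ fn φ x -ℤ c))) (sym (eq x)))
          (regroup κ (fn T x) (fn φ x +ℤ fn φ x -ℤ c))))
    where
    T : Pol
    T = φ *ᵖ (φ +ᵖ constᵖ (-ℤ c))
    rearrange : ∀ κ d p c f K → κ *ℤ ((d *ℤ (p +ℤ -ℤ c) +ℤ p *ℤ (d +ℤ 0ℤ)) *ℤ (f *ℤ K)) ≡ κ *ℤ (f *ℤ d *ℤ K *ℤ (p +ℤ p -ℤ c))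
    rearrange = ℤ.solve-∀
    regroup : ∀ κ T s → κ *ℤ (κ *ℤ T *ℤ s) ≡ T *ℤ (κ *ℤ κ *ℤ s)
    regroup = ℤ.solve-∀

  module _ (abc : ABC-Conjecture) (f : Pol) (C₂ B₂ : ℕ) (cubic : ∀ x → B₂ ≤ abs x → abs x ^ 3 ≤ C₂ * abs (fn f x)) where

    private
      Bounded : Set
      Bounded = ∃[ B ] (∀ x → Powerful (abs (fn f x)) → abs x ≤ B)

      assemble : ∀ φ c → c ≢ 0ℤ → ∀ κ K → κ ≢ 0ℤ → constᵖ κ *ᵖ (φ *ᵖ (φ +ᵖ constᵖ (-ℤ c))) ≐ f *ᵖ D φ *ᵖ K →
        ∀ N → φ *ᵖ (φ +ᵖ constᵖ (-ℤ c)) ∣ᵖ (f *ᵖ K) ^ᵖ N →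
        ∀ n C₄ C₃ B₄ → (∀ x → B₄ ≤ abs x → abs (fn φ x) ≤ C₄ * abs x ^ n × abs (fn φ x) ≤ C₃ * (abs x * abs (dn φ x))) →
        ∀ B₃ → (∀ x → B₃ ≤ abs x → suc (abs c) ≤ abs (fn φ x)) →
        ∀ C₅ → (∀ X Y Z M → 0 < X → 0 < Y → 0 < M → X + Y ≡ Z →
          (∀ p → Prime p → p ∣ X * Y * Z → p ∣ M) → Z ^ (2 * n) ≤ (Y * C₅) ^ (2 * n) * M ^ (2 * n + 1)) → Bounded
      assemble φ c c≢0 κ K κ≢0 eq N (dvd C₁ U C₁≢0 U-eq) n C₄ C₃ B₄ φ-growth B₃ φ-large C₅ abc-ineq = B , bounded
        where open ABCTriple f φ K U c κ C₁ c≢0 κ≢0 C₁≢0 eq N U-eq n B₂ B₃ B₄ C₂ C₃ C₄ C₅ cubic φ-large φ-growth abc-ineq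

      choose : ∃[ φ ] ∃[ c ] (c ≢ 0ℤ × Tends φ × f *ᵖ D φ ∣ᵖ φ *ᵖ (φ +ᵖ constᵖ (-ℤ c))) → Bounded
      choose (φ , c , c≢0 , φ-tends , dvd κ K κ≢0 eq) = let
          (N , T∣) = product-power f φ K c κ κ≢0 eq (belyi-product-NonZero φ c φ-tends)
          (n , C₄ , C₃ , B₄ , 0<n , φ-growth) = growth φ φ-tends
          (B₃ , φ-large) = φ-tends (suc (abs c))
          -- ε = 1 / (2 n) depends on the degree n of φ, so ABC is applied only after φ has been
          -- constructed.
          (C₅ , abc-ineq) = abc-bound abc (2 * n) (≤-trans 0<n (m≤m+n n (n + 0)))
        in assemble φ c c≢0 κ K κ≢0 eq N T∣ n C₄ C₃ B₄ φ-growth B₃ φ-large C₅ abc-ineq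

    abstract
      powerful-values-bounded : NonZeroᵖ f → Squarefreeᵖ f → ∃[ B ] (∀ x → Powerful (abs (fn f x)) → abs x ≤ B)
      powerful-values-bounded f-nz sqf = choose (squarefree-belyi f f-nz sqf)

-- From bounded variables to finite solution sets

module FiniteSolutionSets where

  open PolynomialEvaluation
  open IntegerPolynomials
  open PolynomialExpressions hiding (∣-trans)
  open Multiplicities
  open BelyiPolynomials
  open Radicals
  open PowerfulValues
  open import Data.Empty using (⊥-elim)
  open import Data.Fin.Base using (zero; suc)
  open import Data.Fin.Properties using (0≢1+n; suc-injective)
  open import Data.Integer.Base using (ℤ; +_; -[1+_]; 0ℤ; 1ℤ; _+_; _*_; _-_; -_) renaming (∣_∣ to abs; _^_ to _^ℤ_)
  import Data.Integer.Properties as ℤ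
  open import Data.Integer.Tactic.RingSolver using (solve-∀)
  open import Data.List.Base using (List; []; _∷_; _∷ʳ_; _++_; length; map; upTo; cartesianProduct)
  open import Data.List.Membership.Propositional using (_∈_)
  open import Data.List.Membership.Propositional.Properties using (∈-map⁺; ∈-upTo⁺; ∈-++⁺ˡ; ∈-++⁺ʳ; ∈-cartesianProduct⁺)
  open import Data.List.Relation.Unary.All using ([]; _∷_)
  open import Data.Nat.Base as ℕ using (ℕ; zero; suc; _≤_; _<_; z≤n; s≤s; _⊔_; _^_)
  open import Data.Nat.Divisibility using (_∣_; divides; ∣-trans; ∣-reflexive; m∣m*n; n∣m*n; ∣1⇒≡1; *-pres-∣)
  open import Data.Nat.Primality using (Prime; euclidsLemma; ¬prime[1])
  import Data.Nat.Properties as ℕ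
  import Data.Nat.Tactic.RingSolver as ℕ
  open import Data.Product.Base using (∃-syntax; _×_; _,_)
  open import Data.Sum.Base using (inj₁; inj₂)
  open import Data.Vec.Functional using (Vector)
  open import Function.Definitions using (Injective)
  open import Relation.Binary.PropositionalEquality
  open ℤ[X] using (X+_; _≈_; ∏) renaming (_^_ to _^ₚ_; _∣_ to _∣ₚ_)

  leadingAtDegree : ∀ p d → HasDegree p d →
    ∃[ p₀ ] ∃[ γ ] (γ ≢ 0ℤ × length p₀ ≡ d × (∀ x → ev p x ≡ ev (p₀ ∷ʳ γ) x))
  leadingAtDegree []      d       (c≢0 , _) = ⊥-elim (c≢0 refl)
  leadingAtDegree (a ∷ p) zero    (c≢0 , h) = [] , a , c≢0 , refl ,
    λ x → cong (λ t → a + x * t) (ev-IsZero (coeffs-zero p (λ n → h (suc n) (s≤s z≤n))) x)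
    where
    coeffs-zero : ∀ p → (∀ n → coeff p n ≡ 0ℤ) → IsZero p
    coeffs-zero []      h = []
    coeffs-zero (a ∷ p) h = h 0 ∷ coeffs-zero p (λ n → h (suc n))
  leadingAtDegree (a ∷ p) (suc d) (c≢0 , h) = let
      (p₀ , γ , γ≢0 , l , e) = leadingAtDegree p d (c≢0 , λ n d<n → h (suc n) (s≤s d<n))
    in a ∷ p₀ , γ , γ≢0 , cong suc l , λ x → cong (λ t → a + x * t) (e x)

  degree-growth : ∀ p d → HasDegree p d → ∃[ C ] ∃[ B ] (∀ x → B ≤ abs x → abs x ^ d ≤ C ℕ.* abs (ev p x))
  degree-growth p d hd = let
      (p₀ , γ , γ≢0 , l , e) = leadingAtDegree p d hd
      (C , B , h) = growth-lower p₀ γ γ≢0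
    in C , B , λ x le → subst₂ (λ n v → abs x ^ n ≤ C ℕ.* abs v) l (sym (e x)) (h x le)

  ≈⇒ev≡ : ∀ p q → p ≈ q → ∀ x → ev p x ≡ ev q x
  ≈⇒ev≡ []      []      h x = refl
  ≈⇒ev≡ []      (b ∷ q) h x = sym (trans (cong₂ (λ s t → s + x * t) (sym (h 0)) (sym (≈⇒ev≡ [] q (λ n → h (suc n)) x))) (trans (ℤ.+-identityˡ (x * 0ℤ)) (ℤ.*-zeroʳ x)))
  ≈⇒ev≡ (a ∷ p) []      h x = trans (cong₂ (λ s t → s + x * t) (h 0) (≈⇒ev≡ p [] (λ n → h (suc n)) x)) (trans (ℤ.+-identityˡ (x * 0ℤ)) (ℤ.*-zeroʳ x))
  ≈⇒ev≡ (a ∷ p) (b ∷ q) h x = cong₂ (λ s t → s + x * t) (h 0) (≈⇒ev≡ p q (λ n → h (suc n)) x)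

  ev-^ₚ : ∀ p n x → ev (p ^ₚ n) x ≡ ev p x ^ℤ n
  ev-^ₚ p zero    x = ev-const 1ℤ x
  ev-^ₚ p (suc n) x = trans (ev-⊗ p (p ^ₚ n) x) (cong (ev p x *_) (ev-^ₚ p n x))

  ev-∏ : ∀ {m} (v : Vector Poly m) x → ev (∏ v) x ≡ ∏ℤ (λ i → ev (v i) x)
  ev-∏ {zero}  v x = ev-const 1ℤ x
  ev-∏ {suc m} v x = trans (ev-⊗ (v zero) (∏ (λ i → v (suc i))) x) (cong (ev (v zero) x *_) (ev-∏ (λ i → v (suc i)) x))

  ∏ℤ-cong : ∀ {m} (u v : Vector ℤ m) → (∀ i → u i ≡ v i) → ∏ℤ u ≡ ∏ℤ v
  ∏ℤ-cong {zero}  u v h = refl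
  ∏ℤ-cong {suc m} u v h = cong₂ _*_ (h zero) (∏ℤ-cong (λ i → u (suc i)) (λ i → v (suc i)) (λ i → h (suc i)))

  factor-∣-∏ℤ : ∀ {m} (v : Vector ℤ m) i → abs (v i) ∣ abs (∏ℤ v)
  factor-∣-∏ℤ v zero    = subst (abs (v zero) ∣_) (sym (ℤ.abs-* (v zero) (∏ℤ (λ i → v (suc i))))) (m∣m*n _)
  factor-∣-∏ℤ v (suc i) = ∣-trans (factor-∣-∏ℤ (λ i → v (suc i)) i)
    (subst (abs (∏ℤ (λ i → v (suc i))) ∣_) (sym (ℤ.abs-* (v zero) (∏ℤ (λ i → v (suc i))))) (n∣m*n (abs (v zero))))

  prime-∣-∏ℤ : ∀ {m} (v : Vector ℤ m) p → Prime p → p ∣ abs (∏ℤ v) → ∃[ i ] (p ∣ abs (v i))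
  prime-∣-∏ℤ {zero}  v p pr d = ⊥-elim (¬prime[1] (subst Prime (∣1⇒≡1 d) pr))
  prime-∣-∏ℤ {suc m} v p pr d with euclidsLemma (abs (v zero)) (abs (∏ℤ (λ i → v (suc i)))) pr
                                     (subst (p ∣_) (ℤ.abs-* (v zero) (∏ℤ (λ i → v (suc i)))) d)
  ... | inj₁ p∣v = zero , p∣v
  ... | inj₂ p∣  = let (i , p∣v) = prime-∣-∏ℤ (λ i → v (suc i)) p pr p∣ in suc i , p∣v

  ∣-square : ∀ {p a} → p ∣ a → p ^ 2 ∣ a ^ 2
  ∣-square p∣a = *-pres-∣ p∣a (*-pres-∣ p∣a (∣-reflexive refl))

  -- A prime dividing the product divides some `v i`, and the exponent `l i` ≥ 2 puts its square
  -- into that factor.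
  ∏ℤ-powerful : ∀ {m} (v : Vector ℤ m) (l : Vector ℕ m) → (∀ i → 2 ≤ l i) → Powerful (abs (∏ℤ (λ i → v i ^ℤ l i)))
  ∏ℤ-powerful v l 2≤l p pr d = let (i , p∣) = prime-∣-∏ℤ (λ i → v i ^ℤ l i) p pr d in
    ∣-trans (∣-trans (∣-square (prime-∣-^ _ (l i) pr (subst (p ∣_) (abs-^ (v i) (l i)) p∣)))
      (subst₂ _∣_ refl (sym (abs-^ (v i) (l i))) (divides (abs (v i) ^ (l i ℕ.∸ 2))
        (trans (cong (abs (v i) ^_) (sym (ℕ.m∸n+n≡m (2≤l i)))) (ℕ.^-distribˡ-+-* (abs (v i)) (l i ℕ.∸ 2) 2)))))
      (factor-∣-∏ℤ (λ i → v i ^ℤ l i) i)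

  linearProduct : ∀ {m} → Vector ℤ m → Pol
  linearProduct {zero}  q = constᵖ 1ℤ
  linearProduct {suc m} q = X+ᵖ (q zero) *ᵖ linearProduct (λ i → q (suc i))

  fn-linearProduct : ∀ {m} (q : Vector ℤ m) y → fn (linearProduct q) y ≡ ∏ℤ (λ i → y + q i)
  fn-linearProduct {zero}  q y = refl
  fn-linearProduct {suc m} q y = cong ((y + q zero) *_) (fn-linearProduct (λ i → q (suc i)) y)

  eval-∏-X+ : ∀ {m} (q : Vector ℤ m) y → ev (∏ (λ i → X+ q i)) y ≡ ∏ℤ (λ i → y + q i)
  eval-∏-X+ q y = trans (ev-∏ (λ i → X+ q i) y) (∏ℤ-cong (λ i → ev (X+ q i) y) (λ i → y + q i) (λ i → sym (fn≡ (X+ᵖ q i) y)))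

  -- The cofactor of a divisibility in ℤ[y] is integral, so the divisibility survives evaluation at
  -- an integer y.
  squares-powerful : ∀ {m} (q : Vector ℤ m) → (∀ j → ((X+ q j) ^ₚ 2) ∣ₚ ∏ (λ i → X+ q i)) →
    ∀ y → Powerful (abs (∏ℤ (λ i → y + q i)))
  squares-powerful q h y p pr d with prime-∣-∏ℤ (λ i → y + q i) p pr d
  ... | j , p∣ with h j
  ...   | record { quotient = r ; equality = e } = ∣-trans (∣-square p∣) (divides (abs (ev r y)) (begin
    abs (∏ℤ (λ i → y + q i))                     ≡⟨ cong abs (eval-∏-X+ q y) ⟨
    abs (ev (∏ (λ i → X+ q i)) y)                ≡⟨ cong abs (≈⇒ev≡ (r ⊗ ((X+ q j) ^ₚ 2)) (∏ (λ i → X+ q i)) e y) ⟨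
    abs (ev (r ⊗ ((X+ q j) ^ₚ 2)) y)             ≡⟨ cong abs (ev-⊗ r ((X+ q j) ^ₚ 2) y) ⟩
    abs (ev r y * ev ((X+ q j) ^ₚ 2) y)
      ≡⟨ cong (λ t → abs (ev r y * t)) (trans (ev-^ₚ (X+ q j) 2 y) (cong (_^ℤ 2) (sym (fn≡ (X+ᵖ q j) y)))) ⟩
    abs (ev r y * ((y + q j) ^ℤ 2))              ≡⟨ ℤ.abs-* (ev r y) ((y + q j) ^ℤ 2) ⟩
    abs (ev r y) ℕ.* abs ((y + q j) ^ℤ 2)
      ≡⟨ cong (abs (ev r y) ℕ.*_) (trans (ℤ.abs-* (y + q j) ((y + q j) * 1ℤ)) (cong (abs (y + q j) ℕ.*_) (ℤ.abs-* (y + q j) 1ℤ))) ⟩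
    abs (ev r y) ℕ.* (abs (y + q j) ^ 2)         ∎))
    where open ≡-Reasoning

  linearProduct-growth : ∀ {m} (q : Vector ℤ m) →
    ∃[ C ] ∃[ B ] (∀ y → B ≤ abs y → abs y ^ m ≤ C ℕ.* abs (fn (linearProduct q) y))
  linearProduct-growth {zero}  q = 1 , 0 , λ y _ → s≤s z≤n
  linearProduct-growth {suc m} q = let (C , B , h) = linearProduct-growth (λ i → q (suc i)); a = abs (q zero) in
    2 ℕ.* C , B ⊔ (2 ℕ.* a) , λ y le → let
        f = fn (linearProduct (λ i → q (suc i))) y
        linear : abs y ≤ 2 ℕ.* abs (y + q zero)
        linear = ℕ.+-cancelʳ-≤ (abs y) _ _ (begin
          abs y ℕ.+ abs y                              ≡⟨ cong (abs y ℕ.+_) (sym (ℕ.+-identityʳ (abs y))) ⟩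
          2 ℕ.* abs y                                  ≤⟨ ℕ.*-monoʳ-≤ 2 (∣+∣≥ y (q zero)) ⟩
          2 ℕ.* (abs (y + q zero) ℕ.+ a)               ≡⟨ ℕ.*-distribˡ-+ 2 (abs (y + q zero)) a ⟩
          2 ℕ.* abs (y + q zero) ℕ.+ 2 ℕ.* a           ≤⟨ ℕ.+-monoʳ-≤ (2 ℕ.* abs (y + q zero)) (ℕ.≤-trans (ℕ.m≤n⊔m B (2 ℕ.* a)) le) ⟩
          2 ℕ.* abs (y + q zero) ℕ.+ abs y             ∎)
      in begin
        abs y ℕ.* abs y ^ m                            ≤⟨ ℕ.*-mono-≤ linear (h y (ℕ.≤-trans (ℕ.m≤m⊔n B (2 ℕ.* a)) le)) ⟩
        2 ℕ.* abs (y + q zero) ℕ.* (C ℕ.* abs f)       ≡⟨ regroup (abs (y + q zero)) C (abs f) ⟩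
        2 ℕ.* C ℕ.* (abs (y + q zero) ℕ.* abs f)       ≡⟨ cong (2 ℕ.* C ℕ.*_) (sym (ℤ.abs-* (y + q zero) f)) ⟩
        2 ℕ.* C ℕ.* abs ((y + q zero) * f)             ∎
    where
    open ℕ.≤-Reasoning
    regroup : ∀ u C f → 2 ℕ.* u ℕ.* (C ℕ.* f) ≡ 2 ℕ.* C ℕ.* (u ℕ.* f)
    regroup = ℕ.solve-∀

  Coprime-* : ∀ m p q → Coprimeᵖ m p → Coprimeᵖ m q → Coprimeᵖ m (p *ᵖ q)
  Coprime-* m p q (a , b , κ , κ≢0 , e) (a′ , b′ , κ′ , κ′≢0 , e′) =
    constᵖ κ *ᵖ a′ +ᵖ a *ᵖ b′ *ᵖ q , b *ᵖ b′ , κ * κ′ , *-≢0 κ≢0 κ′≢0 , λ x →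
    trans (regroup κ (fn a x) (fn b x) (fn a′ x) (fn b′ x) (fn m x) (fn p x) (fn q x))
    (trans (cong (λ t → κ * (fn a′ x * fn m x) + fn b′ x * fn q x * t) (e x))
    (trans (factor κ (fn a′ x * fn m x) (fn b′ x) (fn q x)) (cong (κ *_) (e′ x))))
    where
    regroup : ∀ κ a b a′ b′ m p q → (κ * a′ + a * b′ * q) * m + b * b′ * (p * q) ≡ κ * (a′ * m) + b′ * q * (a * m + b * p)
    regroup = solve-∀
    factor : ∀ κ u b q → κ * u + b * q * κ ≡ κ * (u + b * q)
    factor = solve-∀

  Coprime-sym : ∀ p q → Coprimeᵖ p q → Coprimeᵖ q p
  Coprime-sym p q (a , b , κ , κ≢0 , e) = b , a , κ , κ≢0 , λ x → trans (ℤ.+-comm (fn b x * fn q x) (fn a x * fn p x)) (e x)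

  Coprime-shift : ∀ m p u q → q ≐ p +ᵖ m *ᵖ u → Coprimeᵖ m p → Coprimeᵖ m q
  Coprime-shift m p u q h (a , b , κ , κ≢0 , e) = a +ᵖ constᵖ (- 1ℤ) *ᵖ b *ᵖ u , b , κ , κ≢0 , λ x →
    trans (cong (λ t → (fn a x + - 1ℤ * fn b x * fn u x) * fn m x + fn b x * t) (h x))
    (trans (simplify (fn a x) (fn b x) (fn u x) (fn m x) (fn p x)) (e x))
    where
    simplify : ∀ a b u m p → (a + - 1ℤ * b * u) * m + b * (p + m * u) ≡ a * m + b * p
    simplify = solve-∀

  -- Modulo p the derivative of p q is p′ q, a product of two polynomials coprime to p; likewise
  -- modulo q.
  Squarefree-* : ∀ p q → Squarefreeᵖ p → Squarefreeᵖ q → Coprimeᵖ p q → Squarefreeᵖ (p *ᵖ q)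
  Squarefree-* p q sp sq c = Coprime-sym (D (p *ᵖ q)) (p *ᵖ q) (Coprime-* (D (p *ᵖ q)) p q
    (Coprime-sym p (D (p *ᵖ q)) (Coprime-shift p (D p *ᵖ q) (D q) (D (p *ᵖ q)) (λ x → refl) (Coprime-* p (D p) q sp c)))
    (Coprime-sym q (D (p *ᵖ q)) (Coprime-shift q (p *ᵖ D q) (D p) (D (p *ᵖ q))
      (λ x → swap (dn p x) (fn q x) (fn p x) (dn q x)) (Coprime-* q p (D q) (Coprime-sym p q c) sq))))
    where
    swap : ∀ p′ q p q′ → p′ * q + p * q′ ≡ p * q′ + q * p′
    swap = solve-∀

  ∏ℤ-≢0 : ∀ {m} (v : Vector ℤ m) → (∀ i → v i ≢ 0ℤ) → ∏ℤ v ≢ 0ℤ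
  ∏ℤ-≢0 {zero}  v h ()
  ∏ℤ-≢0 {suc m} v h = *-≢0 (h zero) (∏ℤ-≢0 (λ i → v (suc i)) (λ i → h (suc i)))

  -- X + q₀ is coprime to the remaining product G because G(- q₀) is a product of differences q i -
  -- q₀, nonzero by injectivity; the factor theorem turns this into a Bezout relation.
  linearProduct-squarefree : ∀ {m} (q : Vector ℤ m) → Injective _≡_ _≡_ q → Squarefreeᵖ (linearProduct q)
  linearProduct-squarefree {zero}  q inj = constᵖ 1ℤ , constᵖ 0ℤ , 1ℤ , 1≢0 , λ x → refl
  linearProduct-squarefree {suc m} q inj = Squarefree-* (X+ᵖ q zero) G
    (constᵖ 0ℤ , constᵖ 1ℤ , 1ℤ , 1≢0 , λ x → refl)
    (linearProduct-squarefree (λ i → q (suc i)) (λ e → suc-injective (inj e)))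
    coprime
    where
    G : Pol
    G = linearProduct (λ i → q (suc i))
    v : ℤ
    v = fn G (- q zero)
    v≢0 : v ≢ 0ℤ
    v≢0 z = ∏ℤ-≢0 (λ i → - q zero + q (suc i)) (λ i e → 0≢1+n (inj (sym (ℤ.i-j≡0⇒i≡j (q (suc i)) (q zero)
      (trans (ℤ.+-comm (q (suc i)) (- q zero)) e))))) (trans (sym (fn-linearProduct (λ i → q (suc i)) (- q zero))) z)
    coprime : Coprimeᵖ (X+ᵖ q zero) G
    coprime with factor-theorem G (- q zero)
    ... | dvd κ s κ≢0 e = constᵖ (- 1ℤ) *ᵖ s , constᵖ κ , κ * v , *-≢0 κ≢0 v≢0 , λ x →
      trans (isolate (fn s x) (x + q zero) κ (fn G x) v)
      (trans (cong (λ t → t - fn s x * (x + q zero) + κ * v) (e x))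
      (trans (cong (λ t → (x + t) * fn s x - fn s x * (x + q zero) + κ * v) (ℤ.neg-involutive (q zero)))
             (cancel (x + q zero) (fn s x) (κ * v))))
      where
      isolate : ∀ s l κ g v → - 1ℤ * s * l + κ * g ≡ κ * (g + - v) - s * l + κ * v
      isolate = solve-∀
      cancel : ∀ l s w → l * s - s * l + w ≡ w
      cancel = solve-∀

  values-bounded : ∀ p B → ∃[ V ] (∀ x → abs x ≤ B → abs (ev p x) ≤ V)
  values-bounded []      B = 0 , λ _ _ → z≤n
  values-bounded (a ∷ p) B = let (V , h) = values-bounded p B in abs a ℕ.+ B ℕ.* V , λ x le →
    ℕ.≤-trans (ℤ.∣i+j∣≤∣i∣+∣j∣ a (x * ev p x)) (ℕ.+-monoʳ-≤ (abs a)
      (ℕ.≤-trans (ℕ.≤-reflexive (ℤ.abs-* x (ev p x))) (ℕ.*-mono-≤ le (h x le))))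

  interval : ℕ → List ℤ
  interval B = map (λ n → + n) (upTo (suc B)) ++ map (λ n → - + n) (upTo (suc B))

  ∈-interval : ∀ x B → abs x ≤ B → x ∈ interval B
  ∈-interval (+ n)    B le = ∈-++⁺ˡ (∈-map⁺ (λ n → + n) (∈-upTo⁺ (s≤s le)))
  ∈-interval -[1+ n ] B le = ∈-++⁺ʳ (map (λ n → + n) (upTo (suc B))) (∈-map⁺ (λ n → - + n) (∈-upTo⁺ (s≤s le)))

  bounded⇒FinitelyMany : ∀ {P : ℤ × ℤ → Set} B B′ → (∀ x y → P (x , y) → abs x ≤ B × abs y ≤ B′) → FinitelyMany P
  bounded⇒FinitelyMany B B′ h = cartesianProduct (interval B) (interval B′) , λ (x , y) Pxy →
    let (x≤ , y≤) = h x y Pxy in ∈-cartesianProduct⁺ (∈-interval x B x≤) (∈-interval y B′ y≤)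

  Tends-bound : ∀ p → Tends p → ∀ V → ∃[ B ] (∀ x → abs (fn p x) ≤ V → abs x ≤ B)
  Tends-bound p tends V = let (B , h) = tends (suc V) in B , λ x le →
    ℕ.<⇒≤ (ℕ.≰⇒> λ B≤x → ℕ.<⇒≱ (h x B≤x) le)

  degree⇒NonZero : ∀ f d → HasDegree f d → NonZeroᵖ ⌈ f ⌉
  degree⇒NonZero f d degree = let (C , B , h) = degree-growth f d degree in growth⇒NonZero ⌈ f ⌉ d C B h

  module _ (abc : ABC-Conjecture) (f : Poly) (m : ℕ) (q : Vector ℤ m) where

    private
      P : ℤ × ℤ → Set
      P (x , y) = ∏ℤ (λ i → y + q i) ≡ ev f x

      values≡ : ∀ x y → P (x , y) → fn (linearProduct q) y ≡ ev f x
      values≡ x y e = trans (fn-linearProduct q y) e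

      cubic : ∀ p d C B → 2 < d → (∀ x → B ≤ abs x → abs x ^ d ≤ C ℕ.* abs (fn p x)) →
        ∀ x → suc B ≤ abs x → abs x ^ 3 ≤ C ℕ.* abs (fn p x)
      cubic p d C B 2<d h x le = ℕ.≤-trans (ℕ.^-monoʳ-≤ (abs x) {{ℕ.>-nonZero (ℕ.≤-trans (s≤s z≤n) le)}} 2<d)
        (h x (ℕ.≤-trans (ℕ.n≤1+n B) le))

    -- The powerful number is f(x), so x is bounded first; this bounds f(x), and then y because the
    -- product is nonconstant in y.
    finite-when-product-powerful : 0 < m → Squarefreeᵖ ⌈ f ⌉ → ∀ d → HasDegree f d → 2 < d →
      (∀ j → ((X+ q j) ^ₚ 2) ∣ₚ ∏ (λ i → X+ q i)) → FinitelyMany P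
    finite-when-product-powerful 0<m sqf d degree 2<d squares = let
        (C , B , h) = degree-growth f d degree
        (Bx , hx) = powerful-values-bounded abc ⌈ f ⌉ C (suc B) (cubic ⌈ f ⌉ d C B 2<d h) (degree⇒NonZero f d degree) sqf
        (V , hV) = values-bounded f Bx
        (By , hy) = Tends-bound (linearProduct q) (tends m 0<m q) V
      in bounded⇒FinitelyMany Bx By λ x y e → let x≤ = hx x (subst (λ t → Powerful (abs t)) e (squares-powerful q squares y)) in
        x≤ , hy y (subst (λ t → abs t ≤ V) (sym (values≡ x y e)) (hV x x≤))
      where
      tends : ∀ m → 0 < m → (q : Vector ℤ m) → Tends (linearProduct q)
      tends (suc m) _ q = let (C , B , h) = linearProduct-growth q in Tends-growth (linearProduct q) m C B h

    -- The roles are exchanged: the product, squarefree of degree m > 2 in y, takes the powerful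
    -- value f(x). So y is bounded first, then x because f is nonconstant.
    finite-when-f-powerful : Nonconstant f → 2 < m → Injective _≡_ _≡_ q →
      (k : ℕ) (g : Vector Poly k) (l : Vector ℕ k) → (∀ i → 2 ≤ l i) →
      f ≈ ∏ (λ i → g i ^ₚ l i) → FinitelyMany P
    finite-when-f-powerful f-nonconstant 2<m distinct k g l 2≤l f≈ = let
        (C , B , h) = linearProduct-growth q
        (By , hy) = powerful-values-bounded abc (linearProduct q) C (suc B) (cubic (linearProduct q) m C B 2<m h)
          (growth⇒NonZero (linearProduct q) m C B h) (linearProduct-squarefree q distinct)
        (V , hV) = values-bounded (code (linearProduct q)) By
        (Bx , hx) = Tends-bound ⌈ f ⌉ (tends f-nonconstant) V
        powerful : ∀ x → Powerful (abs (ev f x))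
        powerful x = subst (λ t → Powerful (abs t)) (sym (trans (≈⇒ev≡ f (∏ (λ i → g i ^ₚ l i)) f≈ x)
          (trans (ev-∏ (λ i → g i ^ₚ l i) x) (∏ℤ-cong (λ i → ev (g i ^ₚ l i) x) (λ i → ev (g i) x ^ℤ l i) (λ i → ev-^ₚ (g i) (l i) x)))))
          (∏ℤ-powerful (λ i → ev (g i) x) l 2≤l)
      in bounded⇒FinitelyMany Bx By λ x y e →
        let y≤ = hy y (subst (λ t → Powerful (abs t)) (sym (values≡ x y e)) (powerful x)) in
        hx x (subst (λ t → abs t ≤ V) (trans (sym (fn≡ (linearProduct q) y)) (values≡ x y e)) (hV y y≤)) , y≤
      where
      tends : Nonconstant f → Tends ⌈ f ⌉
      tends (suc d , degree , _) = let (C , B , h) = degree-growth f (suc d) degree in Tends-growth ⌈ f ⌉ d C B h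

-- Gaussian rationals and their norms

module GaussianRationals where

  open import Algebra.Bundles using (CommutativeRing)
  open import Algebra.Structures using (IsCommutativeRing)
  open import Data.Empty using (⊥-elim)
  open import Data.Integer.Base as ℤ using (ℤ; -[1+_]) renaming (+_ to pos)
  import Data.Integer.Properties as ℤ
  open import Data.Maybe.Base using (Maybe; just; nothing)
  open import Data.Nat.Base as ℕ using (ℕ; zero; suc)
  import Data.Nat.Properties as ℕ
  open import Data.Product.Base using (∃-syntax; _,_)
  open import Data.Rational.Base hiding (pos)
  open import Data.Rational.Properties
  open import Data.Rational.Solver using (module +-*-Solver)
  import Data.Rational.Unnormalised.Base as ℚᵘ
  import Data.Rational.Unnormalised.Properties as ℚᵘ
  open import Data.Sum.Base using (inj₁; inj₂)
  open import Level using (0ℓ)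
  open import Relation.Binary.PropositionalEquality
  open import Relation.Nullary using (¬_; yes; no)
  open import Tactic.RingSolver using (solve-∀)
  open import Tactic.RingSolver.Core.AlmostCommutativeRing using (AlmostCommutativeRing; fromCommutativeRing)

  *-mono-0≤ : ∀ {a b c d} → 0ℚ ≤ a → a ≤ b → 0ℚ ≤ c → c ≤ d → a * c ≤ b * d
  *-mono-0≤ {a} {b} {c} {d} 0≤a a≤b 0≤c c≤d = ≤-trans
    (*-monoʳ-≤-nonNeg c {{nonNegative 0≤c}} a≤b) (*-monoˡ-≤-nonNeg b {{nonNegative (≤-trans 0≤a a≤b)}} c≤d)

  *-monoˡ : ∀ {a b} c → 0ℚ ≤ c → a ≤ b → c * a ≤ c * b
  *-monoˡ c 0≤c = *-monoˡ-≤-nonNeg c {{nonNegative 0≤c}}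

  *-monoʳ : ∀ {a b} c → 0ℚ ≤ c → a ≤ b → a * c ≤ b * c
  *-monoʳ c 0≤c = *-monoʳ-≤-nonNeg c {{nonNegative 0≤c}}

  0≤* : ∀ {a b} → 0ℚ ≤ a → 0ℚ ≤ b → 0ℚ ≤ a * b
  0≤* {a} {b} 0≤a 0≤b = subst (_≤ a * b) (*-zeroˡ b) (*-monoʳ b 0≤b 0≤a)

  0≤+ : ∀ {a b} → 0ℚ ≤ a → 0ℚ ≤ b → 0ℚ ≤ a + b
  0≤+ {a} {b} 0≤a 0≤b = subst (_≤ a + b) (+-identityˡ 0ℚ) (+-mono-≤ 0≤a 0≤b)

  p≤p+q : ∀ p {q} → 0ℚ ≤ q → p ≤ p + q
  p≤p+q p {q} 0≤q = subst (_≤ p + q) (+-identityʳ p) (+-monoʳ-≤ p 0≤q)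

  q≤p+q : ∀ {p} q → 0ℚ ≤ p → q ≤ p + q
  q≤p+q {p} q 0≤p = subst (_≤ p + q) (+-identityˡ q) (+-monoˡ-≤ q 0≤p)

  <⇒≱ : ∀ {p q} → p < q → ¬ q ≤ p
  <⇒≱ p<q q≤p = <-irrefl refl (<-≤-trans p<q q≤p)

  +-cancelʳ : ∀ {p q} r → p + r ≤ q + r → p ≤ q
  +-cancelʳ {p} {q} r h = subst₂ _≤_ (cancel p r) (cancel q r) (+-monoˡ-≤ (- r) h)
    where
    open +-*-Solver
    cancel : ∀ p r → p + r + - r ≡ p
    cancel = solve 2 (λ p r → p :+ r :+ :- r := p) refl

  0≤1 : 0ℚ ≤ 1ℚ
  0≤1 = nonNegative⁻¹ 1ℚ

  0≤½ : 0ℚ ≤ ½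
  0≤½ = nonNegative⁻¹ ½

  0≤square : ∀ p → 0ℚ ≤ p * p
  0≤square p with ≤-total 0ℚ p
  ... | inj₁ 0≤p = 0≤* 0≤p 0≤p
  ... | inj₂ p≤0 = subst (0ℚ ≤_) (neg*neg p) (0≤* (neg-antimono-≤ p≤0) (neg-antimono-≤ p≤0))
    where
    open +-*-Solver
    neg*neg : ∀ p → - p * - p ≡ p * p
    neg*neg = solve 1 (λ p → :- p :* :- p := p :* p) refl

  fromℤℚ : ℤ → ℚ
  fromℤℚ a = a / 1

  fromℤℚ-+ : ∀ a b → fromℤℚ (a ℤ.+ b) ≡ fromℤℚ a + fromℤℚ b
  fromℤℚ-+ a b = toℚᵘ-injective (ℚᵘ.≃-trans (toℚᵘ-fromℚᵘ (ℚᵘ.mkℚᵘ (a ℤ.+ b) 0))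
    (ℚᵘ.≃-trans (ℚᵘ.≃-reflexive (cong (λ c → ℚᵘ.mkℚᵘ c 0) (sym (cong₂ ℤ._+_ (ℤ.*-identityʳ a) (ℤ.*-identityʳ b)))))
    (ℚᵘ.≃-sym (ℚᵘ.≃-trans (toℚᵘ-homo-+ (fromℤℚ a) (fromℤℚ b))
      (ℚᵘ.+-cong (toℚᵘ-fromℚᵘ (ℚᵘ.mkℚᵘ a 0)) (toℚᵘ-fromℚᵘ (ℚᵘ.mkℚᵘ b 0)))))))

  fromℤℚ-* : ∀ a b → fromℤℚ (a ℤ.* b) ≡ fromℤℚ a * fromℤℚ b
  fromℤℚ-* a b = toℚᵘ-injective (ℚᵘ.≃-trans (toℚᵘ-fromℚᵘ (ℚᵘ.mkℚᵘ (a ℤ.* b) 0))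
    (ℚᵘ.≃-sym (ℚᵘ.≃-trans (toℚᵘ-homo-* (fromℤℚ a) (fromℤℚ b))
      (ℚᵘ.*-cong (toℚᵘ-fromℚᵘ (ℚᵘ.mkℚᵘ a 0)) (toℚᵘ-fromℚᵘ (ℚᵘ.mkℚᵘ b 0))))))

  fromℕ : ℕ → ℚ
  fromℕ n = fromℤℚ (pos n)

  fromℕ-suc : ∀ n → fromℕ (suc n) ≡ 1ℚ + fromℕ n
  fromℕ-suc n = fromℤℚ-+ (pos 1) (pos n)

  fromℕ-* : ∀ m n → fromℕ (m ℕ.* n) ≡ fromℕ m * fromℕ n
  fromℕ-* m n = trans (cong fromℤℚ (ℤ.pos-* m n)) (fromℤℚ-* (pos m) (pos n))

  0≤fromℕ : ∀ n → 0ℚ ≤ fromℕ n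
  0≤fromℕ zero    = ≤-refl
  0≤fromℕ (suc n) = subst (0ℚ ≤_) (sym (fromℕ-suc n)) (0≤+ 0≤1 (0≤fromℕ n))

  1≤fromℕ : ∀ n → 1ℚ ≤ fromℕ (suc n)
  1≤fromℕ n = subst (1ℚ ≤_) (sym (fromℕ-suc n)) (p≤p+q 1ℚ (0≤fromℕ n))

  archimedean : ∀ p → ∃[ n ] p ≤ fromℕ n
  archimedean p@(mkℚ (pos n) d-1 _) = n , toℚᵘ-cancel-≤ (ℚᵘ.≤-respʳ-≃ (ℚᵘ.≃-sym (toℚᵘ-fromℚᵘ (ℚᵘ.mkℚᵘ (pos n) 0)))
    (ℚᵘ.*≤* (subst₂ ℤ._≤_ (ℤ.pos-* n 1) (ℤ.pos-* n (suc d-1)) (ℤ.+≤+ (ℕ.*-monoʳ-≤ n (ℕ.s≤s ℕ.z≤n))))))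
  archimedean p@(mkℚ -[1+ n ] d-1 _) = 0 , nonPositive⁻¹ p

  ∣fromℤℚ∣≥1 : ∀ a → a ≢ ℤ.0ℤ → 1ℚ ≤ ∣ fromℤℚ a ∣
  ∣fromℤℚ∣≥1 (pos zero)    a≢0 = ⊥-elim (a≢0 refl)
  ∣fromℤℚ∣≥1 (pos (suc n)) _   = subst (1ℚ ≤_) (sym (0≤p⇒∣p∣≡p (0≤fromℕ (suc n)))) (1≤fromℕ n)
  ∣fromℤℚ∣≥1 -[1+ n ]      _   = subst (1ℚ ≤_) (sym (trans (∣-p∣≡∣p∣ (fromℕ (suc n))) (0≤p⇒∣p∣≡p (0≤fromℕ (suc n))))) (1≤fromℕ n)

  -- A datatype rather than a record, to keep the operations from unfolding
  -- on variables.

  infixl 6 _+ᶜ_ _-ᶜ_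
  infixl 7 _*ᶜ_
  infix  8 -ᶜ_
  infix  5 _⊹_

  data Gauss : Set where
    _⊹_ : ℚ → ℚ → Gauss

  Re Im : Gauss → ℚ
  Re (a ⊹ b) = a
  Im (a ⊹ b) = b

  _+ᶜ_ _*ᶜ_ : Gauss → Gauss → Gauss
  (a ⊹ b) +ᶜ (c ⊹ d) = (a + c) ⊹ (b + d)
  (a ⊹ b) *ᶜ (c ⊹ d) = (a * c + - (b * d)) ⊹ (a * d + b * c)

  -ᶜ_ : Gauss → Gauss
  -ᶜ (a ⊹ b) = (- a) ⊹ (- b)

  _-ᶜ_ : Gauss → Gauss → Gauss
  x -ᶜ y = x +ᶜ -ᶜ y

  ofℚ : ℚ → Gauss
  ofℚ q = q ⊹ 0ℚ

  ofℤ : ℤ → Gauss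
  ofℤ a = ofℚ (fromℤℚ a)

  0ᶜ 1ᶜ : Gauss
  0ᶜ = ofℚ 0ℚ
  1ᶜ = ofℚ 1ℚ

  gaussIsRing : IsCommutativeRing _≡_ _+ᶜ_ _*ᶜ_ -ᶜ_ 0ᶜ 1ᶜ
  gaussIsRing = record
    { isRing = record
      { +-isAbelianGroup = record
        { isGroup = record
          { isMonoid = record
            { isSemigroup = record
              { isMagma = record { isEquivalence = isEquivalence ; ∙-cong = cong₂ _+ᶜ_ }
              ; assoc = λ { (a ⊹ b) (c ⊹ d) (e ⊹ f) → cong₂ _⊹_ (+-assoc a c e) (+-assoc b d f) } }
            ; identity = (λ { (a ⊹ b) → cong₂ _⊹_ (+-identityˡ a) (+-identityˡ b) })
                       , (λ { (a ⊹ b) → cong₂ _⊹_ (+-identityʳ a) (+-identityʳ b) }) }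
          ; inverse = (λ { (a ⊹ b) → cong₂ _⊹_ (+-inverseˡ a) (+-inverseˡ b) })
                    , (λ { (a ⊹ b) → cong₂ _⊹_ (+-inverseʳ a) (+-inverseʳ b) })
          ; ⁻¹-cong = cong (λ x → -ᶜ x) }
        ; comm = λ { (a ⊹ b) (c ⊹ d) → cong₂ _⊹_ (+-comm a c) (+-comm b d) } }
      ; *-cong = cong₂ _*ᶜ_
      ; *-assoc = λ { (a ⊹ b) (c ⊹ d) (e ⊹ f) → cong₂ _⊹_
          (solve 6 (λ a b c d e f → (a :* c :+ :- (b :* d)) :* e :+ :- ((a :* d :+ b :* c) :* f)
                                  := a :* (c :* e :+ :- (d :* f)) :+ :- (b :* (c :* f :+ d :* e))) refl a b c d e f)
          (solve 6 (λ a b c d e f → (a :* c :+ :- (b :* d)) :* f :+ (a :* d :+ b :* c) :* e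
                                  := a :* (c :* f :+ d :* e) :+ b :* (c :* e :+ :- (d :* f))) refl a b c d e f) }
      ; *-identity = (λ { (a ⊹ b) → cong₂ _⊹_ (solve 2 (λ a b → con 1ℚ :* a :+ :- (con 0ℚ :* b) := a) refl a b)
                                              (solve 2 (λ a b → con 1ℚ :* b :+ con 0ℚ :* a := b) refl a b) })
                   , (λ { (a ⊹ b) → cong₂ _⊹_ (solve 2 (λ a b → a :* con 1ℚ :+ :- (b :* con 0ℚ) := a) refl a b)
                                              (solve 2 (λ a b → a :* con 0ℚ :+ b :* con 1ℚ := b) refl a b) })
      ; distrib = (λ { (a ⊹ b) (c ⊹ d) (e ⊹ f) → cong₂ _⊹_
            (solve 6 (λ a b c d e f → a :* (c :+ e) :+ :- (b :* (d :+ f)) := a :* c :+ :- (b :* d) :+ (a :* e :+ :- (b :* f))) refl a b c d e f)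
            (solve 6 (λ a b c d e f → a :* (d :+ f) :+ b :* (c :+ e) := a :* d :+ b :* c :+ (a :* f :+ b :* e)) refl a b c d e f) })
                , (λ { (a ⊹ b) (c ⊹ d) (e ⊹ f) → cong₂ _⊹_
            (solve 6 (λ a b c d e f → (c :+ e) :* a :+ :- ((d :+ f) :* b) := c :* a :+ :- (d :* b) :+ (e :* a :+ :- (f :* b))) refl a b c d e f)
            (solve 6 (λ a b c d e f → (c :+ e) :* b :+ (d :+ f) :* a := c :* b :+ d :* a :+ (e :* b :+ f :* a)) refl a b c d e f) }) }
    ; *-comm = λ { (a ⊹ b) (c ⊹ d) → cong₂ _⊹_ (solve 4 (λ a b c d → a :* c :+ :- (b :* d) := c :* a :+ :- (d :* b)) refl a b c d)
                                                (solve 4 (λ a b c d → a :* d :+ b :* c := c :* b :+ d :* a) refl a b c d) } }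
    where open +-*-Solver

  gaussRing : CommutativeRing 0ℓ 0ℓ
  gaussRing = record { isCommutativeRing = gaussIsRing }

  0ᶜ≟ : ∀ x → Maybe (0ᶜ ≡ x)
  0ᶜ≟ (a ⊹ b) with 0ℚ ≟ a | 0ℚ ≟ b
  ... | yes refl | yes refl = just refl
  ... | _        | _        = nothing

  gaussACR : AlmostCommutativeRing 0ℓ 0ℓ
  gaussACR = fromCommutativeRing gaussRing 0ᶜ≟

  open CommutativeRing gaussRing public using () renaming
    (*-comm to *ᶜ-comm; *-assoc to *ᶜ-assoc; *-identityˡ to *ᶜ-identityˡ; *-identityʳ to *ᶜ-identityʳ; zeroˡ to *ᶜ-zeroˡ; zeroʳ to *ᶜ-zeroʳ; +-identityˡ to +ᶜ-identityˡ; +-identityʳ to +ᶜ-identityʳ; -‿inverseʳ to -ᶜ-inverseʳ)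

  ofℤ-+ : ∀ a b → ofℤ (a ℤ.+ b) ≡ ofℤ a +ᶜ ofℤ b
  ofℤ-+ a b = cong₂ _⊹_ (fromℤℚ-+ a b) (sym (+-identityˡ 0ℚ))

  ofℚ-* : ∀ p q → ofℚ (p * q) ≡ ofℚ p *ᶜ ofℚ q
  ofℚ-* p q = cong₂ _⊹_ (solve 2 (λ p q → p :* q := p :* q :+ :- (con 0ℚ :* con 0ℚ)) refl p q)
    (solve 2 (λ p q → con 0ℚ := p :* con 0ℚ :+ con 0ℚ :* q) refl p q)
    where open +-*-Solver

  ofℤ-* : ∀ a b → ofℤ (a ℤ.* b) ≡ ofℤ a *ᶜ ofℤ b
  ofℤ-* a b = trans (cong ofℚ (fromℤℚ-* a b)) (ofℚ-* (fromℤℚ a) (fromℤℚ b))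

  -- Unlike the modulus, rational-valued.

  norm : Gauss → ℚ
  norm (a ⊹ b) = ∣ a ∣ + ∣ b ∣

  0≤norm : ∀ x → 0ℚ ≤ norm x
  0≤norm (a ⊹ b) = 0≤+ (0≤∣p∣ a) (0≤∣p∣ b)

  norm-+≤ : ∀ x y → (norm (x +ᶜ y)) ≤ (norm x) + (norm y)
  norm-+≤ (a ⊹ b) (c ⊹ d) = ≤-trans (+-mono-≤ (∣p+q∣≤∣p∣+∣q∣ a c) (∣p+q∣≤∣p∣+∣q∣ b d))
    (≤-reflexive (solve 4 (λ a b c d → a :+ c :+ (b :+ d) := a :+ b :+ (c :+ d)) refl (∣ a ∣) (∣ b ∣) (∣ c ∣) (∣ d ∣)))
    where open +-*-Solver

  norm-neg : ∀ x → norm (-ᶜ x) ≡ norm x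
  norm-neg (a ⊹ b) = cong₂ _+_ (∣-p∣≡∣p∣ a) (∣-p∣≡∣p∣ b)

  norm-*≤ : ∀ x y → (norm (x *ᶜ y)) ≤ (norm x) * (norm y)
  norm-*≤ (a ⊹ b) (c ⊹ d) = ≤-trans (+-mono-≤ (∣p+q∣≤∣p∣+∣q∣ (a * c) (- (b * d))) (∣p+q∣≤∣p∣+∣q∣ (a * d) (b * c)))
    (≤-reflexive (trans (cong₂ _+_ (cong₂ _+_ (∣p*q∣≡∣p∣*∣q∣ a c) (trans (∣-p∣≡∣p∣ (b * d)) (∣p*q∣≡∣p∣*∣q∣ b d)))
                                   (cong₂ _+_ (∣p*q∣≡∣p∣*∣q∣ a d) (∣p*q∣≡∣p∣*∣q∣ b c)))
      (solve 4 (λ a b c d → a :* c :+ b :* d :+ (a :* d :+ b :* c) := (a :+ b) :* (c :+ d)) refl (∣ a ∣) (∣ b ∣) (∣ c ∣) (∣ d ∣))))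
    where open +-*-Solver

  norm-ofℚ : ∀ q → 0ℚ ≤ q → norm (ofℚ q) ≡ q
  norm-ofℚ q 0≤q = trans (+-identityʳ ∣ q ∣) (0≤p⇒∣p∣≡p 0≤q)

  norm-0 : norm 0ᶜ ≡ 0ℚ
  norm-0 = refl

  norm-1 : norm 1ᶜ ≡ 1ℚ
  norm-1 = refl

  norm-ofℤ≥1 : ∀ a → a ≢ ℤ.0ℤ → 1ℚ ≤ (norm (ofℤ a))
  norm-ofℤ≥1 a a≢0 = subst (1ℚ ≤_) (sym (+-identityʳ ∣ fromℤℚ a ∣)) (∣fromℤℚ∣≥1 a a≢0)

  -- Multiplicative, which `norm` is not; it agrees with the square of `norm` up to a factor 2.
  modulus² : Gauss → ℚ
  modulus² (a ⊹ b) = a * a + b * b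

  modulus²-* : ∀ x y → modulus² (x *ᶜ y) ≡ modulus² x * modulus² y
  modulus²-* (a ⊹ b) (c ⊹ d) = solve 4 (λ a b c d →
      (a :* c :+ :- (b :* d)) :* (a :* c :+ :- (b :* d)) :+ (a :* d :+ b :* c) :* (a :* d :+ b :* c)
      := (a :* a :+ b :* b) :* (c :* c :+ d :* d)) refl a b c d
    where open +-*-Solver

  ∣∣-square : ∀ p → ∣ p ∣ * ∣ p ∣ ≡ p * p
  ∣∣-square p = trans (sym (∣p*q∣≡∣p∣*∣q∣ p p)) (0≤p⇒∣p∣≡p (0≤square p))

  norm²≤2modulus² : ∀ x → (norm x) * (norm x) ≤ (1ℚ + 1ℚ) * modulus² x
  norm²≤2modulus² (a ⊹ b) = subst₂ _≤_ refl (trans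
      (solve 2 (λ a b → (a :+ b) :* (a :+ b) :+ (a :- b) :* (a :- b) := (con 1ℚ :+ con 1ℚ) :* (a :* a :+ b :* b)) refl (∣ a ∣) (∣ b ∣))
      (cong₂ (λ s t → (1ℚ + 1ℚ) * (s + t)) (∣∣-square a) (∣∣-square b)))
    (p≤p+q _ (0≤square (∣ a ∣ - ∣ b ∣)))
    where open +-*-Solver

  modulus²≤norm² : ∀ x → modulus² x ≤ (norm x) * (norm x)
  modulus²≤norm² (a ⊹ b) = subst₂ _≤_ (cong₂ _+_ (∣∣-square a) (∣∣-square b))
      (solve 2 (λ a b → a :* a :+ b :* b :+ (a :* b :+ a :* b) := (a :+ b) :* (a :+ b)) refl (∣ a ∣) (∣ b ∣))
    (p≤p+q _ (0≤+ (0≤* (0≤∣p∣ a) (0≤∣p∣ b)) (0≤* (0≤∣p∣ a) (0≤∣p∣ b))))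
    where open +-*-Solver

  conj : Gauss → Gauss
  conj (a ⊹ b) = a ⊹ (- b)

  conj-* : ∀ x → conj x *ᶜ x ≡ ofℚ (modulus² x)
  conj-* (a ⊹ b) = cong₂ _⊹_ (solve 2 (λ a b → a :* a :+ :- (:- b :* b) := a :* a :+ b :* b) refl a b)
    (solve 2 (λ a b → a :* b :+ :- b :* a := con 0ℚ) refl a b)
    where open +-*-Solver

  norm-conj : ∀ x → norm (conj x) ≡ norm x
  norm-conj (a ⊹ b) = cong (_+_ ∣ a ∣) (∣-p∣≡∣p∣ b)

  0≤modulus² : ∀ x → 0ℚ ≤ modulus² x
  0≤modulus² (a ⊹ b) = 0≤+ (0≤square a) (0≤square b)

  norm-scale : ∀ q → 0ℚ ≤ q → ∀ y → (norm (ofℚ q *ᶜ y)) ≡ norm (ofℚ q) * norm y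
  norm-scale q 0≤q (c ⊹ d) = trans (cong₂ (λ s t → ∣ s ∣ + ∣ t ∣)
      (solve 3 (λ q c d → q :* c :+ :- (con 0ℚ :* d) := q :* c) refl q c d)
      (solve 3 (λ q c d → q :* d :+ con 0ℚ :* c := q :* d) refl q c d))
    (trans (cong₂ _+_ (∣p*q∣≡∣p∣*∣q∣ q c) (∣p*q∣≡∣p∣*∣q∣ q d))
      (solve 3 (λ q c d → q :* c :+ q :* d := (q :+ con 0ℚ) :* (c :+ d)) refl (∣ q ∣) (∣ c ∣) (∣ d ∣)))
    where open +-*-Solver

  -- Multiplying x y by the conjugate of x gives |x|² y, whose norm is known exactly; comparing |x|²
  -- with the square of `norm x` costs the factor 2.
  norm-*≥ : ∀ x y → (norm x) * (norm y) ≤ (1ℚ + 1ℚ) * (norm (x *ᶜ y))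
  norm-*≥ x y with 0ℚ <? (norm x)
  ... | no ¬0< = ≤-trans (≤-reflexive (trans (cong (_* (norm y)) (≤-antisym (≮⇒≥ ¬0<) (0≤norm x))) (*-zeroˡ  (norm y))))
                   (0≤* (0≤+ 0≤1 0≤1) (0≤norm (x *ᶜ y)))
  ... | yes 0<x = *-cancelˡ-≤-pos  (norm x) {{positive 0<x}} (begin
    (norm x) * ((norm x) * (norm y))                    ≡⟨ *-assoc  (norm x) (norm x) (norm y) ⟨
    (norm x) * (norm x) * (norm y)                      ≤⟨ *-monoʳ  (norm y) (0≤norm y) (norm²≤2modulus² x) ⟩
    (1ℚ + 1ℚ) * modulus² x * (norm y)             ≡⟨ *-assoc (1ℚ + 1ℚ) (modulus² x) (norm y) ⟩
    (1ℚ + 1ℚ) * (modulus² x * (norm y))           ≡⟨ cong (λ t → (1ℚ + 1ℚ) * (t * (norm y))) (sym (norm-ofℚ (modulus² x) (0≤modulus² x))) ⟩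
    (1ℚ + 1ℚ) * ((norm (ofℚ (modulus² x))) * (norm y)) ≡⟨ cong ((1ℚ + 1ℚ) *_) (norm-scale (modulus² x) (0≤modulus² x) y) ⟨
    (1ℚ + 1ℚ) * (norm (ofℚ (modulus² x) *ᶜ y))      ≡⟨ cong (λ t → (1ℚ + 1ℚ) * (norm t)) (trans (cong (_*ᶜ y) (sym (conj-* x))) (*ᶜ-assoc (conj x) x y)) ⟩
    (1ℚ + 1ℚ) * (norm (conj x *ᶜ (x *ᶜ y)))         ≤⟨ *-monoˡ (1ℚ + 1ℚ) (0≤+ 0≤1 0≤1) (norm-*≤ (conj x) (x *ᶜ y)) ⟩
    (1ℚ + 1ℚ) * ((norm (conj x)) * (norm (x *ᶜ y)))      ≡⟨ cong (λ t → (1ℚ + 1ℚ) * (t * (norm (x *ᶜ y)))) (norm-conj x) ⟩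
    (1ℚ + 1ℚ) * ((norm x) * (norm (x *ᶜ y)))           ≡⟨ swap (1ℚ + 1ℚ) (norm x) (norm (x *ᶜ y)) ⟩
    (norm x) * ((1ℚ + 1ℚ) * (norm (x *ᶜ y)))           ∎)
    where
    open ≤-Reasoning
    swap : ∀ a b c → a * (b * c) ≡ b * (a * c)
    swap = solve 3 (λ a b c → a :* (b :* c) := b :* (a :* c)) refl where open +-*-Solver

  -- Junk value: invᶜ 0 = 0.
  invᶜ : Gauss → Gauss
  invᶜ x with modulus² x ≟ 0ℚ
  ... | yes _   = 0ᶜ
  ... | no n≢0 = ofℚ (1/_ (modulus² x) {{≢-nonZero n≢0}}) *ᶜ conj x

  *-invᶜ : ∀ x → 0ℚ < (norm x) → x *ᶜ invᶜ x ≡ 1ᶜ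
  *-invᶜ x 0<x with modulus² x ≟ 0ℚ
  ... | yes n≡0 = ⊥-elim (<⇒≢ (positive⁻¹ ((norm x) * (norm x)) {{pos*pos⇒pos  (norm x) {{positive 0<x}} (norm x) {{positive 0<x}}}})
      (≤-antisym (0≤square  (norm x)) (≤-trans (norm²≤2modulus² x) (≤-reflexive (trans (cong ((1ℚ + 1ℚ) *_) n≡0) (*-zeroʳ (1ℚ + 1ℚ)))))))
  ... | no n≢0 = trans (swap x (ofℚ r) (conj x)) (trans (cong (ofℚ r *ᶜ_) (conj-* x))
      (trans (sym (ofℚ-* r (modulus² x))) (cong ofℚ (*-inverseˡ (modulus² x) {{≢-nonZero n≢0}}))))
    where
    r : ℚ
    r = 1/_ (modulus² x) {{≢-nonZero n≢0}}
    swap : ∀ x r c → x *ᶜ (r *ᶜ c) ≡ r *ᶜ (c *ᶜ x)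
    swap = solve-∀ gaussACR

  norm-inv≤ : ∀ x y → x *ᶜ y ≡ 1ᶜ → (norm x) * (norm y) ≤ 1ℚ + 1ℚ
  norm-inv≤ x y e = subst ((norm x) * (norm y) ≤_) (cong (λ t → (1ℚ + 1ℚ) * (norm t)) e) (norm-*≥ x y)

-- Divided differences and rational rotations

module PolynomialsOverℚi where

  open PolynomialEvaluation
  open GaussianRationals
  open import Data.Integer.Base using (0ℤ)
  open import Data.List.Base using ([]; _∷_; _∷ʳ_)
  open import Data.Nat.Base using (ℕ; suc)
  open import Data.Product.Base using (∃-syntax; _×_; _,_)
  open import Data.Rational.Base
  open import Data.Rational.Properties
  open import Data.Rational.Solver using (module +-*-Solver)
  open import Relation.Binary.PropositionalEquality
  open import Tactic.RingSolver using (solve-∀)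

  open Evaluation gaussRing ofℤ refl ofℤ-+ ofℤ-* public using () renaming
    (ev to evᶜ; ev-⊕ to evᶜ-⊕; ev-⊗ to evᶜ-⊗; ev-const to evᶜ-const; ev-IsZero to evᶜ-IsZero; ev-deriv-∷ to evᶜ-deriv-∷; ev-scale to evᶜ-scale)

  norm-−≤ : ∀ x y → norm (x -ᶜ y) ≤ norm x + norm y
  norm-−≤ x y = subst (norm (x -ᶜ y) ≤_) (cong (_+_ (norm x)) (norm-neg y)) (norm-+≤ x (-ᶜ y))

  norm≤norm-−+ : ∀ x y → norm x ≤ norm (x -ᶜ y) + norm y
  norm≤norm-−+ x y = subst (_≤ norm (x -ᶜ y) + norm y) (cong norm (cancel x y)) (norm-+≤ (x -ᶜ y) y)
    where
    cancel : ∀ x y → x -ᶜ y +ᶜ y ≡ x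
    cancel = solve-∀ gaussACR

  norm-+≤-mono : ∀ {a b} x y → norm x ≤ a → norm y ≤ b → norm (x +ᶜ y) ≤ a + b
  norm-+≤-mono x y hx hy = ≤-trans (norm-+≤ x y) (+-mono-≤ hx hy)

  norm-*≤-mono : ∀ {a b} x y → norm x ≤ a → norm y ≤ b → norm (x *ᶜ y) ≤ a * b
  norm-*≤-mono x y hx hy = ≤-trans (norm-*≤ x y) (*-mono-0≤ (0≤norm x) hx (0≤norm y) hy)

  bound : Poly → ℚ → ℚ
  bound []      B = 0ℚ
  bound (a ∷ p) B = norm (ofℤ a) + B * bound p B

  0≤bound : ∀ p {B} → 0ℚ ≤ B → 0ℚ ≤ bound p B
  0≤bound []      0≤B = ≤-refl
  0≤bound (a ∷ p) 0≤B = 0≤+ (0≤norm (ofℤ a)) (0≤* 0≤B (0≤bound p 0≤B))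

  norm-ev≤bound : ∀ p z {B} → norm z ≤ B → norm (evᶜ p z) ≤ bound p B
  norm-ev≤bound []      z h = ≤-refl
  norm-ev≤bound (a ∷ p) z h = norm-+≤-mono (ofℤ a) (z *ᶜ evᶜ p z) ≤-refl (norm-*≤-mono z (evᶜ p z) h (norm-ev≤bound p z h))

  -- The divided difference (p(z) - p(w)) / (z - w) written as a polynomial in z and w, so that it
  -- makes sense at z = w, where it is p′.
  Δ : Poly → Gauss → Gauss → Gauss
  Δ []      z w = 0ᶜ
  Δ (a ∷ p) z w = evᶜ p z +ᶜ w *ᶜ Δ p z w

  Δ-eq : ∀ p z w → evᶜ p z -ᶜ evᶜ p w ≡ (z -ᶜ w) *ᶜ Δ p z w
  Δ-eq []      z w = sym (*ᶜ-zeroʳ (z -ᶜ w))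
  Δ-eq (a ∷ p) z w = trans (isolate (ofℤ a) z w (evᶜ p z) (evᶜ p w))
    (trans (cong (λ t → (z -ᶜ w) *ᶜ evᶜ p z +ᶜ w *ᶜ t) (Δ-eq p z w)) (collect (z -ᶜ w) (evᶜ p z) w (Δ p z w)))
    where
    isolate : ∀ a z w p q → a +ᶜ z *ᶜ p -ᶜ (a +ᶜ w *ᶜ q) ≡ (z -ᶜ w) *ᶜ p +ᶜ w *ᶜ (p -ᶜ q)
    isolate = solve-∀ gaussACR
    collect : ∀ d p w e → d *ᶜ p +ᶜ w *ᶜ (d *ᶜ e) ≡ d *ᶜ (p +ᶜ w *ᶜ e)
    collect = solve-∀ gaussACR

  Δ-diagonal : ∀ p z → Δ p z z ≡ evᶜ (deriv p) z
  Δ-diagonal []      z = refl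
  Δ-diagonal (a ∷ p) z = trans (cong (λ t → evᶜ p z +ᶜ z *ᶜ t) (Δ-diagonal p z)) (sym (evᶜ-deriv-∷ a p z))

  -- The divided difference of `Δ` in its second argument; it controls second-order errors.
  Δ² : Poly → Gauss → Gauss → Gauss → Gauss
  Δ² []      z w v = 0ᶜ
  Δ² (a ∷ p) z w v = Δ p z w +ᶜ v *ᶜ Δ² p z w v

  Δ²-eq : ∀ p z w v → Δ p z w -ᶜ Δ p z v ≡ (w -ᶜ v) *ᶜ Δ² p z w v
  Δ²-eq []      z w v = sym (*ᶜ-zeroʳ (w -ᶜ v))
  Δ²-eq (a ∷ p) z w v = trans (isolate (evᶜ p z) w v (Δ p z w) (Δ p z v))
    (trans (cong (λ t → (w -ᶜ v) *ᶜ Δ p z w +ᶜ v *ᶜ t) (Δ²-eq p z w v)) (collect (w -ᶜ v) (Δ p z w) v (Δ² p z w v)))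
    where
    isolate : ∀ a z w p q → a +ᶜ z *ᶜ p -ᶜ (a +ᶜ w *ᶜ q) ≡ (z -ᶜ w) *ᶜ p +ᶜ w *ᶜ (p -ᶜ q)
    isolate = solve-∀ gaussACR
    collect : ∀ d p w e → d *ᶜ p +ᶜ w *ᶜ (d *ᶜ e) ≡ d *ᶜ (p +ᶜ w *ᶜ e)
    collect = solve-∀ gaussACR

  boundΔ boundΔ² : Poly → ℚ → ℚ
  boundΔ []      B = 0ℚ
  boundΔ (a ∷ p) B = bound p B + B * boundΔ p B
  boundΔ² []      B = 0ℚ
  boundΔ² (a ∷ p) B = boundΔ p B + B * boundΔ² p B

  0≤boundΔ : ∀ p {B} → 0ℚ ≤ B → 0ℚ ≤ boundΔ p B
  0≤boundΔ []      0≤B = ≤-refl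
  0≤boundΔ (a ∷ p) 0≤B = 0≤+ (0≤bound p 0≤B) (0≤* 0≤B (0≤boundΔ p 0≤B))

  0≤boundΔ² : ∀ p {B} → 0ℚ ≤ B → 0ℚ ≤ boundΔ² p B
  0≤boundΔ² []      0≤B = ≤-refl
  0≤boundΔ² (a ∷ p) 0≤B = 0≤+ (0≤boundΔ p 0≤B) (0≤* 0≤B (0≤boundΔ² p 0≤B))

  norm-Δ≤ : ∀ p z w {B} → norm z ≤ B → norm w ≤ B → norm (Δ p z w) ≤ boundΔ p B
  norm-Δ≤ []      z w hz hw = ≤-refl
  norm-Δ≤ (a ∷ p) z w hz hw = norm-+≤-mono (evᶜ p z) (w *ᶜ Δ p z w) (norm-ev≤bound p z hz)
    (norm-*≤-mono w (Δ p z w) hw (norm-Δ≤ p z w hz hw))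

  norm-Δ²≤ : ∀ p z w v {B} → norm z ≤ B → norm w ≤ B → norm v ≤ B → norm (Δ² p z w v) ≤ boundΔ² p B
  norm-Δ²≤ []      z w v hz hw hv = ≤-refl
  norm-Δ²≤ (a ∷ p) z w v hz hw hv = norm-+≤-mono (Δ p z w) (v *ᶜ Δ² p z w v) (norm-Δ≤ p z w hz hw)
    (norm-*≤-mono v (Δ² p z w v) hv (norm-Δ²≤ p z w v hz hw hv))

  2ℚ 4ℚ : ℚ
  2ℚ = 1ℚ + 1ℚ
  4ℚ = 2ℚ + 2ℚ

  0≤2 : 0ℚ ≤ 2ℚ
  0≤2 = nonNegative⁻¹ 2ℚ

  -- Mutual induction on the coefficients: if |p| ≥ 1 far out, then z p(z), and with it a + z p(z),
  -- becomes as large as desired.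
  growth≥1 : ∀ p γ → γ ≢ 0ℤ → ∃[ R ] (0ℚ ≤ R × (∀ z → R ≤ norm z → 1ℚ ≤ norm (evᶜ (p ∷ʳ γ) z)))
  growthᶜ : ∀ a p γ → γ ≢ 0ℤ → ∀ M → 0ℚ ≤ M → ∃[ R ] (0ℚ ≤ R × (∀ z → R ≤ norm z → M ≤ norm (evᶜ (a ∷ p ∷ʳ γ) z)))
  growth≥1 []      γ γ≢0 = 0ℚ , ≤-refl , λ z _ → subst (λ t → 1ℚ ≤ norm t) (sym (evᶜ-const γ z)) (norm-ofℤ≥1 γ γ≢0)
  growth≥1 (a ∷ p) γ γ≢0 = growthᶜ a p γ γ≢0 1ℚ 0≤1
  growthᶜ a p γ γ≢0 M 0≤M = let (R , 0≤R , h) = growth≥1 p γ γ≢0 in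
    R + 2ℚ * (M + α) , 0≤+ 0≤R 0≤M+α , λ z le → let w = evᶜ (p ∷ʳ γ) z in
      +-cancelʳ α (*-cancelˡ-≤-pos 2ℚ (begin
        2ℚ * (M + α)                             ≤⟨ q≤p+q (2ℚ * (M + α)) 0≤R ⟩
        R + 2ℚ * (M + α)                         ≤⟨ le ⟩
        norm z                                   ≡⟨ *-identityʳ (norm z) ⟨
        norm z * 1ℚ                              ≤⟨ *-monoˡ (norm z) (0≤norm z) (h z (≤-trans (p≤p+q R 0≤M+α) le)) ⟩
        norm z * norm w                          ≤⟨ norm-*≥ z w ⟩
        2ℚ * norm (z *ᶜ w)                       ≡⟨ cong (λ t → 2ℚ * norm t) (cancel (ofℤ a) (z *ᶜ w)) ⟨
        2ℚ * norm (ofℤ a +ᶜ z *ᶜ w -ᶜ ofℤ a)     ≤⟨ *-monoˡ 2ℚ 0≤2 (norm-−≤ (ofℤ a +ᶜ z *ᶜ w) (ofℤ a)) ⟩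
        2ℚ * (norm (ofℤ a +ᶜ z *ᶜ w) + α)        ∎))
    where
    open ≤-Reasoning
    α : ℚ
    α = norm (ofℤ a)
    0≤M+α : 0ℚ ≤ 2ℚ * (M + α)
    0≤M+α = 0≤* 0≤2 (0≤+ 0≤M (0≤norm (ofℤ a)))
    cancel : ∀ a x → a +ᶜ x -ᶜ a ≡ x
    cancel = solve-∀ gaussACR

  -- 1 + θ = (N + i) / (N - i)
  record Rotation (N : ℕ) : Set where
    field
      η        : ℚ
      0≤η      : 0ℚ ≤ η
      η≤1      : η ≤ 1ℚ
      η*N      : η * fromℕ N ≡ 1ℚ
      θ θ⁻¹    : Gauss
      θ⁻¹*θ    : θ⁻¹ *ᶜ θ ≡ 1ᶜ
      norm-θ   : norm θ ≤ 4ℚ * η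
      norm-θ⁻¹ : norm θ⁻¹ ≤ fromℕ N
      unit     : modulus² (1ᶜ +ᶜ θ) ≡ 1ℚ

  rotation : ∀ n → Rotation (suc n)
  rotation n = record
    { η = η ; 0≤η = 0≤η ; η≤1 = subst₂ _≤_ (*-identityʳ η) η*N (*-monoˡ η 0≤η 1≤Nq) ; η*N = η*N ; θ = θ ; θ⁻¹ = θ⁻¹
    ; θ⁻¹*θ = θ⁻¹*θ
    ; norm-θ = begin
        norm θ                              ≡⟨ trans (sym (*-identityʳ (norm θ))) (cong (norm θ *_) (sym η*N)) ⟩
        norm θ * (η * Nq)                   ≡⟨ regroup (norm θ) η Nq ⟩
        (½ * Nq) * norm θ * (2ℚ * η)        ≤⟨ *-monoʳ (2ℚ * η) (0≤* 0≤2 0≤η) (begin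
            (½ * Nq) * norm θ               ≤⟨ *-monoʳ (norm θ) (0≤norm θ) (q≤p+q (½ * Nq) 0≤½) ⟩
            (½ + ½ * Nq) * norm θ           ≡⟨ cong (_* norm θ) norm-θ⁻¹≡ ⟨
            norm θ⁻¹ * norm θ               ≤⟨ norm-inv≤ θ⁻¹ θ θ⁻¹*θ ⟩
            2ℚ                              ∎) ⟩
        2ℚ * (2ℚ * η)                       ≡⟨ *-assoc 2ℚ 2ℚ η ⟨
        4ℚ * η                              ∎
    ; norm-θ⁻¹ = begin
        norm θ⁻¹                            ≡⟨ norm-θ⁻¹≡ ⟩
        ½ + ½ * Nq                          ≤⟨ +-monoˡ-≤ (½ * Nq) (subst (_≤ ½ * Nq) (*-identityʳ ½) (*-monoˡ ½ 0≤½ 1≤Nq)) ⟩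
        ½ * Nq + ½ * Nq                     ≡⟨ halves Nq ⟩
        Nq                                  ∎
    ; unit = begin-equality
        modulus² (1ᶜ +ᶜ θ)                                    ≡⟨ *-identityʳ _ ⟨
        modulus² (1ᶜ +ᶜ θ) * 1ℚ                               ≡⟨ cong (modulus² (1ᶜ +ᶜ θ) *_) mm≡1 ⟨
        modulus² (1ᶜ +ᶜ θ) * (modulus² θ⁻¹ * modulus² θ)      ≡⟨ *-assoc (modulus² (1ᶜ +ᶜ θ)) (modulus² θ⁻¹) (modulus² θ) ⟨
        modulus² (1ᶜ +ᶜ θ) * modulus² θ⁻¹ * modulus² θ        ≡⟨ cong (_* modulus² θ) (modulus²-* (1ᶜ +ᶜ θ) θ⁻¹) ⟨
        modulus² ((1ᶜ +ᶜ θ) *ᶜ θ⁻¹) * modulus² θ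
          ≡⟨ cong (λ t → modulus² t * modulus² θ) (trans (expand θ θ⁻¹) (cong (θ⁻¹ +ᶜ_) θ⁻¹*θ)) ⟩
        modulus² (θ⁻¹ +ᶜ 1ᶜ) * modulus² θ                     ≡⟨ cong (_* modulus² θ) (reflected (½ * Nq)) ⟩
        modulus² θ⁻¹ * modulus² θ                             ≡⟨ mm≡1 ⟩
        1ℚ                                                    ∎
    }
    where
    open ≤-Reasoning
    Nq η : ℚ
    Nq = fromℕ (suc n)
    1≤Nq : 1ℚ ≤ Nq
    1≤Nq = 1≤fromℕ n
    0<Nq : 0ℚ < Nq
    0<Nq = <-≤-trans (positive⁻¹ 1ℚ) 1≤Nq
    instance
      Nq-pos : Positive Nq
      Nq-pos = positive 0<Nq
      Nq-nz : NonZero Nq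
      Nq-nz = pos⇒nonZero Nq
    η = 1/ Nq
    0≤η : 0ℚ ≤ η
    0≤η = <⇒≤ (positive⁻¹ η {{1/pos⇒pos Nq}})
    η*N : η * Nq ≡ 1ℚ
    η*N = *-inverseˡ Nq
    θ⁻¹ θ : Gauss
    -- θ = 2 i / (N - i), so its inverse is (N - i) / (2 i) = - 1/2 - (N/2) i.
    θ⁻¹ = (- ½) ⊹ (- (½ * Nq))
    θ = invᶜ θ⁻¹
    norm-θ⁻¹≡ : norm θ⁻¹ ≡ ½ + ½ * Nq
    norm-θ⁻¹≡ = cong (_+_ ½) (trans (∣-p∣≡∣p∣ (½ * Nq)) (0≤p⇒∣p∣≡p (0≤* 0≤½ (<⇒≤ 0<Nq))))
    θ⁻¹*θ : θ⁻¹ *ᶜ θ ≡ 1ᶜ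
    θ⁻¹*θ = *-invᶜ θ⁻¹ (subst (0ℚ <_) (sym norm-θ⁻¹≡) (<-≤-trans (positive⁻¹ ½) (p≤p+q ½ (0≤* 0≤½ (<⇒≤ 0<Nq)))))
    mm≡1 : modulus² θ⁻¹ * modulus² θ ≡ 1ℚ
    mm≡1 = trans (sym (modulus²-* θ⁻¹ θ)) (cong modulus² θ⁻¹*θ)
    expand : ∀ t s → (1ᶜ +ᶜ t) *ᶜ s ≡ s +ᶜ s *ᶜ t
    expand = solve-∀ gaussACR
    -- Adding 1 reflects θ⁻¹ in the imaginary axis. So (1 + θ) θ⁻¹ = θ⁻¹ + 1 has the same modulus as
    -- θ⁻¹, and |1 + θ| = 1.
    reflected : ∀ q → modulus² (((- ½) ⊹ (- q)) +ᶜ 1ᶜ) ≡ modulus² ((- ½) ⊹ (- q))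
    reflected q = cong (λ t → ½ * ½ + t * t) (+-identityʳ (- q))
    regroup : ∀ t η n → t * (η * n) ≡ (½ * n) * t * (2ℚ * η)
    regroup = solve 3 (λ t η n → t :* (η :* n) := (con ½ :* n) :* t :* (con 2ℚ :* η)) refl
      where open +-*-Solver
    halves : ∀ n → ½ * n + ½ * n ≡ n
    halves = solve 1 (λ n → con ½ :* n :+ con ½ :* n := n) refl
      where open +-*-Solver

-- Averages of 1/g over circles

module CircleAverages where

  open PolynomialEvaluation
  open GaussianRationals
  open PolynomialsOverℚi
  open import Data.Empty using (⊥-elim)
  open import Data.Nat.Base as ℕ using (ℕ; zero; suc)
  import Data.Nat.Properties as ℕ
  open import Data.Rational.Base
  open import Data.Rational.Properties
  open import Data.Rational.Solver using (module +-*-Solver)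
  open import Relation.Binary.PropositionalEquality
  open import Relation.Nullary using (yes; no)
  open import Relation.Nullary.Decidable using (from-no)
  open import Tactic.RingSolver using (solve-∀)

  inv-difference : ∀ a b x y → a *ᶜ x ≡ 1ᶜ → b *ᶜ y ≡ 1ᶜ → y -ᶜ x ≡ (a -ᶜ b) *ᶜ (x *ᶜ y)
  inv-difference a b x y ax by = sym (trans (expand a b x y) (trans (cong₂ (λ s t → s *ᶜ y -ᶜ t *ᶜ x) ax by) (simplify x y)))
    where
    expand : ∀ a b x y → (a -ᶜ b) *ᶜ (x *ᶜ y) ≡ a *ᶜ x *ᶜ y -ᶜ b *ᶜ y *ᶜ x
    expand = solve-∀ gaussACR
    simplify : ∀ x y → 1ᶜ *ᶜ y -ᶜ 1ᶜ *ᶜ x ≡ y -ᶜ x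
    simplify = solve-∀ gaussACR

  -- The steps z ↦ z (1 + u) and z ↦ z (1 + θ) change h = 1 / g by z u h′(z)
  -- and z θ h′(z) up to second order, so one difference is u / θ times the other.
  two-step-difference : ∀ g z u θ θ⁻¹ h h₁ h₂ → let z₁ = z *ᶜ (1ᶜ +ᶜ u); z₂ = z *ᶜ (1ᶜ +ᶜ θ) in
    θ⁻¹ *ᶜ θ ≡ 1ᶜ → evᶜ g z *ᶜ h ≡ 1ᶜ → evᶜ g z₁ *ᶜ h₁ ≡ 1ᶜ → evᶜ g z₂ *ᶜ h₂ ≡ 1ᶜ →
    h₁ -ᶜ h -ᶜ θ⁻¹ *ᶜ u *ᶜ (h₂ -ᶜ h) ≡
    -ᶜ (z *ᶜ z *ᶜ (u *ᶜ (u -ᶜ θ)) *ᶜ (h *ᶜ h₁ *ᶜ (Δ² g z z₁ z₂ -ᶜ Δ g z z₂ *ᶜ Δ g z₂ z₁ *ᶜ h₂)))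
  two-step-difference g z u θ θ⁻¹ h h₁ h₂ θθ e e₁ e₂ = begin
    h₁ -ᶜ h -ᶜ θ⁻¹ *ᶜ u *ᶜ (h₂ -ᶜ h)
      ≡⟨ cong₂ (λ s t → s -ᶜ θ⁻¹ *ᶜ u *ᶜ t)
           (trans (inv-difference (evᶜ g z) (evᶜ g z₁) h h₁ e e₁) (cong (_*ᶜ (h *ᶜ h₁)) (Δ-eq g z z₁)))
           (trans (inv-difference (evᶜ g z) (evᶜ g z₂) h h₂ e e₂) (cong (_*ᶜ (h *ᶜ h₂)) (Δ-eq g z z₂))) ⟩
    (z -ᶜ z₁) *ᶜ p₁ *ᶜ (h *ᶜ h₁) -ᶜ θ⁻¹ *ᶜ u *ᶜ ((z -ᶜ z₂) *ᶜ p₂ *ᶜ (h *ᶜ h₂))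
      ≡⟨ step₁ z u θ θ⁻¹ p₁ p₂ h h₁ h₂ ⟩
    θ⁻¹ *ᶜ θ *ᶜ (u *ᶜ z *ᶜ p₂ *ᶜ (h *ᶜ h₂)) -ᶜ z *ᶜ u *ᶜ p₁ *ᶜ (h *ᶜ h₁)
      ≡⟨ cong (λ s → s *ᶜ (u *ᶜ z *ᶜ p₂ *ᶜ (h *ᶜ h₂)) -ᶜ z *ᶜ u *ᶜ p₁ *ᶜ (h *ᶜ h₁)) θθ ⟩
    1ᶜ *ᶜ (u *ᶜ z *ᶜ p₂ *ᶜ (h *ᶜ h₂)) -ᶜ z *ᶜ u *ᶜ p₁ *ᶜ (h *ᶜ h₁)
      ≡⟨ step₂ z u p₁ p₂ h h₁ h₂ ⟩
    -ᶜ (z *ᶜ u *ᶜ h *ᶜ ((p₁ -ᶜ p₂) *ᶜ h₁ +ᶜ p₂ *ᶜ (h₁ -ᶜ h₂)))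
      ≡⟨ cong₂ (λ s t → -ᶜ (z *ᶜ u *ᶜ h *ᶜ (s *ᶜ h₁ +ᶜ p₂ *ᶜ t))) (Δ²-eq g z z₁ z₂)
           (trans (inv-difference (evᶜ g z₂) (evᶜ g z₁) h₂ h₁ e₂ e₁) (cong (_*ᶜ (h₂ *ᶜ h₁)) (Δ-eq g z₂ z₁))) ⟩
    -ᶜ (z *ᶜ u *ᶜ h *ᶜ ((z₁ -ᶜ z₂) *ᶜ q *ᶜ h₁ +ᶜ p₂ *ᶜ ((z₂ -ᶜ z₁) *ᶜ p₃ *ᶜ (h₂ *ᶜ h₁))))
      ≡⟨ step₃ z u θ p₂ p₃ q h h₁ h₂ ⟩
    -ᶜ (z *ᶜ z *ᶜ (u *ᶜ (u -ᶜ θ)) *ᶜ (h *ᶜ h₁ *ᶜ (q -ᶜ p₂ *ᶜ p₃ *ᶜ h₂))) ∎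
    where
    open ≡-Reasoning
    z₁ z₂ p₁ p₂ p₃ q : Gauss
    z₁ = z *ᶜ (1ᶜ +ᶜ u)
    z₂ = z *ᶜ (1ᶜ +ᶜ θ)
    p₁ = Δ g z z₁
    p₂ = Δ g z z₂
    p₃ = Δ g z₂ z₁
    q = Δ² g z z₁ z₂
    step₁ : ∀ z u θ θ⁻¹ p₁ p₂ h h₁ h₂ →
      (z -ᶜ z *ᶜ (1ᶜ +ᶜ u)) *ᶜ p₁ *ᶜ (h *ᶜ h₁) -ᶜ θ⁻¹ *ᶜ u *ᶜ ((z -ᶜ z *ᶜ (1ᶜ +ᶜ θ)) *ᶜ p₂ *ᶜ (h *ᶜ h₂))
      ≡ θ⁻¹ *ᶜ θ *ᶜ (u *ᶜ z *ᶜ p₂ *ᶜ (h *ᶜ h₂)) -ᶜ z *ᶜ u *ᶜ p₁ *ᶜ (h *ᶜ h₁)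
    step₁ = solve-∀ gaussACR
    step₂ : ∀ z u p₁ p₂ h h₁ h₂ →
      1ᶜ *ᶜ (u *ᶜ z *ᶜ p₂ *ᶜ (h *ᶜ h₂)) -ᶜ z *ᶜ u *ᶜ p₁ *ᶜ (h *ᶜ h₁)
      ≡ -ᶜ (z *ᶜ u *ᶜ h *ᶜ ((p₁ -ᶜ p₂) *ᶜ h₁ +ᶜ p₂ *ᶜ (h₁ -ᶜ h₂)))
    step₂ = solve-∀ gaussACR
    step₃ : ∀ z u θ p₂ p₃ q h h₁ h₂ →
      -ᶜ (z *ᶜ u *ᶜ h *ᶜ ((z *ᶜ (1ᶜ +ᶜ u) -ᶜ z *ᶜ (1ᶜ +ᶜ θ)) *ᶜ q *ᶜ h₁
         +ᶜ p₂ *ᶜ ((z *ᶜ (1ᶜ +ᶜ θ) -ᶜ z *ᶜ (1ᶜ +ᶜ u)) *ᶜ p₃ *ᶜ (h₂ *ᶜ h₁))))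
      ≡ -ᶜ (z *ᶜ z *ᶜ (u *ᶜ (u -ᶜ θ)) *ᶜ (h *ᶜ h₁ *ᶜ (q -ᶜ p₂ *ᶜ p₃ *ᶜ h₂)))
    step₃ = solve-∀ gaussACR

  norm-ofℚ-* : ∀ q y → 0ℚ ≤ q → norm (ofℚ q *ᶜ y) ≡ q * norm y
  norm-ofℚ-* q y 0≤q = trans (norm-scale q 0≤q y) (cong (_* norm y) (norm-ofℚ q 0≤q))

  unit-norm≤2 : ∀ x → modulus² x ≡ 1ℚ → norm x ≤ 2ℚ
  unit-norm≤2 x m≡1 with norm x ≤? 2ℚ
  ... | yes le = le
  ... | no ¬le = ⊥-elim (from-no (4ℚ ≤? 2ℚ) (begin
    2ℚ * 2ℚ             ≤⟨ *-mono-0≤ 0≤2 (<⇒≤ (≰⇒> ¬le)) 0≤2 (<⇒≤ (≰⇒> ¬le)) ⟩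
    norm x * norm x     ≤⟨ norm²≤2modulus² x ⟩
    2ℚ * modulus² x     ≡⟨ cong (2ℚ *_) m≡1 ⟩
    2ℚ                  ∎))
    where open ≤-Reasoning

  unit-norm≥1 : ∀ x → modulus² x ≡ 1ℚ → 1ℚ ≤ norm x
  unit-norm≥1 x m≡1 with 1ℚ ≤? norm x
  ... | yes le = le
  ... | no ¬le = begin
    1ℚ                  ≡⟨ m≡1 ⟨
    modulus² x          ≤⟨ modulus²≤norm² x ⟩
    norm x * norm x     ≤⟨ *-monoˡ (norm x) (0≤norm x) (<⇒≤ (≰⇒> ¬le)) ⟩
    norm x * 1ℚ         ≡⟨ *-identityʳ (norm x) ⟩
    norm x              ∎
    where open ≤-Reasoning

  -- A polar grid R (1 - η)ʲ (1 + θ)ᵃ with η = 1/N: j moves towards the centre, a along a circle.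
  -- Coordinates stay rational, at the price that the walk along a circle does not close up.
  module Grid (R : ℚ) (0≤R : 0ℚ ≤ R) {N : ℕ} (rot : Rotation N) where

    open Rotation rot

    rot^ : ℕ → Gauss
    rot^ zero    = 1ᶜ
    rot^ (suc a) = rot^ a *ᶜ (1ᶜ +ᶜ θ)

    shrink^ : ℕ → ℚ
    shrink^ zero    = 1ℚ
    shrink^ (suc j) = shrink^ j * (1ℚ - η)

    pt : ℕ → ℕ → Gauss
    pt j a = ofℚ (R * shrink^ j) *ᶜ rot^ a

    u : Gauss
    u = ofℚ (- η)

    0≤1-η : 0ℚ ≤ 1ℚ - η
    0≤1-η = subst (_≤ 1ℚ - η) (+-inverseʳ η) (+-monoˡ-≤ (- η) η≤1)

    0≤shrink^ : ∀ j → 0ℚ ≤ shrink^ j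
    0≤shrink^ zero    = 0≤1
    0≤shrink^ (suc j) = 0≤* (0≤shrink^ j) 0≤1-η

    0≤n*η : ∀ n → 0ℚ ≤ fromℕ n * η
    0≤n*η n = 0≤* (0≤fromℕ n) 0≤η

    -- From (1 - η) (1 + (n + 1) η) ≤ 1 + n η. A Bernoulli-type substitute for exponential decay.
    shrink-decay : ∀ n → shrink^ n * (1ℚ + fromℕ n * η) ≤ 1ℚ
    shrink-decay zero    = ≤-reflexive (trans (*-identityˡ _) (trans (cong (_+_ 1ℚ) (*-zeroˡ η)) (+-identityʳ 1ℚ)))
    shrink-decay (suc n) = begin
      shrink^ n * (1ℚ - η) * (1ℚ + fromℕ (suc n) * η)
        ≡⟨ cong (λ t → shrink^ n * (1ℚ - η) * (1ℚ + t * η)) (fromℕ-suc n) ⟩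
      shrink^ n * (1ℚ - η) * (1ℚ + (1ℚ + fromℕ n) * η)
        ≤⟨ p≤p+q _ (0≤* (0≤shrink^ n) (0≤* (0≤+ 0≤1 (0≤fromℕ n)) (0≤square η))) ⟩
      shrink^ n * (1ℚ - η) * (1ℚ + (1ℚ + fromℕ n) * η) + shrink^ n * ((1ℚ + fromℕ n) * (η * η))
        ≡⟨ solve 3 (λ s η n → s :* (con 1ℚ :- η) :* (con 1ℚ :+ (con 1ℚ :+ n) :* η) :+ s :* ((con 1ℚ :+ n) :* (η :* η))
             := s :* (con 1ℚ :+ n :* η)) refl (shrink^ n) η (fromℕ n) ⟩
      shrink^ n * (1ℚ + fromℕ n * η)
        ≤⟨ shrink-decay n ⟩
      1ℚ ∎
      where
      open ≤-Reasoning
      open +-*-Solver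

    shrink≤1 : ∀ n → shrink^ n ≤ 1ℚ
    shrink≤1 n = ≤-trans (subst (_≤ shrink^ n * (1ℚ + fromℕ n * η)) (*-identityʳ (shrink^ n))
      (*-monoˡ (shrink^ n) (0≤shrink^ n) (p≤p+q 1ℚ (0≤n*η n)))) (shrink-decay n)

    rot-unit : ∀ a → modulus² (rot^ a) ≡ 1ℚ
    rot-unit zero    = refl
    rot-unit (suc a) = trans (modulus²-* (rot^ a) (1ᶜ +ᶜ θ)) (cong₂ _*_ (rot-unit a) unit)

    0≤R*shrink : ∀ j → 0ℚ ≤ R * shrink^ j
    0≤R*shrink j = 0≤* 0≤R (0≤shrink^ j)

    norm-pt : ∀ j a → norm (pt j a) ≡ R * shrink^ j * norm (rot^ a)
    norm-pt j a = norm-ofℚ-* (R * shrink^ j) (rot^ a) (0≤R*shrink j)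

    norm-pt≤ : ∀ j a → norm (pt j a) ≤ R * shrink^ j * 2ℚ
    norm-pt≤ j a = subst (_≤ R * shrink^ j * 2ℚ) (sym (norm-pt j a))
      (*-monoˡ (R * shrink^ j) (0≤R*shrink j) (unit-norm≤2 (rot^ a) (rot-unit a)))

    norm-pt≤2R : ∀ j a → norm (pt j a) ≤ R * 2ℚ
    norm-pt≤2R j a = ≤-trans (norm-pt≤ j a) (*-monoʳ 2ℚ 0≤2 (subst (R * shrink^ j ≤_) (*-identityʳ R) (*-monoˡ R 0≤R (shrink≤1 j))))

    norm-pt₀≥ : ∀ a → R ≤ norm (pt 0 a)
    norm-pt₀≥ a = subst₂ _≤_ (trans (*-identityʳ (R * 1ℚ)) (*-identityʳ R)) (sym (norm-pt 0 a))
      (*-monoˡ (R * 1ℚ) (0≤R*shrink 0) (unit-norm≥1 (rot^ a) (rot-unit a)))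

    pt-radial : ∀ j a → pt (suc j) a ≡ pt j a *ᶜ (1ᶜ +ᶜ u)
    pt-radial j a = trans (cong (_*ᶜ rot^ a) (trans (cong ofℚ (sym (*-assoc R (shrink^ j) (1ℚ - η)))) (ofℚ-* (R * shrink^ j) (1ℚ - η))))
      (swap (ofℚ (R * shrink^ j)) (ofℚ (1ℚ - η)) (rot^ a))
      where
      swap : ∀ r s w → r *ᶜ s *ᶜ w ≡ r *ᶜ w *ᶜ s
      swap = solve-∀ gaussACR

    pt-angular : ∀ j a → pt j (suc a) ≡ pt j a *ᶜ (1ᶜ +ᶜ θ)
    pt-angular j a = sym (*ᶜ-assoc (ofℚ (R * shrink^ j)) (rot^ a) (1ᶜ +ᶜ θ))

    norm-u : norm u ≡ η
    norm-u = trans (norm-neg (ofℚ η)) (norm-ofℚ η 0≤η)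

    norm-u-θ≤ : norm (u -ᶜ θ) ≤ (1ℚ + 4ℚ) * η
    norm-u-θ≤ = ≤-trans (norm-−≤ u θ) (≤-trans (+-mono-≤ (≤-reflexive norm-u) norm-θ)
      (≤-reflexive (trans (cong (_+ 4ℚ * η) (sym (*-identityˡ η))) (sym (*-distribʳ-+ η 1ℚ 4ℚ)))))

    norm-θ⁻¹u≤1 : norm (θ⁻¹ *ᶜ u) ≤ 1ℚ
    norm-θ⁻¹u≤1 = ≤-trans (norm-*≤-mono θ⁻¹ u norm-θ⁻¹ (≤-reflexive norm-u)) (≤-reflexive (trans (*-comm (fromℕ N) η) η*N))

    -- Under the assumption that |g| ≥ m on a finite part of the grid, the sum
    -- of 1/g over a circle of the grid hardly depends on the circle.
    module Telescope (g : Poly) (m μ : ℚ) (0<m : 0ℚ < m) (2≤mμ : 2ℚ ≤ m * μ) (J A : ℕ)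
      (large : ∀ j a → j ℕ.≤ J → a ℕ.≤ A → m ≤ norm (evᶜ g (pt j a))) where

      B D₁ D₂ E : ℚ
      B = R * 2ℚ
      D₁ = boundΔ g B
      D₂ = boundΔ² g B
      E = B * B * (1ℚ + 4ℚ) * (μ * μ * (D₂ + D₁ * D₁ * μ))

      inv-g : Gauss → Gauss
      inv-g z = invᶜ (evᶜ g z)

      inv-g-inverse : ∀ z → m ≤ norm (evᶜ g z) → evᶜ g z *ᶜ inv-g z ≡ 1ᶜ
      inv-g-inverse z le = *-invᶜ (evᶜ g z) (<-≤-trans 0<m le)

      norm-inv-g≤ : ∀ z → m ≤ norm (evᶜ g z) → norm (inv-g z) ≤ μ
      norm-inv-g≤ z le = *-cancelˡ-≤-pos m {{positive 0<m}} (begin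
        m * norm (inv-g z)                  ≤⟨ *-monoʳ (norm (inv-g z)) (0≤norm (inv-g z)) le ⟩
        norm (evᶜ g z) * norm (inv-g z)     ≤⟨ norm-inv≤ (evᶜ g z) (inv-g z) (inv-g-inverse z le) ⟩
        2ℚ                                  ≤⟨ 2≤mμ ⟩
        m * μ                               ∎)
        where open ≤-Reasoning

      H : ℕ → ℕ → Gauss
      H j a = inv-g (pt j a)

      0≤B : 0ℚ ≤ B
      0≤B = 0≤* 0≤R 0≤2

      τ : Gauss
      τ = θ⁻¹ *ᶜ u

      -- The right side of `two-step-difference` has the factor u (u - θ), of order η²; the
      -- remaining factors are bounded through |g| ≥ m and the bounds on divided differences.
      local : ∀ j a → suc j ℕ.≤ J → suc a ℕ.≤ A →
        norm (H (suc j) a -ᶜ H j a -ᶜ τ *ᶜ (H j (suc a) -ᶜ H j a)) ≤ E * (η * η)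
      local j a j<J a<A = begin
        norm (H (suc j) a -ᶜ H j a -ᶜ τ *ᶜ (H j (suc a) -ᶜ H j a))
          ≡⟨ cong norm (two-step-difference g z u θ θ⁻¹ (H j a) (H (suc j) a) (H j (suc a)) θ⁻¹*θ
               (inv-g-inverse z l₀) (subst (λ y → evᶜ g y *ᶜ H (suc j) a ≡ 1ᶜ) (pt-radial j a) (inv-g-inverse _ l₁))
               (subst (λ y → evᶜ g y *ᶜ H j (suc a) ≡ 1ᶜ) (pt-angular j a) (inv-g-inverse _ l₂))) ⟩
        norm (-ᶜ X)
          ≡⟨ norm-neg X ⟩
        norm X
          ≤⟨ norm-*≤-mono (z *ᶜ z *ᶜ (u *ᶜ (u -ᶜ θ))) (H j a *ᶜ H (suc j) a *ᶜ (q -ᶜ p₂ *ᶜ p₃ *ᶜ H j (suc a)))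
               (norm-*≤-mono (z *ᶜ z) (u *ᶜ (u -ᶜ θ)) (norm-*≤-mono z z bz bz)
                 (norm-*≤-mono u (u -ᶜ θ) (≤-reflexive norm-u) norm-u-θ≤))
               (norm-*≤-mono (H j a *ᶜ H (suc j) a) (q -ᶜ p₂ *ᶜ p₃ *ᶜ H j (suc a))
                 (norm-*≤-mono (H j a) (H (suc j) a) (norm-inv-g≤ z l₀) (norm-inv-g≤ _ l₁))
                 (≤-trans (norm-−≤ q (p₂ *ᶜ p₃ *ᶜ H j (suc a))) (+-mono-≤ (norm-Δ²≤ g z z₁ z₂ bz bz₁ bz₂)
                   (norm-*≤-mono (p₂ *ᶜ p₃) (H j (suc a)) (norm-*≤-mono p₂ p₃ (norm-Δ≤ g z z₂ bz bz₂) (norm-Δ≤ g z₂ z₁ bz₂ bz₁))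
                     (norm-inv-g≤ _ l₂))))) ⟩
        B * B * (η * ((1ℚ + 4ℚ) * η)) * (μ * μ * (D₂ + D₁ * D₁ * μ))
          ≡⟨ solve 3 (λ b η w → b :* (η :* (con (1ℚ + 4ℚ) :* η)) :* w := b :* con (1ℚ + 4ℚ) :* w :* (η :* η)) refl
               (B * B) η (μ * μ * (D₂ + D₁ * D₁ * μ)) ⟩
        E * (η * η) ∎
        where
        open ≤-Reasoning
        open +-*-Solver
        z z₁ z₂ q p₂ p₃ X : Gauss
        z = pt j a
        z₁ = z *ᶜ (1ᶜ +ᶜ u)
        z₂ = z *ᶜ (1ᶜ +ᶜ θ)
        q = Δ² g z z₁ z₂
        p₂ = Δ g z z₂
        p₃ = Δ g z₂ z₁
        X = z *ᶜ z *ᶜ (u *ᶜ (u -ᶜ θ)) *ᶜ (H j a *ᶜ H (suc j) a *ᶜ (q -ᶜ p₂ *ᶜ p₃ *ᶜ H j (suc a)))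
        bz : norm z ≤ B
        bz = norm-pt≤2R j a
        bz₁ : norm z₁ ≤ B
        bz₁ = subst (λ y → norm y ≤ B) (pt-radial j a) (norm-pt≤2R (suc j) a)
        bz₂ : norm z₂ ≤ B
        bz₂ = subst (λ y → norm y ≤ B) (pt-angular j a) (norm-pt≤2R j (suc a))
        l₀ : m ≤ norm (evᶜ g z)
        l₀ = large j a (ℕ.<⇒≤ j<J) (ℕ.<⇒≤ a<A)
        l₁ : m ≤ norm (evᶜ g (pt (suc j) a))
        l₁ = large (suc j) a j<J (ℕ.<⇒≤ a<A)
        l₂ : m ≤ norm (evᶜ g (pt j (suc a)))
        l₂ = large j (suc a) (ℕ.<⇒≤ j<J) a<A

      S : ℕ → ℕ → Gauss
      S j zero    = 0ᶜ
      S j (suc a) = S j a +ᶜ H j a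

      -- Along a circle the angular differences telescope, so only the two end values and the
      -- accumulated errors E η² remain.
      circle-step : ∀ j → suc j ℕ.≤ J → ∀ a → a ℕ.≤ A →
        norm (S (suc j) a -ᶜ S j a -ᶜ τ *ᶜ (H j a -ᶜ H j 0)) ≤ fromℕ a * (E * (η * η))
      circle-step j j<J zero    _   = ≤-reflexive (trans (cong norm (collapse τ (H j 0))) (sym (*-zeroˡ (E * (η * η)))))
        where
        collapse : ∀ t h → 0ᶜ -ᶜ 0ᶜ -ᶜ t *ᶜ (h -ᶜ h) ≡ 0ᶜ
        collapse = solve-∀ gaussACR
      circle-step j j<J (suc a) a<A = begin
        norm (S (suc j) a +ᶜ H (suc j) a -ᶜ (S j a +ᶜ H j a) -ᶜ τ *ᶜ (H j (suc a) -ᶜ H j 0))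
          ≡⟨ cong norm (regroup (S (suc j) a) (H (suc j) a) (S j a) (H j a) τ (H j (suc a)) (H j 0)) ⟩
        norm (S (suc j) a -ᶜ S j a -ᶜ τ *ᶜ (H j a -ᶜ H j 0) +ᶜ (H (suc j) a -ᶜ H j a -ᶜ τ *ᶜ (H j (suc a) -ᶜ H j a)))
          ≤⟨ norm-+≤-mono (S (suc j) a -ᶜ S j a -ᶜ τ *ᶜ (H j a -ᶜ H j 0)) _
               (circle-step j j<J a (ℕ.<⇒≤ a<A)) (local j a j<J a<A) ⟩
        fromℕ a * (E * (η * η)) + E * (η * η)
          ≡⟨ solve 2 (λ n e → n :* e :+ e := (con 1ℚ :+ n) :* e) refl (fromℕ a) (E * (η * η)) ⟩
        (1ℚ + fromℕ a) * (E * (η * η))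
          ≡⟨ cong (_* (E * (η * η))) (fromℕ-suc a) ⟨
        fromℕ (suc a) * (E * (η * η)) ∎
        where
        open ≤-Reasoning
        open +-*-Solver
        regroup : ∀ s h s′ h′ t k k₀ → s +ᶜ h -ᶜ (s′ +ᶜ h′) -ᶜ t *ᶜ (k -ᶜ k₀)
          ≡ s -ᶜ s′ -ᶜ t *ᶜ (h′ -ᶜ k₀) +ᶜ (h -ᶜ h′ -ᶜ t *ᶜ (k -ᶜ h′))
        regroup = solve-∀ gaussACR

      W : ℚ
      W = fromℕ A * (E * (η * η)) + 2ℚ * μ

      circle-difference : ∀ j → suc j ℕ.≤ J → norm (S (suc j) A -ᶜ S j A) ≤ W
      circle-difference j j<J = ≤-trans (norm≤norm-−+ (S (suc j) A -ᶜ S j A) (τ *ᶜ (H j A -ᶜ H j 0)))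
        (+-mono-≤ (circle-step j j<J A ℕ.≤-refl) (begin
          norm (τ *ᶜ (H j A -ᶜ H j 0))
            ≤⟨ norm-*≤-mono τ (H j A -ᶜ H j 0) norm-θ⁻¹u≤1 (≤-trans (norm-−≤ (H j A) (H j 0))
                 (+-mono-≤ (norm-inv-g≤ _ (large j A (ℕ.<⇒≤ j<J) ℕ.≤-refl)) (norm-inv-g≤ _ (large j 0 (ℕ.<⇒≤ j<J) ℕ.z≤n)))) ⟩
          1ℚ * (μ + μ)
            ≡⟨ solve 1 (λ μ → con 1ℚ :* (μ :+ μ) := con 2ℚ :* μ) refl μ ⟩
          2ℚ * μ ∎))
        where
        open ≤-Reasoning
        open +-*-Solver

      radial-difference : ∀ j → j ℕ.≤ J → norm (S j A -ᶜ S 0 A) ≤ fromℕ j * W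
      radial-difference zero    _   = ≤-reflexive (trans (cong norm (-ᶜ-inverseʳ (S 0 A))) (sym (*-zeroˡ W)))
      radial-difference (suc j) j<J = begin
        norm (S (suc j) A -ᶜ S 0 A)
          ≡⟨ cong norm (insert (S (suc j) A) (S j A) (S 0 A)) ⟩
        norm (S (suc j) A -ᶜ S j A +ᶜ (S j A -ᶜ S 0 A))
          ≤⟨ norm-+≤-mono (S (suc j) A -ᶜ S j A) (S j A -ᶜ S 0 A) (circle-difference j j<J) (radial-difference j (ℕ.<⇒≤ j<J)) ⟩
        W + fromℕ j * W
          ≡⟨ solve 2 (λ w n → w :+ n :* w := (con 1ℚ :+ n) :* w) refl W (fromℕ j) ⟩
        (1ℚ + fromℕ j) * W
          ≡⟨ cong (_* W) (fromℕ-suc j) ⟨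
        fromℕ (suc j) * W ∎
        where
        open ≤-Reasoning
        open +-*-Solver
        insert : ∀ a b c → a -ᶜ c ≡ a -ᶜ b +ᶜ (b -ᶜ c)
        insert = solve-∀ gaussACR

      circle-sum≤ : ∀ j {ν} → (∀ a → a ℕ.≤ A → norm (H j a) ≤ ν) → ∀ a → a ℕ.≤ A → norm (S j a) ≤ fromℕ a * ν
      circle-sum≤ j {ν} h zero    _   = ≤-reflexive (sym (*-zeroˡ ν))
      circle-sum≤ j {ν} h (suc a) a<A = ≤-trans (norm-+≤-mono (S j a) (H j a) (circle-sum≤ j h a (ℕ.<⇒≤ a<A)) (h a (ℕ.<⇒≤ a<A)))
        (≤-reflexive (trans (solve 2 (λ n v → n :* v :+ v := (con 1ℚ :+ n) :* v) refl (fromℕ a) ν) (cong (_* ν) (sym (fromℕ-suc a)))))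
        where open +-*-Solver

      centre-difference : ∀ j h₀ {δ} → (∀ a → a ℕ.≤ A → norm (h₀ -ᶜ H j a) ≤ δ) →
        ∀ a → a ℕ.≤ A → norm (ofℚ (fromℕ a) *ᶜ h₀ -ᶜ S j a) ≤ fromℕ a * δ
      centre-difference j h₀ {δ} h zero    _   = ≤-reflexive (trans (cong norm (collapse h₀)) (sym (*-zeroˡ δ)))
        where
        collapse : ∀ h → 0ᶜ *ᶜ h -ᶜ 0ᶜ ≡ 0ᶜ
        collapse = solve-∀ gaussACR
      centre-difference j h₀ {δ} h (suc a) a<A = begin
        norm (ofℚ (fromℕ (suc a)) *ᶜ h₀ -ᶜ (S j a +ᶜ H j a))
          ≡⟨ cong (λ n → norm (ofℚ n *ᶜ h₀ -ᶜ (S j a +ᶜ H j a))) (fromℕ-suc a) ⟩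
        norm ((1ᶜ +ᶜ ofℚ (fromℕ a)) *ᶜ h₀ -ᶜ (S j a +ᶜ H j a))
          ≡⟨ cong norm (regroup (ofℚ (fromℕ a)) h₀ (S j a) (H j a)) ⟩
        norm (ofℚ (fromℕ a) *ᶜ h₀ -ᶜ S j a +ᶜ (h₀ -ᶜ H j a))
          ≤⟨ norm-+≤-mono (ofℚ (fromℕ a) *ᶜ h₀ -ᶜ S j a) (h₀ -ᶜ H j a) (centre-difference j h₀ h a (ℕ.<⇒≤ a<A)) (h a (ℕ.<⇒≤ a<A)) ⟩
        fromℕ a * δ + δ
          ≡⟨ solve 2 (λ n v → n :* v :+ v := (con 1ℚ :+ n) :* v) refl (fromℕ a) δ ⟩
        (1ℚ + fromℕ a) * δ
          ≡⟨ cong (_* δ) (fromℕ-suc a) ⟨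
        fromℕ (suc a) * δ ∎
        where
        open ≤-Reasoning
        open +-*-Solver
        regroup : ∀ n h s k → (1ᶜ +ᶜ n) *ᶜ h -ᶜ (s +ᶜ k) ≡ n *ᶜ h -ᶜ s +ᶜ (h -ᶜ k)
        regroup = solve-∀ gaussACR

      -- With h₀ = 1 / g(0): the circle J is close to the centre, and on the
      -- circle 0 the function 1 / g is small.
      centre≤ : ∀ h₀ {δ ν} → (∀ a → a ℕ.≤ A → norm (h₀ -ᶜ H J a) ≤ δ) → (∀ a → a ℕ.≤ A → norm (H 0 a) ≤ ν) →
        fromℕ A * norm h₀ ≤ fromℕ A * δ + (fromℕ J * W + fromℕ A * ν)
      centre≤ h₀ {δ} {ν} close small = begin
        fromℕ A * norm h₀
          ≡⟨ norm-ofℚ-* (fromℕ A) h₀ (0≤fromℕ A) ⟨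
        norm (ofℚ (fromℕ A) *ᶜ h₀)
          ≤⟨ norm≤norm-−+ (ofℚ (fromℕ A) *ᶜ h₀) (S J A) ⟩
        norm (ofℚ (fromℕ A) *ᶜ h₀ -ᶜ S J A) + norm (S J A)
          ≤⟨ +-mono-≤ (centre-difference J h₀ close A ℕ.≤-refl) (≤-trans (norm≤norm-−+ (S J A) (S 0 A))
               (+-mono-≤ (radial-difference J ℕ.≤-refl) (circle-sum≤ 0 small A ℕ.≤-refl))) ⟩
        fromℕ A * δ + (fromℕ J * W + fromℕ A * ν) ∎
        where open ≤-Reasoning

-- Small values of g and Newton's method

module ApproximateRoots where

  open PolynomialEvaluation
  open GaussianRationals
  open PolynomialsOverℚi
  open CircleAverages
  open import Data.Empty using (⊥; ⊥-elim)
  open import Data.Integer.Base using (0ℤ)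
  open import Data.List.Base using (_∷_; _∷ʳ_)
  open import Data.Nat.Base as ℕ using (ℕ; zero; suc)
  import Data.Nat.Properties as ℕ
  open import Data.Product.Base using (∃-syntax; Σ-syntax; _×_; _,_; proj₁; proj₂)
  open import Data.Rational.Base
  open import Data.Rational.Properties
  open import Data.Rational.Solver using (module +-*-Solver)
  open import Relation.Binary.PropositionalEquality hiding (J)
  open import Relation.Nullary using (yes; no)
  open import Tactic.RingSolver using (solve-∀)

  centreBound : Poly → ℚ → ℚ → ℚ
  centreBound g R μ = R * 2ℚ * boundΔ g (R * 2ℚ) * (μ * μ)

  stepBound : Poly → ℚ → ℚ → ℚ
  stepBound g R μ = R * 2ℚ * (R * 2ℚ) * (1ℚ + 4ℚ) * (μ * μ * (boundΔ² g (R * 2ℚ) + boundΔ g (R * 2ℚ) * boundΔ g (R * 2ℚ) * μ)) + 2ℚ * μ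

  -- The scale is κ = 1/c: beyond radius R the norm of 1/g is at most κ, whereas at 0 it is at least
  -- 4 κ. K brings the innermost circle close enough to 0, and n makes the accumulated radial error
  -- small.
  module Search (g : Poly) (c κ R m μ : ℚ) (h₀ : Gauss) (0<c : 0ℚ < c) (cκ≡1 : c * κ ≡ 1ℚ) (0≤R : 0ℚ ≤ R)
    (far : ∀ z → R ≤ norm z → 2ℚ * c ≤ norm (evᶜ g z)) (0<m : 0ℚ < m) (2≤mμ : 2ℚ ≤ m * μ)
    (g₀h₀ : evᶜ g 0ᶜ *ᶜ h₀ ≡ 1ᶜ) (h₀≤μ : norm h₀ ≤ μ) (4κ≤h₀ : 4ℚ * κ ≤ norm h₀)
    (K n : ℕ) (K-large : c * centreBound g R μ ≤ fromℕ K) (n-large : c * (fromℕ K * stepBound g R μ) ≤ fromℕ n)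
    (rot : Rotation (suc n)) where

    open ≤-Reasoning
    open +-*-Solver
    open Rotation rot
    open Grid R 0≤R rot

    N A J : ℕ
    N = suc n
    -- N² angular steps turn about N / π times. The K N radial steps shrink the radius by about
    -- exp(- K), estimated by 1 / (1 + K).
    A = N ℕ.* N
    J = K ℕ.* N

    0≤c : 0ℚ ≤ c
    0≤c = <⇒≤ 0<c

    ≤κ : ∀ {t} → c * t ≤ 1ℚ → t ≤ κ
    ≤κ h = *-cancelˡ-≤-pos c {{positive 0<c}} (≤-trans h (≤-reflexive (sym cκ≡1)))

    J*η : fromℕ J * η ≡ fromℕ K
    J*η = trans (cong (_* η) (fromℕ-* K N)) (trans (solve 3 (λ k n e → k :* n :* e := k :* (e :* n)) refl (fromℕ K) (fromℕ N) η)
      (trans (cong (fromℕ K *_) η*N) (*-identityʳ (fromℕ K))))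

    module _ (large : ∀ j a → j ℕ.≤ J → a ℕ.≤ A → m ≤ norm (evᶜ g (pt j a))) where

      open Telescope g m μ 0<m 2≤mμ J A large using (E; W; H; inv-g-inverse; norm-inv-g≤; centre≤)

      -- A η² = 1, so passing to the next circle changes a sum by an amount bounded independently of
      -- N. All J = K N passages cost O(N), against sums of N² terms.
      W≡ : W ≡ stepBound g R μ
      W≡ = cong (_+ 2ℚ * μ) (trans (cong (_* (E * (η * η))) (fromℕ-* N N))
        (trans (solve 3 (λ n e η → n :* n :* (e :* (η :* η)) := e :* ((η :* n) :* (η :* n))) refl (fromℕ N) E η)
          (trans (cong (λ t → E * (t * t)) η*N) (*-identityʳ E))))

      -- The difference of 1/g between z and 0 has the factor z, of norm at most 2 R / (1 + K) on
      -- the innermost circle.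
      close : ∀ a → a ℕ.≤ A → norm (h₀ -ᶜ H J a) ≤ κ
      close a a≤A = ≤κ (begin
        c * norm (h₀ -ᶜ H J a)
          ≡⟨ cong (λ t → c * norm t) (trans (inv-difference (evᶜ g z) (evᶜ g 0ᶜ) (H J a) h₀ (inv-g-inverse z l) g₀h₀)
               (cong (_*ᶜ (H J a *ᶜ h₀)) (Δ-eq g z 0ᶜ))) ⟩
        c * norm ((z -ᶜ 0ᶜ) *ᶜ Δ g z 0ᶜ *ᶜ (H J a *ᶜ h₀))
          ≤⟨ *-monoˡ c 0≤c (norm-*≤-mono ((z -ᶜ 0ᶜ) *ᶜ Δ g z 0ᶜ) (H J a *ᶜ h₀)
               (norm-*≤-mono (z -ᶜ 0ᶜ) (Δ g z 0ᶜ) (subst (λ y → norm y ≤ R * shrink^ J * 2ℚ) (sym (minus-zero z)) (norm-pt≤ J a))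
                 (norm-Δ≤ g z 0ᶜ (norm-pt≤2R J a) (0≤* 0≤R 0≤2)))
               (norm-*≤-mono (H J a) h₀ (norm-inv-g≤ z l) h₀≤μ)) ⟩
        c * (R * shrink^ J * 2ℚ * D₁ * (μ * μ))
          ≡⟨ solve 6 (λ c r s t d w → c :* (r :* s :* t :* d :* w) := s :* (c :* (r :* t :* d :* w))) refl c R (shrink^ J) 2ℚ D₁ (μ * μ) ⟩
        shrink^ J * (c * centreBound g R μ)
          ≤⟨ *-monoˡ (shrink^ J) (0≤shrink^ J) (≤-trans K-large (subst (_≤ 1ℚ + fromℕ J * η) J*η (q≤p+q (fromℕ J * η) 0≤1))) ⟩
        shrink^ J * (1ℚ + fromℕ J * η)
          ≤⟨ shrink-decay J ⟩
        1ℚ ∎)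
        where
        D₁ : ℚ
        D₁ = boundΔ g (R * 2ℚ)
        z : Gauss
        z = pt J a
        l : m ≤ norm (evᶜ g z)
        l = large J a ℕ.≤-refl a≤A
        minus-zero : ∀ z → z -ᶜ 0ᶜ ≡ z
        minus-zero = solve-∀ gaussACR

      small : ∀ a → a ℕ.≤ A → norm (H 0 a) ≤ κ
      small a a≤A = ≤κ (*-cancelˡ-≤-pos 2ℚ (begin
        2ℚ * (c * norm (H 0 a))                     ≡⟨ *-assoc 2ℚ c (norm (H 0 a)) ⟨
        2ℚ * c * norm (H 0 a)                       ≤⟨ *-monoʳ (norm (H 0 a)) (0≤norm (H 0 a)) (far (pt 0 a) (norm-pt₀≥ a)) ⟩
        norm (evᶜ g (pt 0 a)) * norm (H 0 a)        ≤⟨ norm-inv≤ (evᶜ g (pt 0 a)) (H 0 a) (inv-g-inverse (pt 0 a) (large 0 a ℕ.z≤n a≤A)) ⟩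
        2ℚ * 1ℚ                                     ∎))

      -- 4 A ≤ 3 A
      bookkeeping : ∀ A₁ J₁ W₁ N₁ h K₁ S₁ n₁ → 4ℚ * κ ≤ h → 0ℚ ≤ A₁ → A₁ * h ≤ A₁ * κ + (J₁ * W₁ + A₁ * κ) → J₁ ≡ K₁ * N₁ → W₁ ≡ S₁ →
        c * (K₁ * S₁) ≤ n₁ → n₁ ≤ N₁ → 0ℚ ≤ N₁ → A₁ ≡ N₁ * N₁ → A₁ ≤ 0ℚ
      bookkeeping A₁ J₁ W₁ N₁ h K₁ S₁ n₁ 4κ≤h 0≤A le refl refl n-large n≤N 0≤N A≡ = +-cancelʳ (A₁ + A₁ + A₁) (begin
        A₁ + (A₁ + A₁ + A₁)                          ≡⟨ solve 1 (λ a → a :+ (a :+ a :+ a) := a :* con 4ℚ) refl A₁ ⟩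
        A₁ * 4ℚ                                      ≡⟨ cong (A₁ *_) (trans (sym (*-identityʳ 4ℚ)) (cong (4ℚ *_) (sym cκ≡1))) ⟩
        A₁ * (4ℚ * (c * κ))                          ≡⟨ solve 3 (λ a c κ → a :* (con 4ℚ :* (c :* κ)) := c :* (a :* (con 4ℚ :* κ))) refl A₁ c κ ⟩
        c * (A₁ * (4ℚ * κ))                          ≤⟨ *-monoˡ c 0≤c (*-monoˡ A₁ 0≤A 4κ≤h) ⟩
        c * (A₁ * h)                                 ≤⟨ *-monoˡ c 0≤c le ⟩
        c * (A₁ * κ + (K₁ * N₁ * S₁ + A₁ * κ))
          ≡⟨ solve 6 (λ c a κ k n e → c :* (a :* κ :+ (k :* n :* e :+ a :* κ)) := c :* κ :* (a :+ a) :+ n :* (c :* (k :* e))) refl c A₁ κ K₁ N₁ S₁ ⟩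
        c * κ * (A₁ + A₁) + N₁ * (c * (K₁ * S₁))
          ≤⟨ +-mono-≤ (≤-reflexive (trans (cong (_* (A₁ + A₁)) cκ≡1) (*-identityˡ (A₁ + A₁)))) (*-monoˡ N₁ 0≤N (≤-trans n-large n≤N)) ⟩
        A₁ + A₁ + N₁ * N₁                            ≡⟨ cong (_+_ (A₁ + A₁)) (sym A≡) ⟩
        A₁ + A₁ + A₁                                 ≡⟨ +-identityˡ (A₁ + A₁ + A₁) ⟨
        0ℚ + (A₁ + A₁ + A₁)                          ∎)

      contradiction : ⊥
      contradiction = <⇒≱ (<-≤-trans (positive⁻¹ 1ℚ) (1≤fromℕ (n ℕ.+ n ℕ.* suc n)))
        (bookkeeping (fromℕ A) (fromℕ J) W (fromℕ N) (norm h₀) (fromℕ K) (stepBound g R μ) (fromℕ n)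
          4κ≤h₀ (0≤fromℕ A) (centre≤ h₀ {κ} {κ} close small) (fromℕ-* K N) W≡ n-large
          (subst (fromℕ n ≤_) (sym (fromℕ-suc n)) (q≤p+q (fromℕ n) 0≤1)) (0≤fromℕ N) (fromℕ-* N N))

    -- The grid is finite and `<` on ℚ is decidable, so refuting |g| ≥ m on the grid yields a point
    -- where it fails.
    search : ∃[ z ] (norm z ≤ R * 2ℚ × norm (evᶜ g z) < m)
    search with ℕ.anyUpTo? (λ j → ℕ.anyUpTo? (λ a → norm (evᶜ g (pt j a)) <? m) (suc A)) (suc J)
    ... | yes (j , _ , a , _ , lt) = pt j a , norm-pt≤2R j a , lt
    ... | no none = ⊥-elim (contradiction λ j a j≤J a≤A → ≮⇒≥ λ lt → none (j , ℕ.s≤s j≤J , a , ℕ.s≤s a≤A , lt))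

  module ApproximateRoot (g : Poly) (G R : ℚ) (0<G : 0ℚ < G) (g₀≤G : norm (evᶜ g 0ᶜ) ≤ G) (0≤R : 0ℚ ≤ R)
    (far : ∀ z → R ≤ norm z → 2ℚ * (4ℚ * G) ≤ norm (evᶜ g z)) where

    g₀ : Gauss
    g₀ = evᶜ g 0ᶜ

    find : ∀ m → 0ℚ < m → ∃[ z ] (norm z ≤ R * 2ℚ × norm (evᶜ g z) < m)
    -- Either 0 already serves, or |g(0)| ≥ m makes 1/g(0) available with a bound in terms of m.
    find m 0<m with norm g₀ <? m
    ... | yes lt = 0ᶜ , 0≤* 0≤R 0≤2 , lt
    ... | no ¬lt = let (K , K-large) = archimedean (c * centreBound g R μ)
                       (n , n-large) = archimedean (c * (fromℕ K * stepBound g R μ))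
      in Search.search g c κ R m μ h₀ (positive⁻¹ c) cκ≡1 0≤R far 0<m (≤-reflexive 2≡mμ) g₀h₀ h₀≤μ 4κ≤h₀ K n K-large n-large (rotation n)
      where
      open ≤-Reasoning
      open +-*-Solver
      instance
        G-pos : Positive G
        G-pos = positive 0<G
        m-pos : Positive m
        m-pos = positive 0<m
        m-nz : NonZero m
        m-nz = pos⇒nonZero m
        c-pos : Positive (4ℚ * G)
        c-pos = pos*pos⇒pos 4ℚ G
        c-nz : NonZero (4ℚ * G)
        c-nz = pos⇒nonZero (4ℚ * G)
      c κ μ : ℚ
      -- From |g(0)| ≤ G it follows that |1/g(0)| ≥ 1/G = 4 κ. The factor 2 in μ = 2/m is the loss
      -- in `norm-inv≤`.
      c = 4ℚ * G
      κ = 1/ c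
      μ = 2ℚ * 1/ m
      cκ≡1 : c * κ ≡ 1ℚ
      cκ≡1 = *-inverseʳ c
      0≤κ : 0ℚ ≤ κ
      0≤κ = <⇒≤ (positive⁻¹ κ {{1/pos⇒pos c}})
      2≡mμ : 2ℚ ≡ m * μ
      2≡mμ = trans (cong (2ℚ *_) (sym (*-inverseʳ m))) (solve 3 (λ t m i → t :* (m :* i) := m :* (t :* i)) refl 2ℚ m (1/ m))
      m≤g₀ : m ≤ norm g₀
      m≤g₀ = ≮⇒≥ ¬lt
      h₀ : Gauss
      h₀ = invᶜ g₀
      g₀h₀ : g₀ *ᶜ h₀ ≡ 1ᶜ
      g₀h₀ = *-invᶜ g₀ (<-≤-trans 0<m m≤g₀)
      norm-g₀h₀ : norm (g₀ *ᶜ h₀) ≡ 1ℚ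
      norm-g₀h₀ = trans (cong norm g₀h₀) norm-1
      h₀≤μ : norm h₀ ≤ μ
      h₀≤μ = *-cancelˡ-≤-pos m (begin
        m * norm h₀             ≤⟨ *-monoʳ (norm h₀) (0≤norm h₀) m≤g₀ ⟩
        norm g₀ * norm h₀       ≤⟨ norm-inv≤ g₀ h₀ g₀h₀ ⟩
        2ℚ                      ≡⟨ 2≡mμ ⟩
        m * μ                   ∎)
      4κ≤h₀ : 4ℚ * κ ≤ norm h₀
      4κ≤h₀ = begin
        4ℚ * κ                        ≡⟨ *-identityʳ (4ℚ * κ) ⟨
        4ℚ * κ * 1ℚ                   ≡⟨ cong (4ℚ * κ *_) norm-g₀h₀ ⟨
        4ℚ * κ * norm (g₀ *ᶜ h₀)      ≤⟨ *-monoˡ (4ℚ * κ) (0≤* (nonNegative⁻¹ 4ℚ) 0≤κ) (≤-trans (norm-*≤ g₀ h₀)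
                                           (*-monoʳ (norm h₀) (0≤norm h₀) g₀≤G)) ⟩
        4ℚ * κ * (G * norm h₀)        ≡⟨ solve 4 (λ f κ G h → f :* κ :* (G :* h) := f :* G :* κ :* h) refl 4ℚ κ G (norm h₀) ⟩
        c * κ * norm h₀               ≡⟨ cong (_* norm h₀) cκ≡1 ⟩
        1ℚ * norm h₀                  ≡⟨ *-identityˡ (norm h₀) ⟩
        norm h₀                       ∎

  approximate-root : ∀ a p γ → γ ≢ 0ℤ →
    ∃[ B ] (0ℚ ≤ B × (∀ m → 0ℚ < m → ∃[ z ] (norm z ≤ B × norm (evᶜ (a ∷ p ∷ʳ γ) z) < m)))
  approximate-root a p γ γ≢0 = let
      g = a ∷ p ∷ʳ γ
      -- The summand 1 keeps G positive when g(0) = 0.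
      G = 1ℚ + norm (evᶜ g 0ᶜ)
      0<G = <-≤-trans (positive⁻¹ 1ℚ) (p≤p+q 1ℚ (0≤norm (evᶜ g 0ᶜ)))
      (R , 0≤R , far) = growthᶜ a p γ γ≢0 (2ℚ * (4ℚ * G)) (0≤* 0≤2 (0≤* (nonNegative⁻¹ 4ℚ) (<⇒≤ 0<G)))
    in R * 2ℚ , 0≤* 0≤R 0≤2 , ApproximateRoot.find g G R 0<G (q≤p+q (norm (evᶜ g 0ᶜ)) 0≤1) 0≤R far

  ½^ : ℕ → ℚ
  ½^ zero    = 1ℚ
  ½^ (suc n) = ½ * ½^ n

  0≤½^ : ∀ n → 0ℚ ≤ ½^ n
  0≤½^ zero    = 0≤1
  0≤½^ (suc n) = 0≤* 0≤½ (0≤½^ n)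

  ½^-half : ∀ n → ½^ n ≡ ½^ (suc n) + ½^ (suc n)
  ½^-half n = solve 1 (λ h → h := con ½ :* h :+ con ½ :* h) refl (½^ n)
    where open +-*-Solver

  -- Newton's method: a g + b g′ = k keeps g′ away from 0 near a root of g.
  module Newton (g a b : Poly) (k : Gauss) (1≤k : 1ℚ ≤ norm k)
    (bezout : ∀ z → evᶜ a z *ᶜ evᶜ g z +ᶜ evᶜ b z *ᶜ evᶜ (deriv g) z ≡ k)
    (B₀ : ℚ) (0≤B₀ : 0ℚ ≤ B₀) where

    open ≤-Reasoning

    -- On the region norm ≤ B, α and β bound a and b, and Q the second divided difference of g; W
    -- bounds 1/g′ at the iterates. X dominates α, W and W² Q, so each of them times `tolerance` =
    -- 1/(2 X) is at most 1/2.
    B α β W Q X : ℚ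
    B = B₀ + 1ℚ
    0≤B : 0ℚ ≤ B
    0≤B = 0≤+ 0≤B₀ 0≤1
    α = bound a B
    β = bound b B
    W = 4ℚ * β
    Q = boundΔ² g B
    X = 1ℚ + (α + (W + W * W * Q))
    0≤α : 0ℚ ≤ α
    0≤α = 0≤bound a 0≤B
    0≤W : 0ℚ ≤ W
    0≤W = 0≤* (nonNegative⁻¹ 4ℚ) (0≤bound b 0≤B)
    0≤WWQ : 0ℚ ≤ W * W * Q
    0≤WWQ = 0≤* (0≤* 0≤W 0≤W) (0≤boundΔ² g 0≤B)
    1≤X : 1ℚ ≤ X
    1≤X = p≤p+q 1ℚ (0≤+ 0≤α (0≤+ 0≤W 0≤WWQ))
    instance
      X-pos : Positive X
      X-pos = positive (<-≤-trans (positive⁻¹ 1ℚ) 1≤X)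
      X-nz : NonZero X
      X-nz = pos⇒nonZero X

    tolerance : ℚ
    tolerance = ½ * 1/ X
    0<tolerance : 0ℚ < tolerance
    0<tolerance = positive⁻¹ tolerance {{pos*pos⇒pos ½ (1/ X) {{1/pos⇒pos X}}}}
    0≤tolerance : 0ℚ ≤ tolerance
    0≤tolerance = <⇒≤ 0<tolerance

    ≤½ : ∀ {t} → t ≤ X → t * tolerance ≤ ½
    ≤½ {t} t≤X = begin
      t * (½ * 1/ X)      ≤⟨ *-monoʳ tolerance 0≤tolerance t≤X ⟩
      X * (½ * 1/ X)      ≡⟨ solve 3 (λ x h i → x :* (h :* i) := h :* (x :* i)) refl X ½ (1/ X) ⟩
      ½ * (X * 1/ X)      ≡⟨ cong (½ *_) (*-inverseʳ X) ⟩
      ½ * 1ℚ              ≡⟨ *-identityʳ ½ ⟩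
      ½                   ∎
      where open +-*-Solver

    α≤X : α ≤ X
    α≤X = ≤-trans (p≤p+q α (0≤+ 0≤W 0≤WWQ)) (q≤p+q _ 0≤1)
    W≤X : W ≤ X
    W≤X = ≤-trans (p≤p+q W 0≤WWQ) (≤-trans (q≤p+q _ 0≤α) (q≤p+q _ 0≤1))
    WWQ≤X : W * W * Q ≤ X
    WWQ≤X = ≤-trans (q≤p+q (W * W * Q) 0≤W) (≤-trans (q≤p+q _ 0≤α) (q≤p+q _ 0≤1))

    -- The allowed radius grows by 1/2, 1/4, ... and never exceeds B₀ + 1 = B, so the bounds above
    -- apply to every iterate.
    State : ℕ → Set
    State n = Σ[ z ∈ Gauss ] (norm z ≤ B₀ + (1ℚ - ½^ n) × norm (evᶜ g z) ≤ tolerance * ½^ n)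

    ½^≤1 : ∀ n → ½^ n ≤ 1ℚ
    ½^≤1 zero    = ≤-refl
    ½^≤1 (suc n) = ≤-trans (p≤p+q (½^ (suc n)) (0≤½^ (suc n))) (≤-trans (≤-reflexive (sym (½^-half n))) (½^≤1 n))

    state≤B : ∀ n (s : State n) → norm (proj₁ s) ≤ B
    state≤B n (z , z≤ , _) = ≤-trans z≤ (+-monoʳ-≤ B₀ (subst (1ℚ - ½^ n ≤_) (+-identityʳ 1ℚ) (+-monoʳ-≤ 1ℚ (neg-antimono-≤ (0≤½^ n)))))

    module Step n (s : State n) where
      z gz g′z w z₁ : Gauss
      z = proj₁ s
      gz = evᶜ g z
      g′z = evᶜ (deriv g) z
      w = invᶜ g′z
      z₁ = z -ᶜ gz *ᶜ w
      z≤B : norm z ≤ B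
      z≤B = state≤B n s
      gz≤ : norm gz ≤ tolerance * ½^ n
      gz≤ = proj₂ (proj₂ s)
      gz≤tolerance : norm gz ≤ tolerance
      gz≤tolerance = ≤-trans gz≤ (subst (tolerance * ½^ n ≤_) (*-identityʳ tolerance) (*-monoˡ tolerance 0≤tolerance (½^≤1 n)))
      -- In a g + b g′ = k with |k| ≥ 1 the first term is at most 1/2, so the second is at least
      -- 1/2.
      ½≤βg′ : ½ ≤ β * norm g′z
      ½≤βg′ = +-cancelʳ ½ (begin
        ½ + ½                                     ≤⟨ 1≤k ⟩
        norm k                                    ≡⟨ cong norm (bezout z) ⟨
        norm (evᶜ a z *ᶜ gz +ᶜ evᶜ b z *ᶜ g′z)
          ≤⟨ norm-+≤-mono (evᶜ a z *ᶜ gz) (evᶜ b z *ᶜ g′z) (norm-*≤-mono (evᶜ a z) gz (norm-ev≤bound a z z≤B) gz≤tolerance)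
               (norm-*≤-mono (evᶜ b z) g′z (norm-ev≤bound b z z≤B) ≤-refl) ⟩
        α * tolerance + β * norm g′z              ≤⟨ +-monoˡ-≤ (β * norm g′z) (≤½ α≤X) ⟩
        ½ + β * norm g′z                          ≡⟨ +-comm ½ (β * norm g′z) ⟩
        β * norm g′z + ½                          ∎)
      g′w : g′z *ᶜ w ≡ 1ᶜ
      g′w = *-invᶜ g′z (≰⇒> λ g′≤0 → <⇒≱ (positive⁻¹ ½) (≤-trans ½≤βg′
        (≤-reflexive (trans (cong (β *_) (≤-antisym g′≤0 (0≤norm g′z))) (*-zeroʳ β)))))
      w≤W : norm w ≤ W
      w≤W = begin
        norm w                            ≡⟨ *-identityˡ (norm w) ⟨
        1ℚ * norm w                       ≤⟨ *-monoʳ (norm w) (0≤norm w) (begin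
             1ℚ                           ≤⟨ *-monoˡ 2ℚ 0≤2 ½≤βg′ ⟩
             2ℚ * (β * norm g′z)          ∎) ⟩
        2ℚ * (β * norm g′z) * norm w      ≡⟨ solve 4 (λ t b g w → t :* (b :* g) :* w := t :* b :* (g :* w)) refl 2ℚ β (norm g′z) (norm w) ⟩
        2ℚ * β * (norm g′z * norm w)      ≤⟨ *-monoˡ (2ℚ * β) (0≤* 0≤2 (0≤bound b 0≤B)) (norm-inv≤ g′z w g′w) ⟩
        2ℚ * β * 2ℚ                       ≡⟨ solve 1 (λ b → con 2ℚ :* b :* con 2ℚ := con 4ℚ :* b) refl β ⟩
        W                                 ∎
        where open +-*-Solver
      step≤ : norm (gz *ᶜ w) ≤ ½^ (suc n)
      step≤ = begin
        norm (gz *ᶜ w)                ≤⟨ norm-*≤-mono gz w gz≤ w≤W ⟩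
        tolerance * ½^ n * W          ≡⟨ solve 3 (λ t h w → t :* h :* w := w :* t :* h) refl tolerance (½^ n) W ⟩
        W * tolerance * ½^ n          ≤⟨ *-monoʳ (½^ n) (0≤½^ n) (≤½ W≤X) ⟩
        ½ * ½^ n                      ∎
        where open +-*-Solver
      z₁-z : z₁ -ᶜ z ≡ -ᶜ (gz *ᶜ w)
      z₁-z = cancel z (gz *ᶜ w)
        where
        cancel : ∀ z d → z -ᶜ d -ᶜ z ≡ -ᶜ d
        cancel = solve-∀ gaussACR
      norm-z₁-z : norm (z₁ -ᶜ z) ≤ ½^ (suc n)
      norm-z₁-z = subst (_≤ ½^ (suc n)) (sym (trans (cong norm z₁-z) (norm-neg (gz *ᶜ w)))) step≤
      z₁≤ : norm z₁ ≤ B₀ + (1ℚ - ½^ (suc n))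
      z₁≤ = begin
        norm (z -ᶜ gz *ᶜ w)                    ≤⟨ norm-−≤ z (gz *ᶜ w) ⟩
        norm z + norm (gz *ᶜ w)                ≤⟨ +-mono-≤ (proj₁ (proj₂ s)) step≤ ⟩
        B₀ + (1ℚ - ½^ n) + ½^ (suc n)          ≡⟨ cong (λ t → B₀ + (1ℚ - t) + ½^ (suc n)) (½^-half n) ⟩
        B₀ + (1ℚ - (½^ (suc n) + ½^ (suc n))) + ½^ (suc n)
          ≡⟨ solve 2 (λ b h → b :+ (con 1ℚ :- (h :+ h)) :+ h := b :+ (con 1ℚ :- h)) refl B₀ (½^ (suc n)) ⟩
        B₀ + (1ℚ - ½^ (suc n))                 ∎
        where open +-*-Solver
      z₁≤B : norm z₁ ≤ B
      z₁≤B = ≤-trans z₁≤ (+-monoʳ-≤ B₀ (subst (1ℚ - ½^ (suc n) ≤_) (+-identityʳ 1ℚ) (+-monoʳ-≤ 1ℚ (neg-antimono-≤ (0≤½^ (suc n))))))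
      q : Gauss
      q = Δ² g z z₁ z
      -- Expansion of g at z to second order; the Newton step cancels the constant and linear terms
      -- because g′(z) w = 1.
      gz₁≡ : evᶜ g z₁ ≡ gz *ᶜ w *ᶜ (gz *ᶜ w) *ᶜ q
      gz₁≡ = Eq.begin
        evᶜ g z₁
          Eq.≡⟨ isolate gz (evᶜ g z₁) ⟩
        gz -ᶜ (gz -ᶜ evᶜ g z₁)
          Eq.≡⟨ cong (λ t → gz -ᶜ t) (Δ-eq g z z₁) ⟩
        gz -ᶜ (z -ᶜ z₁) *ᶜ Δ g z z₁
          Eq.≡⟨ cong (λ t → gz -ᶜ (z -ᶜ z₁) *ᶜ t) (isolate′ (Δ g z z₁) (Δ g z z)) ⟩
        gz -ᶜ (z -ᶜ z₁) *ᶜ (Δ g z z +ᶜ (Δ g z z₁ -ᶜ Δ g z z))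
          Eq.≡⟨ cong₂ (λ s t → gz -ᶜ (z -ᶜ z₁) *ᶜ (s +ᶜ t)) (Δ-diagonal g z) (trans (Δ²-eq g z z₁ z) (cong (_*ᶜ q) z₁-z)) ⟩
        gz -ᶜ (z -ᶜ (z -ᶜ gz *ᶜ w)) *ᶜ (g′z +ᶜ -ᶜ (gz *ᶜ w) *ᶜ q)
          Eq.≡⟨ expand z gz w g′z q ⟩
        gz -ᶜ gz *ᶜ (g′z *ᶜ w) +ᶜ gz *ᶜ w *ᶜ (gz *ᶜ w) *ᶜ q
          Eq.≡⟨ cong (λ t → gz -ᶜ gz *ᶜ t +ᶜ gz *ᶜ w *ᶜ (gz *ᶜ w) *ᶜ q) g′w ⟩
        gz -ᶜ gz *ᶜ 1ᶜ +ᶜ gz *ᶜ w *ᶜ (gz *ᶜ w) *ᶜ q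
          Eq.≡⟨ cancel gz (gz *ᶜ w *ᶜ (gz *ᶜ w) *ᶜ q) ⟩
        gz *ᶜ w *ᶜ (gz *ᶜ w) *ᶜ q Eq.∎
        where
        module Eq = ≡-Reasoning
        isolate : ∀ x y → y ≡ x -ᶜ (x -ᶜ y)
        isolate = solve-∀ gaussACR
        isolate′ : ∀ x y → x ≡ y +ᶜ (x -ᶜ y)
        isolate′ = solve-∀ gaussACR
        expand : ∀ z g w d q → g -ᶜ (z -ᶜ (z -ᶜ g *ᶜ w)) *ᶜ (d +ᶜ -ᶜ (g *ᶜ w) *ᶜ q)
          ≡ g -ᶜ g *ᶜ (d *ᶜ w) +ᶜ g *ᶜ w *ᶜ (g *ᶜ w) *ᶜ q
        expand = solve-∀ gaussACR
        cancel : ∀ g y → g -ᶜ g *ᶜ 1ᶜ +ᶜ y ≡ y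
        cancel = solve-∀ gaussACR
      -- Of the two factors g(z) one is only bounded by `tolerance`: halving at each step is enough.
      gz₁≤ : norm (evᶜ g z₁) ≤ tolerance * ½^ (suc n)
      gz₁≤ = begin
        norm (evᶜ g z₁)
          ≡⟨ cong norm gz₁≡ ⟩
        norm (gz *ᶜ w *ᶜ (gz *ᶜ w) *ᶜ q)
          ≤⟨ norm-*≤-mono (gz *ᶜ w *ᶜ (gz *ᶜ w)) q (norm-*≤-mono (gz *ᶜ w) (gz *ᶜ w)
               (norm-*≤-mono gz w gz≤ w≤W) (norm-*≤-mono gz w gz≤tolerance w≤W)) (norm-Δ²≤ g z z₁ z z≤B z₁≤B z≤B) ⟩
        tolerance * ½^ n * W * (tolerance * W) * Q
          ≡⟨ solve 4 (λ t h w q → t :* h :* w :* (t :* w) :* q := w :* w :* q :* t :* (t :* h)) refl tolerance (½^ n) W Q ⟩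
        W * W * Q * tolerance * (tolerance * ½^ n)
          ≤⟨ *-monoʳ (tolerance * ½^ n) (0≤* 0≤tolerance (0≤½^ n)) (≤½ WWQ≤X) ⟩
        ½ * (tolerance * ½^ n)
          ≡⟨ solve 2 (λ t h → con ½ :* (t :* h) := t :* (con ½ :* h)) refl tolerance (½^ n) ⟩
        tolerance * ½^ (suc n) ∎
        where open +-*-Solver
      next : State (suc n)
      next = z₁ , z₁≤ , gz₁≤

    module Sequence (z₀ : Gauss) (z₀≤ : norm z₀ ≤ B₀) (gz₀≤ : norm (evᶜ g z₀) ≤ tolerance) where

      state : ∀ n → State n
      state zero    = z₀ , ≤-trans z₀≤ (≤-reflexive (trans (sym (+-identityʳ B₀)) (cong (_+_ B₀) (sym (+-inverseʳ 1ℚ))))) ,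
                      ≤-trans gz₀≤ (≤-reflexive (sym (*-identityʳ tolerance)))
      state (suc n) = Step.next n (state n)

      root : ℕ → Gauss
      root n = proj₁ (state n)

      root≤B : ∀ n → norm (root n) ≤ B
      root≤B n = state≤B n (state n)

      g-root≤ : ∀ n → norm (evᶜ g (root n)) ≤ ½^ n
      g-root≤ n = ≤-trans (proj₂ (proj₂ (state n))) (≤-trans (*-monoʳ (½^ n) (0≤½^ n) tolerance≤1) (≤-reflexive (*-identityˡ (½^ n))))
        where
        tolerance≤1 : tolerance ≤ 1ℚ
        tolerance≤1 = ≤-trans (subst (_≤ ½) (*-identityˡ tolerance) (≤½ 1≤X)) (≤ᵇ⇒≤ _)

      -- The bound is exactly the sum of the step bounds in between, which is what the induction on
      -- k needs.
      root-close : ∀ n k → norm (root (k ℕ.+ n) -ᶜ root n) ≤ ½^ n - ½^ (k ℕ.+ n)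
      root-close n zero    = ≤-reflexive (trans (cong norm (-ᶜ-inverseʳ (root n))) (sym (+-inverseʳ (½^ n))))
      root-close n (suc k) = begin
        norm (root (suc (k ℕ.+ n)) -ᶜ root n)
          ≡⟨ cong norm (insert (root (suc (k ℕ.+ n))) (root (k ℕ.+ n)) (root n)) ⟩
        norm (root (suc (k ℕ.+ n)) -ᶜ root (k ℕ.+ n) +ᶜ (root (k ℕ.+ n) -ᶜ root n))
          ≤⟨ norm-+≤-mono (root (suc (k ℕ.+ n)) -ᶜ root (k ℕ.+ n)) (root (k ℕ.+ n) -ᶜ root n)
               (Step.norm-z₁-z (k ℕ.+ n) (state (k ℕ.+ n))) (root-close n k) ⟩
        ½^ (suc (k ℕ.+ n)) + (½^ n - ½^ (k ℕ.+ n))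
          ≡⟨ cong (λ t → ½^ (suc (k ℕ.+ n)) + (½^ n - t)) (½^-half (k ℕ.+ n)) ⟩
        ½^ (suc (k ℕ.+ n)) + (½^ n - (½^ (suc (k ℕ.+ n)) + ½^ (suc (k ℕ.+ n))))
          ≡⟨ solve 2 (λ h n → h :+ (n :- (h :+ h)) := n :- h) refl (½^ (suc (k ℕ.+ n))) (½^ n) ⟩
        ½^ n - ½^ (suc k ℕ.+ n) ∎
        where
        open +-*-Solver
        insert : ∀ x y z → x -ᶜ z ≡ x -ᶜ y +ᶜ (y -ᶜ z)
        insert = solve-∀ gaussACR

-- Separable polynomials are squarefree

module RepeatedRoots where

  open PolynomialEvaluation
  open IntegerPolynomials
  open PolynomialExpressions
  open Multiplicities
  open BelyiPolynomials using (weightedFrom-∷ʳ; length-weightedFrom)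
  open GaussianRationals
  open PolynomialsOverℚi
  open CircleAverages
  open ApproximateRoots
  open import Algebra.Bundles using (CommutativeRing)
  open import Algebra.Bundles.Raw using (RawRing)
  open import Data.Empty using (⊥; ⊥-elim)
  open import Data.Integer.Base as ℤ using (ℤ; +_; 0ℤ; -1ℤ) renaming (∣_∣ to abs)
  import Data.Integer.Properties as ℤ
  open import Data.List.Base using (List; []; _∷_; _∷ʳ_; map; length)
  open import Data.Nat.Base as ℕ using (ℕ; zero; suc)
  import Data.Nat.Properties as ℕ
  import Data.Nat.Tactic.RingSolver as ℕ
  open import Data.Product.Base using (∃-syntax; Σ-syntax; _×_; _,_; proj₁; proj₂)
  open import Data.Rational.Base hiding (ceiling)
  open import Data.Rational.Properties
  open import Data.Rational.Solver using (module +-*-Solver)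
  open import Data.Sum.Base using (_⊎_; inj₁; inj₂)
  open import Level using (0ℓ)
  open import Relation.Binary.PropositionalEquality hiding (J)
  open import Relation.Nullary using (yes; no)
  open import Tactic.RingSolver using (solve-∀)
  open import Algebra.Definitions.RawMagma using (_,_)

  -- Agreement at all integers forces equal coefficients up to trailing zeros, so identities checked
  -- over ℤ hold over ℚ(i).
  evᶜ-cong : ∀ p q → p ≐ q → ∀ z → evᶜ (code p) z ≡ evᶜ (code q) z
  evᶜ-cong p q h z = begin
    evᶜ (code p) z
      ≡⟨ isolate (evᶜ (code p) z) (evᶜ (code q) z) ⟩
    evᶜ (code p) z +ᶜ -ᶜ 1ᶜ *ᶜ evᶜ (code q) z +ᶜ evᶜ (code q) z
      ≡⟨ cong (_+ᶜ evᶜ (code q) z) (trans (cong (evᶜ (code p) z +ᶜ_) (sym (evᶜ-scale -1ℤ (code q) z)))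
           (trans (sym (evᶜ-⊕ (code p) (map (-1ℤ ℤ.*_) (code q)) z)) (evᶜ-IsZero (ev-ext (code p) (code q) 0
             (λ x _ → trans (sym (fn≡ p x)) (trans (h x) (fn≡ q x)))) z))) ⟩
    0ᶜ +ᶜ evᶜ (code q) z
      ≡⟨ +ᶜ-identityˡ (evᶜ (code q) z) ⟩
    evᶜ (code q) z ∎
    where
    open ≡-Reasoning
    isolate : ∀ x y → x ≡ x +ᶜ -ᶜ 1ᶜ *ᶜ y +ᶜ y
    isolate = solve-∀ gaussACR

  -- The nonzero integer κ has norm at least 1, so a bound for κ p = g r is one for p, up to the
  -- factor 2 of `norm-*≥`.
  norm-≤-∣ : ∀ g p (d : g ∣ᵖ p) z {B δ} → norm z ≤ B → norm (evᶜ (code g) z) ≤ δ →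
    norm (evᶜ (code p) z) ≤ 2ℚ * bound (code (_∣ᵖ_.r d)) B * δ
  norm-≤-∣ g p (dvd κ r κ≢0 e) z {B} {δ} z≤ g≤ = begin
    norm pz                          ≡⟨ *-identityˡ (norm pz) ⟨
    1ℚ * norm pz                     ≤⟨ *-monoʳ (norm pz) (0≤norm pz) (norm-ofℤ≥1 κ κ≢0) ⟩
    norm (ofℤ κ) * norm pz           ≤⟨ norm-*≥ (ofℤ κ) pz ⟩
    2ℚ * norm (ofℤ κ *ᶜ pz)          ≡⟨ cong (λ t → 2ℚ * norm t) κp≡gr ⟩
    2ℚ * norm (evᶜ (code g) z *ᶜ evᶜ (code r) z)
      ≤⟨ *-monoˡ 2ℚ 0≤2 (norm-*≤-mono (evᶜ (code g) z) (evᶜ (code r) z) g≤ (norm-ev≤bound (code r) z z≤)) ⟩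
    2ℚ * (δ * bound (code r) B)      ≡⟨ solve 3 (λ t d b → t :* (d :* b) := t :* b :* d) refl 2ℚ δ (bound (code r) B) ⟩
    2ℚ * bound (code r) B * δ        ∎
    where
    open ≤-Reasoning
    open +-*-Solver
    pz : Gauss
    pz = evᶜ (code p) z
    κp≡gr : ofℤ κ *ᶜ pz ≡ evᶜ (code g) z *ᶜ evᶜ (code r) z
    κp≡gr = trans (cong (_*ᶜ pz) (sym (evᶜ-const κ z))) (trans (sym (evᶜ-⊗ (κ ∷ []) (code p) z))
      (trans (evᶜ-cong (constᵖ κ *ᵖ p) (g *ᵖ r) e z) (evᶜ-⊗ (code g) (code r) z)))

  -- Squarefree factors

  NonconstantFactor : Pol → Set
  NonconstantFactor p = ∃[ a ] ∃[ q ] ∃[ γ ] (γ ≢ 0ℤ × ⌈ a ∷ q ∷ʳ γ ⌉ ∣ᵖ p × ⌈ a ∷ q ∷ʳ γ ⌉ ∣ᵖ D p)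

  squarefree-or-common-factor : ∀ p → NonZeroᵖ p → Squarefreeᵖ p ⊎ NonconstantFactor p
  squarefree-or-common-factor p nz with gcdᵖ p (D p)
  ... | d , d∣p , d∣Dp , a , b , κ , κ≢0 , e with leadingᵖ d (∣-NonZero d p d∣p nz)
  ...   | [] , γ , γ≢0 , _ , h = inj₁ (a , b , κ ℤ.* γ , *-≢0 κ≢0 γ≢0 , λ x →
            trans (e x) (cong (κ ℤ.*_) (trans (fn≡ d x) (trans (h x) (ev-const γ x)))))
  ...   | c ∷ q , γ , γ≢0 , _ , h = inj₂ (c , q , γ , γ≢0 , ∣-trans _ d p ≐d d∣p , ∣-trans _ d (D p) ≐d d∣Dp)
    where
    ≐d : ⌈ c ∷ q ∷ʳ γ ⌉ ∣ᵖ d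
    ≐d = ≐⇒∣ ⌈ c ∷ q ∷ʳ γ ⌉ d λ x → sym (trans (fn≡ d x) (h x))

  -- Otherwise |x|^(deg q + 1) ≤ M |x|^deg q at an x chosen larger than M. This x also has to avoid
  -- the zeros of the cofactor r.
  degree-mono : ∀ p γ q δ → γ ≢ 0ℤ → δ ≢ 0ℤ → ⌈ p ∷ʳ γ ⌉ ∣ᵖ ⌈ q ∷ʳ δ ⌉ → length p ℕ.≤ length q
  degree-mono p γ q δ γ≢0 δ≢0 (dvd κ r κ≢0 e) with length p ℕ.≤? length q
  ... | yes le = le
  ... | no ¬le = ⊥-elim (ℕ.<-irrefl refl (ℕ.≤-trans (ℕ.s≤s M≤) X≤M))
    where
    open ℕ.≤-Reasoning
    lo = growth-lower p γ γ≢0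
    up = growth-upper q δ
    C C′ B B′ M X : ℕ
    C = proj₁ lo
    B = proj₁ (proj₂ lo)
    C′ = proj₁ up
    r-large : ∃[ B ] (∀ x → B ℕ.≤ abs x → fn r x ≢ 0ℤ)
    r-large = NonZero-large r (∣-NonZero r ⌈ q ∷ʳ δ ⌉ (dvd κ ⌈ p ∷ʳ γ ⌉ κ≢0 λ x → trans (e x) (ℤ.*-comm (ev (p ∷ʳ γ) x) (fn r x))) (NonZero-∷ʳ q δ δ≢0))
    B′ = proj₁ r-large
    M = C ℕ.* (abs κ ℕ.* C′)
    X = suc (B ℕ.+ B′ ℕ.+ M)
    x : ℤ
    x = + X
    M≤ : M ℕ.≤ B ℕ.+ B′ ℕ.+ M
    M≤ = ℕ.m≤n+m M (B ℕ.+ B′)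
    B≤X : B ℕ.≤ X
    B≤X = ℕ.≤-trans (ℕ.m≤m+n B B′) (ℕ.≤-trans (ℕ.m≤m+n (B ℕ.+ B′) M) (ℕ.n≤1+n _))
    B′≤X : B′ ℕ.≤ X
    B′≤X = ℕ.≤-trans (ℕ.m≤n+m B′ B) (ℕ.≤-trans (ℕ.m≤m+n (B ℕ.+ B′) M) (ℕ.n≤1+n _))
    Pr≡κQ : abs (ev (p ∷ʳ γ) x) ℕ.* abs (fn r x) ≡ abs κ ℕ.* abs (ev (q ∷ʳ δ) x)
    Pr≡κQ = trans (sym (ℤ.abs-* (ev (p ∷ʳ γ) x) (fn r x))) (trans (cong abs (sym (e x))) (ℤ.abs-* κ (ev (q ∷ʳ δ) x)))
    regroup : ∀ C k C′ y → C ℕ.* (k ℕ.* (C′ ℕ.* y)) ≡ C ℕ.* (k ℕ.* C′) ℕ.* y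
    regroup = ℕ.solve-∀
    X≤M : X ℕ.≤ M
    X≤M = ℕ.*-cancelʳ-≤ X M (X ℕ.^ length q) {{ℕ.m^n≢0 X (length q)}} (begin
      X ℕ.^ suc (length q)                                              ≤⟨ ℕ.^-monoʳ-≤ X (ℕ.≰⇒> ¬le) ⟩
      X ℕ.^ length p                                                    ≤⟨ proj₂ (proj₂ lo) x B≤X ⟩
      C ℕ.* abs (ev (p ∷ʳ γ) x)                                         ≤⟨ ℕ.*-monoʳ-≤ C (ℕ.m≤m*n (abs (ev (p ∷ʳ γ) x)) (abs (fn r x))
                                                                             {{ℕ.>-nonZero (∣∣≢0 (proj₂ r-large x B′≤X))}}) ⟩
      C ℕ.* (abs (ev (p ∷ʳ γ) x) ℕ.* abs (fn r x))                      ≡⟨ cong (C ℕ.*_) Pr≡κQ ⟩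
      C ℕ.* (abs κ ℕ.* abs (ev (q ∷ʳ δ) x))
        ≤⟨ ℕ.*-monoʳ-≤ C (ℕ.*-monoʳ-≤ (abs κ) (proj₂ up x (ℕ.s≤s ℕ.z≤n))) ⟩
      C ℕ.* (abs κ ℕ.* (C′ ℕ.* X ℕ.^ length q))                         ≡⟨ regroup C (abs κ) C′ (X ℕ.^ length q) ⟩
      M ℕ.* X ℕ.^ length q                                              ∎)

  SquarefreeFactor : Pol → Set
  SquarefreeFactor p = ∃[ a ] ∃[ q ] ∃[ γ ] (γ ≢ 0ℤ × Squarefreeᵖ ⌈ a ∷ q ∷ʳ γ ⌉ × ⌈ a ∷ q ∷ʳ γ ⌉ ∣ᵖ p)

  common-factor-degree : ∀ a p γ b q δ → γ ≢ 0ℤ → δ ≢ 0ℤ → ⌈ b ∷ q ∷ʳ δ ⌉ ∣ᵖ D ⌈ a ∷ p ∷ʳ γ ⌉ → suc (length q) ℕ.≤ length p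
  common-factor-degree a p γ b q δ γ≢0 δ≢0 d = subst (suc (length q) ℕ.≤_) (length-weightedFrom 1 p)
    (degree-mono (b ∷ q) δ (weightedFrom 1 p) (+ suc (length p) ℤ.* γ) δ≢0 (*-≢0 {+ suc (length p)} (λ ()) γ≢0)
      (∣-trans ⌈ b ∷ q ∷ʳ δ ⌉ (D ⌈ a ∷ p ∷ʳ γ ⌉) ⌈ weightedFrom 1 p ∷ʳ (+ suc (length p) ℤ.* γ) ⌉ d
        (≐⇒∣ (D ⌈ a ∷ p ∷ʳ γ ⌉) ⌈ weightedFrom 1 p ∷ʳ (+ suc (length p) ℤ.* γ) ⌉ λ x → cong (λ t → ev t x) (weightedFrom-∷ʳ 1 p γ))))

  -- While g shares a nonconstant factor with g′, that factor replaces g and has smaller degree. The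
  -- Bezout relation between g and g′ at the end of this descent is what Newton's method requires.
  squarefree-factor : ∀ n a p γ → γ ≢ 0ℤ → length p ℕ.≤ n → SquarefreeFactor ⌈ a ∷ p ∷ʳ γ ⌉
  reduce : ∀ n a p γ → γ ≢ 0ℤ → length p ℕ.≤ n →
    Squarefreeᵖ ⌈ a ∷ p ∷ʳ γ ⌉ ⊎ NonconstantFactor ⌈ a ∷ p ∷ʳ γ ⌉ → SquarefreeFactor ⌈ a ∷ p ∷ʳ γ ⌉
  squarefree-factor n a p γ γ≢0 l =
    reduce n a p γ γ≢0 l (squarefree-or-common-factor ⌈ a ∷ p ∷ʳ γ ⌉ (NonZero-∷ʳ (a ∷ p) γ γ≢0))
  reduce n       a p γ γ≢0 l (inj₁ sqf) = a , p , γ , γ≢0 , sqf , ∣-refl ⌈ a ∷ p ∷ʳ γ ⌉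
  reduce zero    a p γ γ≢0 l (inj₂ (b , q , δ , δ≢0 , d∣p , d∣Dp)) =
    ⊥-elim (ℕ.n≮0 (ℕ.≤-trans (common-factor-degree a p γ b q δ γ≢0 δ≢0 d∣Dp) l))
  reduce (suc n) a p γ γ≢0 l (inj₂ (b , q , δ , δ≢0 , d∣p , d∣Dp)) = let
      (c , r , ε , ε≢0 , sqf , d) = squarefree-factor n b q δ δ≢0 (ℕ.≤-pred (ℕ.≤-trans (common-factor-degree a p γ b q δ γ≢0 δ≢0 d∣Dp) l))
    in c , r , ε , ε≢0 , sqf , ∣-trans ⌈ c ∷ r ∷ʳ ε ⌉ ⌈ b ∷ q ∷ʳ δ ⌉ ⌈ a ∷ p ∷ʳ γ ⌉ d d∣p

  -- Convergence in ℝ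

  ½^-decay : ∀ n → ½^ n * (1ℚ + fromℕ n) ≤ 1ℚ
  ½^-decay zero    = ≤-refl
  ½^-decay (suc n) = begin
    ½ * ½^ n * (1ℚ + fromℕ (suc n))
      ≡⟨ cong (λ t → ½ * ½^ n * (1ℚ + t)) (fromℕ-suc n) ⟩
    ½ * ½^ n * (1ℚ + (1ℚ + fromℕ n))
      ≤⟨ p≤p+q _ (0≤* (0≤* 0≤½ (0≤½^ n)) (0≤fromℕ n)) ⟩
    ½ * ½^ n * (1ℚ + (1ℚ + fromℕ n)) + ½ * ½^ n * fromℕ n
      ≡⟨ solve 2 (λ h n → con ½ :* h :* (con 1ℚ :+ (con 1ℚ :+ n)) :+ con ½ :* h :* n := h :* (con 1ℚ :+ n)) refl (½^ n) (fromℕ n) ⟩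
    ½^ n * (1ℚ + fromℕ n)
      ≤⟨ ½^-decay n ⟩
    1ℚ ∎
    where
    open ≤-Reasoning
    open +-*-Solver

  0<½^ : ∀ n → 0ℚ < ½^ n
  0<½^ zero    = positive⁻¹ 1ℚ
  0<½^ (suc n) = positive⁻¹ (½ * ½^ n) {{pos*pos⇒pos ½ (½^ n) {{positive (0<½^ n)}}}}

  fromℕ-mono : ∀ {m n} → m ℕ.≤ n → fromℕ m ≤ fromℕ n
  fromℕ-mono {n = n} ℕ.z≤n = 0≤fromℕ n
  fromℕ-mono {suc m} {suc n} (ℕ.s≤s le) = subst₂ _≤_ (sym (fromℕ-suc m)) (sym (fromℕ-suc n)) (+-monoʳ-≤ 1ℚ (fromℕ-mono le))

  ½^-small : ∀ C ε → 0ℚ < ε → ∃[ N ] (∀ n → N ℕ.≤ n → C * ½^ n < ε)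
  ½^-small C ε 0<ε = let (N , h) = archimedean (C * 1/ ε) in N , λ n N≤n → begin-strict
      C * ½^ n                            ≡⟨ trans (sym (*-identityʳ (C * ½^ n))) (cong (C * ½^ n *_) (sym (*-inverseˡ ε))) ⟩
      C * ½^ n * (1/ ε * ε)               ≡⟨ solve 4 (λ c h i e → c :* h :* (i :* e) := c :* i :* (h :* e)) refl C (½^ n) (1/ ε) ε ⟩
      C * 1/ ε * (½^ n * ε)               ≤⟨ *-monoʳ (½^ n * ε) (0≤* (0≤½^ n) (<⇒≤ 0<ε)) (≤-trans h (fromℕ-mono N≤n)) ⟩
      fromℕ n * (½^ n * ε)                <⟨ subst₂ _<_ (+-identityˡ (fromℕ n * (½^ n * ε))) refl (+-monoˡ-< (fromℕ n * (½^ n * ε))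
                                               (positive⁻¹ (½^ n * ε) {{pos*pos⇒pos (½^ n) {{positive (0<½^ n)}} ε}})) ⟩
      ½^ n * ε + fromℕ n * (½^ n * ε)     ≡⟨ solve 3 (λ h n e → h :* e :+ n :* (h :* e) := h :* (con 1ℚ :+ n) :* e) refl (½^ n) (fromℕ n) ε ⟩
      ½^ n * (1ℚ + fromℕ n) * ε           ≤⟨ *-monoʳ ε (<⇒≤ 0<ε) (½^-decay n) ⟩
      1ℚ * ε                              ≡⟨ *-identityˡ ε ⟩
      ε                                   ∎
    where
    open ≤-Reasoning
    open +-*-Solver
    instance
      ε-pos : Positive ε
      ε-pos = positive 0<ε
      ε-nz : NonZero ε
      ε-nz = pos⇒nonZero ε

  ∣Re-Re∣≤norm : ∀ x y → ∣ Re x - Re y ∣ ≤ norm (x -ᶜ y)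
  ∣Re-Re∣≤norm (a ⊹ b) (c ⊹ d) = p≤p+q ∣ a - c ∣ (0≤∣p∣ (b - d))

  ∣Im-Im∣≤norm : ∀ x y → ∣ Im x - Im y ∣ ≤ norm (x -ᶜ y)
  ∣Im-Im∣≤norm (a ⊹ b) (c ⊹ d) = q≤p+q ∣ b - d ∣ (0≤∣p∣ (a - c))

  -- Synthetic division by (X - w)², over ℂ and termwise over ℚ(i)

  module SyntheticDivision (R : RawRing 0ℓ 0ℓ) where
    open Polynomial R using (eval)

    -- Horner's scheme for division by X - w, to be applied twice; the remainder is p(w).
    quot : List (RawRing.Carrier R) → RawRing.Carrier R → List (RawRing.Carrier R)
    quot []      w = []
    quot (a ∷ p) w = eval p w ∷ quot p w

  gaussRawRing : RawRing 0ℓ 0ℓ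
  gaussRawRing = CommutativeRing.rawRing gaussRing

  module ℚi[X] = Polynomial gaussRawRing
  open SyntheticDivision gaussRawRing using (quot)
  open SyntheticDivision ℂ-rawRing using () renaming (quot to quotℂ)

  coeff-⊕ : ∀ p q n → ℚi[X].coeff (p ℚi[X].+ q) n ≡ ℚi[X].coeff p n +ᶜ ℚi[X].coeff q n
  coeff-⊕ []      q       n       = sym (+ᶜ-identityˡ (ℚi[X].coeff q n))
  coeff-⊕ (a ∷ p) []      n       = sym (+ᶜ-identityʳ (ℚi[X].coeff (a ∷ p) n))
  coeff-⊕ (a ∷ p) (b ∷ q) zero    = refl
  coeff-⊕ (a ∷ p) (b ∷ q) (suc n) = coeff-⊕ p q n

  coeff-scale : ∀ a p n → ℚi[X].coeff (map (a *ᶜ_) p) n ≡ a *ᶜ ℚi[X].coeff p n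
  coeff-scale a []      n       = sym (*ᶜ-zeroʳ a)
  coeff-scale a (b ∷ p) zero    = refl
  coeff-scale a (b ∷ p) (suc n) = coeff-scale a p n

  coeff-quot : ∀ p w n → ℚi[X].coeff (quot p w) n ≡ ℚi[X].coeff p (suc n) +ᶜ w *ᶜ ℚi[X].coeff (quot p w) (suc n)
  eval-quot : ∀ p w → ℚi[X].eval p w ≡ ℚi[X].coeff p 0 +ᶜ w *ᶜ ℚi[X].coeff (quot p w) 0
  eval-quot []      w = sym (trans (cong (0ᶜ +ᶜ_) (*ᶜ-zeroʳ w)) (+ᶜ-identityˡ 0ᶜ))
  eval-quot (a ∷ p) w = refl
  coeff-quot []      w n       = eval-quot [] w
  coeff-quot (a ∷ p) w zero    = eval-quot p w
  coeff-quot (a ∷ p) w (suc n) = coeff-quot p w n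

  square : Gauss → ℚi[X].Poly
  square w = (ℚi[X].X+ (-ᶜ w)) ℚi[X].^ 2

  square₀ : ∀ w → ℚi[X].coeff (square w) 0 ≡ w *ᶜ w
  square₀ w = expand w
    where
    expand : ∀ w → -ᶜ w *ᶜ (-ᶜ w *ᶜ 1ᶜ +ᶜ 0ᶜ) +ᶜ 0ᶜ ≡ w *ᶜ w
    expand = solve-∀ gaussACR

  square₁ : ∀ w → ℚi[X].coeff (square w) 1 ≡ -ᶜ w +ᶜ -ᶜ w
  square₁ w = expand w
    where
    expand : ∀ w → -ᶜ w *ᶜ (1ᶜ *ᶜ 1ᶜ +ᶜ 0ᶜ) +ᶜ (1ᶜ *ᶜ (-ᶜ w *ᶜ 1ᶜ +ᶜ 0ᶜ) +ᶜ 0ᶜ) ≡ -ᶜ w +ᶜ -ᶜ w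
    expand = solve-∀ gaussACR

  module _ (w : Gauss) where

    coeff-*∷ : ∀ a q n → ℚi[X].coeff ((a ∷ q) ℚi[X].* square w) n
      ≡ a *ᶜ ℚi[X].coeff (square w) n +ᶜ ℚi[X].coeff (0ᶜ ∷ (q ℚi[X].* square w)) n
    coeff-*∷ a q n = trans (coeff-⊕ (map (a *ᶜ_) (square w)) (0ᶜ ∷ (q ℚi[X].* square w)) n)
      (cong (_+ᶜ ℚi[X].coeff (0ᶜ ∷ (q ℚi[X].* square w)) n) (coeff-scale a (square w) n))

    private
      zero₁ : ∀ w → 0ᶜ ≡ w *ᶜ w *ᶜ 0ᶜ
      zero₁ = solve-∀ gaussACR
      zero₂ : ∀ w → 0ᶜ ≡ w *ᶜ w *ᶜ 0ᶜ +ᶜ (-ᶜ w +ᶜ -ᶜ w) *ᶜ 0ᶜ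
      zero₂ = solve-∀ gaussACR
      zero₃ : ∀ w → 0ᶜ ≡ w *ᶜ w *ᶜ 0ᶜ +ᶜ (-ᶜ w +ᶜ -ᶜ w) *ᶜ 0ᶜ +ᶜ 0ᶜ
      zero₃ = solve-∀ gaussACR
      swap₀ : ∀ a s → a *ᶜ s +ᶜ 0ᶜ ≡ s *ᶜ a
      swap₀ = solve-∀ gaussACR
      swap₁ : ∀ a s t → a *ᶜ s +ᶜ t ≡ t +ᶜ s *ᶜ a
      swap₁ = solve-∀ gaussACR
      swap₂ : ∀ a t → a *ᶜ 1ᶜ +ᶜ t ≡ t +ᶜ a
      swap₂ = solve-∀ gaussACR
      swap₃ : ∀ a t → a *ᶜ 0ᶜ +ᶜ t ≡ t
      swap₃ = solve-∀ gaussACR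

    coeff-*square₀ : ∀ q → ℚi[X].coeff (q ℚi[X].* square w) 0 ≡ w *ᶜ w *ᶜ ℚi[X].coeff q 0
    coeff-*square₀ []      = zero₁ w
    coeff-*square₀ (a ∷ q) = trans (coeff-*∷ a q 0) (trans (cong (λ t → a *ᶜ t +ᶜ 0ᶜ) (square₀ w)) (swap₀ a (w *ᶜ w)))

    coeff-*square₁ : ∀ q → ℚi[X].coeff (q ℚi[X].* square w) 1
      ≡ w *ᶜ w *ᶜ ℚi[X].coeff q 1 +ᶜ (-ᶜ w +ᶜ -ᶜ w) *ᶜ ℚi[X].coeff q 0
    coeff-*square₁ []      = zero₂ w
    coeff-*square₁ (a ∷ q) = trans (coeff-*∷ a q 1) (trans (cong₂ (λ s t → a *ᶜ s +ᶜ t) (square₁ w) (coeff-*square₀ q))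
      (swap₁ a (-ᶜ w +ᶜ -ᶜ w) (w *ᶜ w *ᶜ ℚi[X].coeff q 0)))

    coeff-*square₂ : ∀ q k → ℚi[X].coeff (q ℚi[X].* square w) (suc (suc k))
      ≡ w *ᶜ w *ᶜ ℚi[X].coeff q (suc (suc k)) +ᶜ (-ᶜ w +ᶜ -ᶜ w) *ᶜ ℚi[X].coeff q (suc k) +ᶜ ℚi[X].coeff q k
    coeff-*square₂ []      k       = zero₃ w
    coeff-*square₂ (a ∷ q) zero    = trans (coeff-*∷ a q 2) (trans (cong (a *ᶜ 1ᶜ +ᶜ_) (coeff-*square₁ q)) (swap₂ a _))
    coeff-*square₂ (a ∷ q) (suc k) = trans (coeff-*∷ a q (suc (suc (suc k))))
      (trans (cong (a *ᶜ 0ᶜ +ᶜ_) (coeff-*square₂ q k)) (swap₃ a _))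

    module _ (p : ℚi[X].Poly) where
      private
        q r : ℚi[X].Poly
        q = quot p w
        r = quot q w

      -- Dividing twice gives p = r (X - w)² + q(w) (X - w) + p(w). So r (X - w)² - p has constant
      -- term - (p(w) - w q(w)), linear coefficient - q(w), and nothing beyond.
      remainder₀ : ℚi[X].coeff (r ℚi[X].* square w) 0 -ᶜ ℚi[X].coeff p 0 ≡ -ᶜ (ℚi[X].eval p w -ᶜ w *ᶜ ℚi[X].eval q w)
      remainder₀ = trans (cong (_-ᶜ ℚi[X].coeff p 0) (coeff-*square₀ r))
        (trans (simplify w (ℚi[X].coeff p 0) (ℚi[X].coeff q 0) (ℚi[X].coeff r 0))
          (sym (cong₂ (λ s t → -ᶜ (s -ᶜ w *ᶜ t)) (eval-quot p w) (eval-quot q w))))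
        where
        simplify : ∀ w p q r → w *ᶜ w *ᶜ r -ᶜ p ≡ -ᶜ (p +ᶜ w *ᶜ q -ᶜ w *ᶜ (q +ᶜ w *ᶜ r))
        simplify = solve-∀ gaussACR

      remainder₁ : ℚi[X].coeff (r ℚi[X].* square w) 1 -ᶜ ℚi[X].coeff p 1 ≡ -ᶜ ℚi[X].eval q w
      remainder₁ = trans (cong (_-ᶜ ℚi[X].coeff p 1) (coeff-*square₁ r))
        (trans (cong (λ t → w *ᶜ w *ᶜ ℚi[X].coeff r 1 +ᶜ (-ᶜ w +ᶜ -ᶜ w) *ᶜ t -ᶜ ℚi[X].coeff p 1) (coeff-quot q w 0))
          (trans (simplify w (ℚi[X].coeff p 1) (ℚi[X].coeff q 1) (ℚi[X].coeff r 1))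
            (sym (cong (λ t → -ᶜ t) (trans (eval-quot q w) (cong₂ (λ s t → s +ᶜ w *ᶜ t) (coeff-quot p w 0) (coeff-quot q w 0)))))))
        where
        simplify : ∀ w p q r → w *ᶜ w *ᶜ r +ᶜ (-ᶜ w +ᶜ -ᶜ w) *ᶜ (q +ᶜ w *ᶜ r) -ᶜ p
          ≡ -ᶜ (p +ᶜ w *ᶜ q +ᶜ w *ᶜ (q +ᶜ w *ᶜ r))
        simplify = solve-∀ gaussACR

      remainder₂ : ∀ k → ℚi[X].coeff (r ℚi[X].* square w) (suc (suc k)) -ᶜ ℚi[X].coeff p (suc (suc k)) ≡ 0ᶜ
      remainder₂ k = trans (cong (_-ᶜ ℚi[X].coeff p (suc (suc k))) (coeff-*square₂ r k))
        (trans (cong₂ (λ s t → w *ᶜ w *ᶜ r₂ +ᶜ (-ᶜ w +ᶜ -ᶜ w) *ᶜ s +ᶜ t -ᶜ ℚi[X].coeff p (suc (suc k)))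
                 (coeff-quot q w (suc k))
                 (trans (coeff-quot q w k) (cong₂ (λ s t → s +ᶜ w *ᶜ t) (coeff-quot p w (suc k)) (coeff-quot q w (suc k)))))
               (simplify w (ℚi[X].coeff p (suc (suc k))) (ℚi[X].coeff q (suc (suc k))) r₂))
        where
        r₂ : Gauss
        r₂ = ℚi[X].coeff r (suc (suc k))
        simplify : ∀ w p q r → w *ᶜ w *ᶜ r +ᶜ (-ᶜ w +ᶜ -ᶜ w) *ᶜ (q +ᶜ w *ᶜ r)
          +ᶜ (p +ᶜ w *ᶜ q +ᶜ w *ᶜ (q +ᶜ w *ᶜ r)) -ᶜ p ≡ 0ᶜ
        simplify = solve-∀ gaussACR

  -- A ring homomorphism on the nose, since the operations of ℝ are termwise.
  at : ℕ → ℂ → Gauss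
  at n z = ℝ.seq (ℂ.re z) n ⊹ ℝ.seq (ℂ.im z) n

  module _ (n : ℕ) where

    at-+ : ∀ p q → map (at n) (p ℂ[X].+ q) ≡ map (at n) p ℚi[X].+ map (at n) q
    at-+ []      q       = refl
    at-+ (a ∷ p) []      = refl
    at-+ (a ∷ p) (b ∷ q) = cong (at n a +ᶜ at n b ∷_) (at-+ p q)

    at-scale : ∀ a p → map (at n) (map (RawRing._*_ ℂ-rawRing a) p) ≡ map (at n a *ᶜ_) (map (at n) p)
    at-scale a []      = refl
    at-scale a (b ∷ p) = cong (at n a *ᶜ at n b ∷_) (at-scale a p)

    at-* : ∀ p q → map (at n) (p ℂ[X].* q) ≡ map (at n) p ℚi[X].* map (at n) q
    at-* []      q = refl
    at-* (a ∷ p) q = trans (at-+ (map (RawRing._*_ ℂ-rawRing a) q) (RawRing.0# ℂ-rawRing ∷ (p ℂ[X].* q)))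
      (cong₂ (λ s t → s ℚi[X].+ (0ᶜ ∷ t)) (at-scale a q) (at-* p q))

    at-eval : ∀ p z → at n (ℂ[X].eval p z) ≡ ℚi[X].eval (map (at n) p) (at n z)
    at-eval []      z = refl
    at-eval (a ∷ p) z = cong (λ t → at n a +ᶜ at n z *ᶜ t) (at-eval p z)

    at-quot : ∀ p z → map (at n) (quotℂ p z) ≡ quot (map (at n) p) (at n z)
    at-quot []      z = refl
    at-quot (a ∷ p) z = cong₂ _∷_ (at-eval p z) (at-quot p z)

    at-coeff : ∀ p j → at n (ℂ[X].coeff p j) ≡ ℚi[X].coeff (map (at n) p) j
    at-coeff []      j       = refl
    at-coeff (a ∷ p) zero    = refl
    at-coeff (a ∷ p) (suc j) = at-coeff p j

    at-fromℤ : ∀ (f : Poly) → map (at n) (map fromℤ f) ≡ map ofℤ f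
    at-fromℤ []      = refl
    at-fromℤ (a ∷ f) = cong (ofℤ a ∷_) (at-fromℤ f)

  eval-ofℤ : ∀ f z → ℚi[X].eval (map ofℤ f) z ≡ evᶜ f z
  eval-ofℤ []      z = refl
  eval-ofℤ (a ∷ f) z = cong (λ t → ofℤ a +ᶜ z *ᶜ t) (eval-ofℤ f z)

  -- At X = z the quotient (f(X) - f(z)) / (X - z) takes the value f′(z).
  eval-quot-ofℤ : ∀ f z → ℚi[X].eval (quot (map ofℤ f) z) z ≡ evᶜ (deriv f) z
  eval-quot-ofℤ []      z = refl
  eval-quot-ofℤ (a ∷ f) z = trans (cong₂ (λ s t → s +ᶜ z *ᶜ t) (eval-ofℤ f z) (eval-quot-ofℤ f z)) (sym (evᶜ-deriv-∷ a f z))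

  module Limit (root : ℕ → Gauss) (close : ∀ n k → norm (root (k ℕ.+ n) -ᶜ root n) ≤ ½^ n) where

    open ≤-Reasoning

    cauchy : ∀ ε → 0ℚ < ε → ∃[ N ] (∀ m n → N ℕ.≤ m → N ℕ.≤ n → norm (root m -ᶜ root n) < ε)
    cauchy ε 0<ε = let (N , h) = ½^-small 2ℚ ε 0<ε in N , λ m n N≤m N≤n → begin-strict
      norm (root m -ᶜ root n)
        ≡⟨ cong norm (insert (root m) (root N) (root n)) ⟩
      norm (root m -ᶜ root N -ᶜ (root n -ᶜ root N))
        ≤⟨ norm-−≤ (root m -ᶜ root N) (root n -ᶜ root N) ⟩
      norm (root m -ᶜ root N) + norm (root n -ᶜ root N)
        ≤⟨ +-mono-≤ (near m N N≤m) (near n N N≤n) ⟩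
      ½^ N + ½^ N
        ≡⟨ solve 1 (λ h → h :+ h := con 2ℚ :* h) refl (½^ N) ⟩
      2ℚ * ½^ N
        <⟨ h N ℕ.≤-refl ⟩
      ε ∎
      where
      open +-*-Solver
      insert : ∀ x y z → x -ᶜ z ≡ x -ᶜ y -ᶜ (z -ᶜ y)
      insert = solve-∀ gaussACR
      near : ∀ m N → N ℕ.≤ m → norm (root m -ᶜ root N) ≤ ½^ N
      near m N N≤m = subst (λ k → norm (root k -ᶜ root N) ≤ ½^ N) (ℕ.m∸n+n≡m N≤m) (close N (m ℕ.∸ N))

    limit : ℂ
    limit = record
      { re = record { seq = λ n → Re (root n) ; cauchy = λ ε 0<ε → let (N , h) = cauchy ε 0<ε in
          N , λ m n m≥ n≥ → ≤-<-trans (∣Re-Re∣≤norm (root m) (root n)) (h m n m≥ n≥) }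
      ; im = record { seq = λ n → Im (root n) ; cauchy = λ ε 0<ε → let (N , h) = cauchy ε 0<ε in
          N , λ m n m≥ n≥ → ≤-<-trans (∣Im-Im∣≤norm (root m) (root n)) (h m n m≥ n≥) } }

    at-limit : ∀ n → at n limit ≡ root n
    at-limit n = η (root n)
      where
      η : ∀ x → (Re x ⊹ Im x) ≡ x
      η (a ⊹ b) = refl

    module _ (f : Poly) (B C : ℚ) (0≤B : 0ℚ ≤ B) (0≤C : 0ℚ ≤ C) (root≤B : ∀ n → norm (root n) ≤ B)
      (f≤ : ∀ n → norm (evᶜ f (root n)) ≤ C * ½^ n) (f′≤ : ∀ n → norm (evᶜ (deriv f) (root n)) ≤ C * ½^ n) where

      -- Formed in ℂ[X] at the limit itself. Its n-th terms are the quotient at `root n`, whose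
      -- remainder involves only f and f′ at `root n`; their convergence to 0 takes the place of a
      -- continuity argument.
      quotient : ℂ[X].Poly
      quotient = quotℂ (quotℂ (map fromℤ f) limit) limit

      product : ℂ[X].Poly
      product = quotient ℂ[X].* ((ℂ[X].X+ (RawRing.-_ ℂ-rawRing limit)) ℂ[X].^ 2)

      C′ : ℚ
      C′ = C + B * C

      0≤Ch : ∀ n → 0ℚ ≤ C * ½^ n
      0≤Ch n = 0≤* 0≤C (0≤½^ n)

      C≤C′ : ∀ n → C * ½^ n ≤ C′ * ½^ n
      C≤C′ n = *-monoʳ (½^ n) (0≤½^ n) (p≤p+q C (0≤* 0≤B 0≤C))

      product-at : ∀ n j → at n (ℂ[X].coeff product j) ≡ ℚi[X].coeff (quot (quot (map ofℤ f) (root n)) (root n) ℚi[X].* square (root n)) j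
      product-at n j = trans (at-coeff n product j) (cong (λ p → ℚi[X].coeff p j)
        (trans (at-* n quotient ((ℂ[X].X+ (RawRing.-_ ℂ-rawRing limit)) ℂ[X].^ 2))
          (trans (cong (ℚi[X]._* square (at n limit)) (trans (at-quot n (quotℂ (map fromℤ f) limit) limit)
             (cong (λ p → quot p (at n limit)) (trans (at-quot n (map fromℤ f) limit) (cong (λ p → quot p (at n limit)) (at-fromℤ n f))))))
            (cong (λ z → quot (quot (map ofℤ f) z) z ℚi[X].* square z) (at-limit n)))))

      f-at : ∀ n j → at n (ℂ[X].coeff (map fromℤ f) j) ≡ ℚi[X].coeff (map ofℤ f) j
      f-at n j = trans (at-coeff n (map fromℤ f) j) (cong (λ p → ℚi[X].coeff p j) (at-fromℤ n f))

      difference≤ : ∀ n j → norm (at n (ℂ[X].coeff product j) -ᶜ at n (ℂ[X].coeff (map fromℤ f) j)) ≤ C′ * ½^ n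
      difference≤ n j = ≤-trans (≤-reflexive (cong₂ (λ x y → norm (x -ᶜ y)) (product-at n j) (f-at n j))) (go j)
        where
        z : Gauss
        z = root n
        F : ℚi[X].Poly
        F = map ofℤ f
        go : ∀ j → norm (ℚi[X].coeff (quot (quot F z) z ℚi[X].* square z) j -ᶜ ℚi[X].coeff F j) ≤ C′ * ½^ n
        go zero = begin
          norm (ℚi[X].coeff (quot (quot F z) z ℚi[X].* square z) 0 -ᶜ ℚi[X].coeff F 0)
            ≡⟨ trans (cong norm (remainder₀ z F)) (norm-neg (ℚi[X].eval F z -ᶜ z *ᶜ ℚi[X].eval (quot F z) z)) ⟩
          norm (ℚi[X].eval F z -ᶜ z *ᶜ ℚi[X].eval (quot F z) z)
            ≡⟨ cong₂ (λ s t → norm (s -ᶜ z *ᶜ t)) (eval-ofℤ f z) (eval-quot-ofℤ f z) ⟩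
          norm (evᶜ f z -ᶜ z *ᶜ evᶜ (deriv f) z)
            ≤⟨ ≤-trans (norm-−≤ (evᶜ f z) (z *ᶜ evᶜ (deriv f) z))
                 (+-mono-≤ (f≤ n) (norm-*≤-mono z (evᶜ (deriv f) z) (root≤B n) (f′≤ n))) ⟩
          C * ½^ n + B * (C * ½^ n)
            ≡⟨ solve 3 (λ b c h → c :* h :+ b :* (c :* h) := (c :+ b :* c) :* h) refl B C (½^ n) ⟩
          C′ * ½^ n ∎
          where open +-*-Solver
        go (suc zero) = begin
          norm (ℚi[X].coeff (quot (quot F z) z ℚi[X].* square z) 1 -ᶜ ℚi[X].coeff F 1)
            ≡⟨ trans (cong norm (remainder₁ z F)) (norm-neg (ℚi[X].eval (quot F z) z)) ⟩
          norm (ℚi[X].eval (quot F z) z)   ≡⟨ cong norm (eval-quot-ofℤ f z) ⟩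
          norm (evᶜ (deriv f) z)           ≤⟨ f′≤ n ⟩
          C * ½^ n                         ≤⟨ C≤C′ n ⟩
          C′ * ½^ n                        ∎
        go (suc (suc k)) = begin
          norm (ℚi[X].coeff (quot (quot F z) z ℚi[X].* square z) (suc (suc k)) -ᶜ ℚi[X].coeff F (suc (suc k)))
            ≡⟨ trans (cong norm (remainder₂ z F k)) norm-0 ⟩
          0ℚ                               ≤⟨ 0≤Ch n ⟩
          C * ½^ n                         ≤⟨ C≤C′ n ⟩
          C′ * ½^ n                        ∎

      repeated-root : IsRepeatedRoot f limit
      repeated-root = quotient , λ j →
        (λ ε 0<ε → let (N , h) = ½^-small C′ ε 0<ε in N , λ n N≤n →
          ≤-<-trans (≤-trans (∣Re-Re∣≤norm (at n (ℂ[X].coeff product j)) (at n (ℂ[X].coeff (map fromℤ f) j))) (difference≤ n j)) (h n N≤n)) ,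
        (λ ε 0<ε → let (N , h) = ½^-small C′ ε 0<ε in N , λ n N≤n →
          ≤-<-trans (≤-trans (∣Im-Im∣≤norm (at n (ℂ[X].coeff product j)) (at n (ℂ[X].coeff (map fromℤ f) j))) (difference≤ n j)) (h n N≤n))

  -- A small value of g starts Newton's method for g; f and f′ tend to 0 along the resulting
  -- sequence because g divides both.
  module CommonRoot (f : Poly) (g : Poly) (g∣f : ⌈ g ⌉ ∣ᵖ ⌈ f ⌉) (g∣f′ : ⌈ g ⌉ ∣ᵖ D ⌈ f ⌉) (a b : Pol) (k : ℤ) (k≢0 : k ≢ 0ℤ)
    (bezout : a *ᵖ ⌈ g ⌉ +ᵖ b *ᵖ D ⌈ g ⌉ ≐ constᵖ k) (B₀ : ℚ) (0≤B₀ : 0ℚ ≤ B₀)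
    (approximate : ∀ m → 0ℚ < m → ∃[ z ] (norm z ≤ B₀ × norm (evᶜ g z) < m)) where

    bezoutᶜ : ∀ z → evᶜ (code a) z *ᶜ evᶜ g z +ᶜ evᶜ (code b) z *ᶜ evᶜ (deriv g) z ≡ ofℤ k
    bezoutᶜ z = trans (sym (trans (evᶜ-⊕ (code a ⊗ g) (code b ⊗ deriv g) z) (cong₂ _+ᶜ_ (evᶜ-⊗ (code a) g z) (evᶜ-⊗ (code b) (deriv g) z))))
      (trans (evᶜ-cong (a *ᵖ ⌈ g ⌉ +ᵖ b *ᵖ D ⌈ g ⌉) (constᵖ k) bezout z) (evᶜ-const k z))

    open Newton g (code a) (code b) (ofℤ k) (norm-ofℤ≥1 k k≢0) bezoutᶜ B₀ 0≤B₀ using (tolerance; 0<tolerance; B; 0≤B; module Sequence)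

    start = approximate tolerance 0<tolerance

    open Sequence (proj₁ start) (proj₁ (proj₂ start)) (<⇒≤ (proj₂ (proj₂ start)))

    C₁ C₂ : ℚ
    C₁ = 2ℚ * bound (code (_∣ᵖ_.r g∣f)) B
    C₂ = 2ℚ * bound (code (_∣ᵖ_.r g∣f′)) B

    0≤C₁ : 0ℚ ≤ C₁
    0≤C₁ = 0≤* 0≤2 (0≤bound (code (_∣ᵖ_.r g∣f)) 0≤B)

    0≤C₂ : 0ℚ ≤ C₂
    0≤C₂ = 0≤* 0≤2 (0≤bound (code (_∣ᵖ_.r g∣f′)) 0≤B)

    close : ∀ n k → norm (root (k ℕ.+ n) -ᶜ root n) ≤ ½^ n
    close n k = ≤-trans (root-close n k) (subst (½^ n - ½^ (k ℕ.+ n) ≤_) (+-identityʳ (½^ n)) (+-monoʳ-≤ (½^ n) (neg-antimono-≤ (0≤½^ (k ℕ.+ n)))))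

    common-root : ∃[ z ] IsRepeatedRoot f z
    common-root = Limit.limit root close , Limit.repeated-root root close f B (C₁ + C₂) 0≤B (0≤+ 0≤C₁ 0≤C₂) root≤B
      (λ n → ≤-trans (norm-≤-∣ ⌈ g ⌉ ⌈ f ⌉ g∣f (root n) (root≤B n) (g-root≤ n)) (*-monoʳ {C₁} {C₁ + C₂} (½^ n) (0≤½^ n) (p≤p+q C₁ 0≤C₂)))
      (λ n → ≤-trans (norm-≤-∣ ⌈ g ⌉ (D ⌈ f ⌉) g∣f′ (root n) (root≤B n) (g-root≤ n)) (*-monoʳ {C₂} {C₁ + C₂} (½^ n) (0≤½^ n) (q≤p+q C₂ 0≤C₁)))

  -- Otherwise f and f′ share a nonconstant factor; a squarefree factor of it has a complex root,
  -- which is a repeated root of f.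
  separable⇒squarefree : ∀ f → NonZeroᵖ ⌈ f ⌉ → Separable f → Squarefreeᵖ ⌈ f ⌉
  separable⇒squarefree f nz sep = decide (squarefree-or-common-factor ⌈ f ⌉ nz)
    where
    conclude : ∀ d → d ∣ᵖ ⌈ f ⌉ → d ∣ᵖ D ⌈ f ⌉ → SquarefreeFactor d → ⊥
    conclude d d∣f d∣f′ (a , p , γ , γ≢0 , (u , v , k , k≢0 , bezout) , g∣d) = let
        (B₀ , 0≤B₀ , approximate) = approximate-root a p γ γ≢0
        (z , rr) = CommonRoot.common-root f (a ∷ p ∷ʳ γ) (∣-trans _ d _ g∣d d∣f) (∣-trans _ d _ g∣d d∣f′)
                     u v k k≢0 bezout B₀ 0≤B₀ approximate
      in sep z rr
    decide : Squarefreeᵖ ⌈ f ⌉ ⊎ NonconstantFactor ⌈ f ⌉ → Squarefreeᵖ ⌈ f ⌉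
    decide (inj₁ sqf) = sqf
    decide (inj₂ (a , q , γ , γ≢0 , d∣f , d∣f′)) = ⊥-elim (conclude ⌈ a ∷ q ∷ʳ γ ⌉ d∣f d∣f′ (squarefree-factor _ a q γ γ≢0 ℕ.≤-refl))

open import Data.Integer.Base using (ℤ; _+_)
open import Data.Nat.Base using (ℕ; _<_; _≤_)
open import Data.Product.Base using (_×_; _,_; ∃-syntax)
open import Data.Vec.Functional using (Vector)
open import Function.Definitions using (Injective)
open import Relation.Binary.PropositionalEquality using (_≡_)
open ℤ[X] using (Poly; eval; X+_; _≈_; _∣_; _^_; ∏)

corollary1p7 : ABC-Conjecture →
    (f : Poly) → Nonconstant f →
    (m : ℕ) → 0 < m → (q : Vector ℤ m) →
    ( Separable f →
    (∃[ d ] (HasDegree f d × 2 < d)) →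
    (∀ j → ((X+ q j) ^ 2) ∣ ∏ (λ i → X+ q i)) →
    FinitelyMany {ℤ × ℤ} (λ (x , y) → ∏ℤ (λ i → y + q i) ≡ eval f x) )
    ×
    ( 2 < m →
    Injective _≡_ _≡_ q →
    (k : ℕ) → 0 < k → (g : Vector Poly k) → (l : Vector ℕ k) →
    (∀ i → 2 ≤ l i) →
    f ≈ ∏ (λ i → g i ^ l i) →
    FinitelyMany {ℤ × ℤ} (λ (x , y) → ∏ℤ (λ i → y + q i) ≡ eval f x) )
corollary1p7 abc f f-nonconstant m 0<m q =
  (λ separable (d , degree , 2<d) squares → finite-when-product-powerful abc f m q 0<m
    (separable⇒squarefree f (degree⇒NonZero f d degree) separable) d degree 2<d squares) ,
  (λ 2<m distinct k _ g l 2≤l f≈ → finite-when-f-powerful abc f m q f-nonconstant 2<m distinct k g l 2≤l f≈)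
  where
  open FiniteSolutionSets
  open RepeatedRoots using (separable⇒squarefree)
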